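{- Let $q$ be an odd prime power, $\beta\in\mathbb{F}_q^*$, and let $\theta_1,\theta_2\in\mathbb{F}_{q^2}$ form an $\mathbb{F}_q$-basis of $\mathbb{F}_{q^2}$ with $\mathrm{Tr}(\theta_1)=\beta$, $\mathrm{Tr}(\theta_2)=0$. Write $q^2-1=2^\ell q_2$ with $q_2$ odd and let $q_2'$ be the product of the distinct primes dividing $q_2$. Write $q_2'=kp_1\cdots p_s$ with $p_1,\dots,p_s$ distinct primes (not dividing $k$), ordered so that $p_i\mid q+1$ for $1\le i\le r$ and $p_i\nmid q+1$ for $r<i\le s$. Let $\varepsilon=1-\sum_{i=1}^s\frac1{p_i}$ ($\varepsilon=1$ if $s=0$), $\varepsilon'=1-\sum_{i=1}^r\frac1{p_i}$, and let $k_1$ be the product of the primes dividing $k$ which divide $q+1$. Assume $\varepsilon>0$. For $m\mid q_2'$ let $\mathcal{Q}_m$ be the number of $\alpha\in\mathbb{F}_q$ such that $\theta_1+\alpha\theta_2$ is $m$-free, a square in $\mathbb{F}_{q^2}$, and not a fourth power in $\mathbb{F}_{q^2}$. (1) If $q\equiv1\pmod4$ and $$q+1>4\left[W(k)\left(\frac{s-1}{\varepsilon}+2\right)\sqrt q-W(k_1)\left(\frac{r-1+\varepsilon'}{\varepsilon}+1\right)\frac{\sqrt q-1}{2}\right],$$ then $\mathcal{Q}_{q_2'}\ne0$. (2) If $q\equiv3\pmod4$ and $$q+1>4\left[W(k)\left(\frac{s-1}{\varepsilon}+2\right)\sqrt q-W(k_1)\left(\frac{r-1+\varepsilon'}{\varepsilon}+1\right)(\sqrt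 q-1)\right],$$ then $\mathcal{Q}_{q_2'}\ne0$. In particular, $\mathcal{Q}_{q_2'}>0$ whenever $\sqrt q\ge 4W(k)\left(\frac{s-1}{\varepsilon}+2\right)$.
   Context: $\mathrm{Tr}:\mathbb{F}_{q^2}\to\mathbb{F}_q$ is $\xi\mapsto\xi+\xi^q$. For a divisor $m$ of $q^2-1$, $\xi\in\mathbb{F}_{q^2}^*$ is $m$-free if $\xi=\zeta^d$ with $d\mid m$, $\zeta\in\mathbb{F}_{q^2}^*$ implies $d=1$. $W(m)=2^{\nu(m)}$ with $\nu(m)$ the number of distinct prime divisors of $m$. -}

module Defs where

open import Level using (0ℓ)
open import Algebra.Bundles using (CommutativeRing)
open import Data.Nat as ℕ using (ℕ; zero; suc; _∸_)
open import Data.Nat.Divisibility using (_∣_; _∣?_)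
open import Data.Nat.Primality using (Prime; prime?)
open import Data.Fin using (Fin)
open import Data.List using (List; []; _∷_; length; filter; upTo; foldr; map)
open import Data.Nat.ListAction using (product)
open import Data.List.Membership.Propositional using (_∈_)
open import Data.List.Relation.Unary.Unique.Propositional using (Unique)
open import Data.List.Relation.Unary.All using (All)
open import Data.Integer as ℤ using (ℤ; +_)
open import Data.Rational as ℚ using (ℚ; 0ℚ; 1ℚ)
open import Data.Rational.Properties using () renaming (_≟_ to _≟ℚ_)
open import Data.Product using (Σ; ∃; _×_; _,_)
open import Data.Sum using (_⊎_)
open import Relation.Nullary using (¬_; yes; no)
open import Relation.Nullary.Decidable using (_×-dec_)
open import Relation.Binary.PropositionalEquality using (_≡_)
open import Function.Bundles using (_⇔_)

record FiniteField (n : ℕ) : Set₁ where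
  field
    commRing : CommutativeRing 0ℓ 0ℓ
  open CommutativeRing commRing public hiding (refl)
  field
    1≉0     : ¬ (1# ≈ 0#)
    inverse : ∀ x → ¬ (x ≈ 0#) → ∃ λ y → x * y ≈ 1#
    toFin      : Carrier → Fin n
    fromFin    : Fin n → Carrier
    toFin-cong : ∀ {x y} → x ≈ y → toFin x ≡ toFin y
    from∘to    : ∀ x → fromFin (toFin x) ≈ x
    to∘from    : ∀ i → toFin (fromFin i) ≡ i

-- Notions inside a finite field F (intended: F = 𝔽_{q²}, q given).

module _ {n : ℕ} (F : FiniteField n) (q : ℕ) where
  open FiniteField F

  pow : Carrier → ℕ → Carrier
  pow x zero    = 1#
  pow x (suc d) = x * pow x d

  Tr : Carrier → Carrier
  Tr ξ = ξ + pow ξ q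

  -- membership in the subfield 𝔽_q = { x | x^q = x } of 𝔽_{q²}
  InFq : Carrier → Set
  InFq x = pow x q ≈ x

  IsFqBasis : Carrier → Carrier → Set
  IsFqBasis θ₁ θ₂ =
    (∀ a b → InFq a → InFq b → (a * θ₁ + b * θ₂) ≈ 0# → (a ≈ 0#) × (b ≈ 0#))
    × (∀ ξ → ∃ λ a → ∃ λ b → InFq a × InFq b × (ξ ≈ (a * θ₁ + b * θ₂)))

  IsFree : ℕ → Carrier → Set
  IsFree m ξ = ¬ (ξ ≈ 0#) ×
    (∀ (d : ℕ) (ζ : Carrier) → d ∣ m → ¬ (ζ ≈ 0#) → ξ ≈ pow ζ d → d ≡ 1)

  IsSquare : Carrier → Set
  IsSquare ξ = ∃ λ ζ → ξ ≈ pow ζ 2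

  IsFourthPower : Carrier → Set
  IsFourthPower ξ = ∃ λ ζ → ξ ≈ pow ζ 4

  Counted : Carrier → Carrier → ℕ → Carrier → Set
  Counted θ₁ θ₂ m α =
    InFq α × IsFree m (θ₁ + α * θ₂) × IsSquare (θ₁ + α * θ₂)
      × ¬ IsFourthPower (θ₁ + α * θ₂)

  QNonzero : Carrier → Carrier → ℕ → Set
  QNonzero θ₁ θ₂ m = ∃ λ α → Counted θ₁ θ₂ m α

  Setup : Carrier → Carrier → Carrier → Set
  Setup β θ₁ θ₂ = InFq β × ¬ (β ≈ 0#) × IsFqBasis θ₁ θ₂
    × (Tr θ₁ ≈ β) × (Tr θ₂ ≈ 0#)

OddPrimePower : ℕ → Set
OddPrimePower q = ∃ λ p → ∃ λ e → Prime p × ¬ (2 ∣ p) × 1 ℕ.≤ e × q ≡ p ℕ.^ e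

-- the distinct primes dividing n (for n ≥ 1)
primeDivisors : ℕ → List ℕ
primeDivisors n = filter (λ p → prime? p ×-dec p ∣? n) (upTo (suc n))

ν : ℕ → ℕ
ν m = length (primeDivisors m)

W : ℕ → ℕ
W m = 2 ℕ.^ ν m

IsRadicalOf : ℕ → ℕ → Set
IsRadicalOf n r = ∃ λ (L : List ℕ) → Unique L × All Prime L
  × (∀ p → Prime p → (p ∣ n ⇔ p ∈ L)) × product L ≡ r

k₁Of : ℕ → ℕ → ℕ
k₁Of k q = product (filter (λ p → p ∣? (q ℕ.+ 1)) (primeDivisors k))

ℕ→ℚ : ℕ → ℚ
ℕ→ℚ n = + n ℚ./ 1

-- 1/p (with 1/0 := 0, never used on primes)
recipℕ : ℕ → ℚ
recipℕ zero    = 0ℚ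
recipℕ (suc n) = + 1 ℚ./ suc n

-- division in ℚ, with x/0 := 0 (only used with positive divisor ε)
_÷ℚ_ : ℚ → ℚ → ℚ
x ÷ℚ y with y ≟ℚ 0ℚ
... | yes _  = 0ℚ
... | no y≢0 = ℚ._÷_ x y {{ℚ.≢-nonZero y≢0}}

sumRecip : List ℕ → ℚ
sumRecip ps = foldr ℚ._+_ 0ℚ (map recipℕ ps)

-- comparisons of a rational with c·√q (q ∈ ℕ), without real numbers:
-- "x > c·√q"
GtCSqrt : ℚ → ℚ → ℕ → Set
GtCSqrt x c q =
  (c ℚ.< 0ℚ × (0ℚ ℚ.≤ x ⊎ x ℚ.* x ℚ.< c ℚ.* c ℚ.* ℕ→ℚ q))
  ⊎ (0ℚ ℚ.≤ c × 0ℚ ℚ.≤ x × c ℚ.* c ℚ.* ℕ→ℚ q ℚ.< x ℚ.* x)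

SqrtGe : ℕ → ℚ → Set
SqrtGe q y = y ℚ.≤ 0ℚ ⊎ y ℚ.* y ℚ.≤ ℕ→ℚ q

GtAffineSqrt : ℚ → ℚ → ℚ → ℕ → Set
GtAffineSqrt x a b q = GtCSqrt (x ℚ.- b) a q

{-# OPTIONS --safe #-}

-- Characters of F* = 𝔽_{q²}* are replaced by rational kernels K(x, y), the averages of χ(x/y) over all characters χ
-- of a given order. These kernels are positive semidefinite, so Cauchy–Schwarz bounds the sum T of K(θ₁ + αθ₂, 1)
-- over α ∈ 𝔽_q by T² ≤ M, where M is the sum of K over all pairs of points of the line. The quotients of distinct
-- points of the line run exactly once over 𝔽_{q²} ∖ 𝔽_q, so M = q + Σ_{F*} K(z, 1) − Σ_{𝔽_q*} K(z, 1). For an order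
-- greater than 1 the first sum vanishes; the second is nonnegative, and equals q − 1 if the order divides q + 1.
-- Hence |T| ≤ √q, and |T| ≤ 1 if the order divides q + 1. Writing the indicator functions of k-free elements and of
-- squares that are not fourth powers as combinations of kernels, and sieving with ∏(1 − s_p) ≥ 1 − ∑ s_p, where s_p
-- is the indicator function of the p-th powers, shows that 𝒬 = 0 contradicts the hypotheses.
-- Real numbers are avoided by proving all estimates for every rational r ≥ √q; a suitable r is chosen at the end.

module Submission where

-- A single character has values in a cyclotomic field; its average over all characters of one exact
-- order is Galois invariant, hence rational, and is a combination of indicators of power residue
-- classes. So neither complex roots of unity nor a generator of F* is needed: for d dividing N =
-- |F*|, a nonzero x is a d-th power exactly if x^(N/d) = 1, which follows by counting roots of
-- polynomials. Semidefiniteness survives products because each factor is, up to a positive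
-- constant, its own Gram matrix. The indicator of the squares that are not fourth powers is (1 + u₂
-- - 2u₄)/4, with u₂ the quadratic character and u₄ the mean of the two quartic ones; the weights 1,
-- 1, 2 add up to the constant 4 of the theorem. Savings over √q come from characters trivial on
-- 𝔽_q*. Of the four characters of order 1, 2, 4, two always are, and all four are when 4 divides q
-- + 1: this is the difference between (1) and (2). The indicator of k-free elements is left
-- unnormalised, as a product of terms 1 - u_p; its expansion has coefficients ±1, so W(k) counts
-- its terms.

-- Rational arithmetic and indicator functions.

module RationalLemmas where

  open import Defs using (ℕ→ℚ; recipℕ; _÷ℚ_)
  open import Level using (0ℓ)
  open import Data.Empty using (⊥-elim)
  open import Data.Integer as ℤ using (+_)
  import Data.Integer.Properties as ℤ
  open import Data.Maybe using (Maybe; just; nothing)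
  open import Data.Nat as ℕ using (ℕ; zero; suc)
  import Data.Nat.Properties as ℕ
  open import Data.Product using (_×_; _,_)
  open import Data.Rational
  open import Data.Rational.Properties
  import Data.Rational.Unnormalised as ℚᵘ
  import Data.Rational.Unnormalised.Properties as ℚᵘ
  open import Data.Sum using (inj₁; inj₂)
  open import Relation.Nullary using (¬_; Dec; yes; no)
  open import Relation.Binary.PropositionalEquality
  open import Tactic.RingSolver using (solve-∀)
  open import Tactic.RingSolver.Core.AlmostCommutativeRing using (AlmostCommutativeRing; fromCommutativeRing)

  ringℚ : AlmostCommutativeRing 0ℓ 0ℓ
  ringℚ = fromCommutativeRing +-*-commutativeRing isZero
    where
    isZero : ∀ x → Maybe (0ℚ ≡ x)
    isZero x with 0ℚ ≟ x
    ... | yes e = just e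
    ... | no _  = nothing

  0≤⇒≤ : ∀ {a b} → 0ℚ ≤ b - a → a ≤ b
  0≤⇒≤ {a} {b} h = subst₂ _≤_ (+-identityʳ a) (eq a b) (+-monoʳ-≤ a h)
    where
    eq : ∀ a b → a + (b - a) ≡ b
    eq = solve-∀ ringℚ

  ≤⇒0≤ : ∀ {a b} → a ≤ b → 0ℚ ≤ b - a
  ≤⇒0≤ {a} {b} h = subst (_≤ b - a) (+-inverseʳ a) (+-monoˡ-≤ (- a) h)

  0<⇒< : ∀ {a b} → 0ℚ < b - a → a < b
  0<⇒< {a} {b} h = subst₂ _<_ (+-identityʳ a) (eq a b) (+-monoʳ-< a h)
    where
    eq : ∀ a b → a + (b - a) ≡ b
    eq = solve-∀ ringℚ

  <⇒0< : ∀ {a b} → a < b → 0ℚ < b - a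
  <⇒0< {a} {b} h = subst (_< b - a) (+-inverseʳ a) (+-monoˡ-< (- a) h)

  -- The usual form of an inequality proof below: the ring solver rewrites the difference as an
  -- expression whose sign is evident.
  ≤-from : ∀ {a b c} → 0ℚ ≤ c → b - a ≡ c → a ≤ b
  ≤-from h eq = 0≤⇒≤ (subst (0ℚ ≤_) (sym eq) h)

  <-from : ∀ {a b c} → 0ℚ < c → b - a ≡ c → a < b
  <-from h eq = 0<⇒< (subst (0ℚ <_) (sym eq) h)

  0≤+ : ∀ {a b} → 0ℚ ≤ a → 0ℚ ≤ b → 0ℚ ≤ a + b
  0≤+ = +-mono-≤

  0≤* : ∀ {a b} → 0ℚ ≤ a → 0ℚ ≤ b → 0ℚ ≤ a * b
  0≤* {a} {b} ha hb =
    nonNegative⁻¹ (a * b) {{nonNeg*nonNeg⇒nonNeg a {{nonNegative ha}} b {{nonNegative hb}}}}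

  0<* : ∀ {a b} → 0ℚ < a → 0ℚ < b → 0ℚ < a * b
  0<* {a} {b} ha hb =
    positive⁻¹ (a * b) {{pos*pos⇒pos a {{positive ha}} b {{positive hb}}}}

  0≤neg : ∀ {a} → a ≤ 0ℚ → 0ℚ ≤ - a
  0≤neg = neg-antimono-≤

  0≤sq : ∀ a → 0ℚ ≤ a * a
  0≤sq a with ≤-total 0ℚ a
  ... | inj₁ h = 0≤* h h
  ... | inj₂ h = subst (0ℚ ≤_) (eq a) (0≤* (0≤neg h) (0≤neg h))
    where
    eq : ∀ a → (- a) * (- a) ≡ a * a
    eq = solve-∀ ringℚ

  0≤1 : 0ℚ ≤ 1ℚ
  0≤1 = nonNegative⁻¹ 1ℚ

  ≤-cancel* : ∀ {c a b} → 0ℚ < c → c * a ≤ c * b → a ≤ b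
  ≤-cancel* {c} h = *-cancelˡ-≤-pos c {{positive h}}

  sq-cancel-≤ : ∀ {a b} → 0ℚ ≤ b → a * a ≤ b * b → a ≤ b
  sq-cancel-≤ {a} {b} hb h with a ≤? b
  ... | yes p = p
  ... | no ¬p = ⊥-elim (<-irrefl refl (<-≤-trans b²<a² h))
    where
    b<a : b < a
    b<a = ≰⇒> ¬p
    eq : ∀ a b → a * a - b * b ≡ (a - b) * (b + a)
    eq = solve-∀ ringℚ
    b²<a² : b * b < a * a
    b²<a² = <-from (0<* (<⇒0< b<a) (+-mono-≤-< hb (≤-<-trans hb b<a))) (eq a b)

  sq-cancel-≡ : ∀ {a b} → 0ℚ ≤ a → 0ℚ ≤ b → a * a ≡ b * b → a ≡ b
  sq-cancel-≡ ha hb e =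
    ≤-antisym (sq-cancel-≤ hb (≤-reflexive e)) (sq-cancel-≤ ha (≤-reflexive (sym e)))

  -- An absolute value bound kept as two one-sided bounds; the sieve picks the side that it needs
  -- for each term.
  ∣_∣≤_ : ℚ → ℚ → Set
  ∣ x ∣≤ b = (x ≤ b) × (- x ≤ b)

  sq≤⇒∣∣≤ : ∀ {x b} → 0ℚ ≤ b → x * x ≤ b * b → ∣ x ∣≤ b
  sq≤⇒∣∣≤ {x} hb h = sq-cancel-≤ hb h , sq-cancel-≤ hb (subst (_≤ _) (eq x) h)
    where
    eq : ∀ x → x * x ≡ (- x) * (- x)
    eq = solve-∀ ringℚ

  ∣-∣≤ : ∀ {x y a b} → ∣ x ∣≤ a → ∣ y ∣≤ b → ∣ x - y ∣≤ (a + b)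
  ∣-∣≤ {x} {y} (h₁ , h₂) (k₁ , k₂) =
    +-mono-≤ h₁ k₂ , subst (_≤ _) (eq x y) (+-mono-≤ h₂ k₁)
    where
    eq : ∀ x y → - x + y ≡ - (x - y)
    eq = solve-∀ ringℚ

  ℕ→ℚ-suc : ∀ n → ℕ→ℚ (suc n) ≡ 1ℚ + ℕ→ℚ n
  ℕ→ℚ-suc n = toℚᵘ-injective (begin
    toℚᵘ (ℕ→ℚ (suc n))               ≈⟨ toℚᵘ-fromℚᵘ (ℚᵘ.mkℚᵘ (+ suc n) 0) ⟩
    ℚᵘ.mkℚᵘ (+ suc n) 0              ≈⟨ ℚᵘ.*≡* (cong (λ z → (+ 1 ℤ.+ z) ℤ.* + 1) (sym (ℤ.*-identityʳ (+ n)))) ⟩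
    toℚᵘ 1ℚ ℚᵘ.+ ℚᵘ.mkℚᵘ (+ n) 0     ≈⟨ ℚᵘ.+-congʳ (toℚᵘ 1ℚ) (toℚᵘ-fromℚᵘ (ℚᵘ.mkℚᵘ (+ n) 0)) ⟨
    toℚᵘ 1ℚ ℚᵘ.+ toℚᵘ (ℕ→ℚ n)        ≈⟨ toℚᵘ-homo-+ 1ℚ (ℕ→ℚ n) ⟨
    toℚᵘ (1ℚ + ℕ→ℚ n)                ∎)
    where open ℚᵘ.≃-Reasoning

  ℕ→ℚ-+ : ∀ m n → ℕ→ℚ (m ℕ.+ n) ≡ ℕ→ℚ m + ℕ→ℚ n
  ℕ→ℚ-+ zero    n = sym (+-identityˡ (ℕ→ℚ n))
  ℕ→ℚ-+ (suc m) n = begin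
    ℕ→ℚ (suc (m ℕ.+ n))         ≡⟨ ℕ→ℚ-suc (m ℕ.+ n) ⟩
    1ℚ + ℕ→ℚ (m ℕ.+ n)          ≡⟨ cong (_+_ 1ℚ) (ℕ→ℚ-+ m n) ⟩
    1ℚ + (ℕ→ℚ m + ℕ→ℚ n)        ≡⟨ +-assoc 1ℚ (ℕ→ℚ m) (ℕ→ℚ n) ⟨
    1ℚ + ℕ→ℚ m + ℕ→ℚ n          ≡⟨ cong (_+ ℕ→ℚ n) (ℕ→ℚ-suc m) ⟨
    ℕ→ℚ (suc m) + ℕ→ℚ n         ∎
    where open ≡-Reasoning

  ℕ→ℚ-* : ∀ m n → ℕ→ℚ (m ℕ.* n) ≡ ℕ→ℚ m * ℕ→ℚ n
  ℕ→ℚ-* zero    n = sym (*-zeroˡ (ℕ→ℚ n))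
  ℕ→ℚ-* (suc m) n = begin
    ℕ→ℚ (n ℕ.+ m ℕ.* n)             ≡⟨ ℕ→ℚ-+ n (m ℕ.* n) ⟩
    ℕ→ℚ n + ℕ→ℚ (m ℕ.* n)           ≡⟨ cong (_+_ (ℕ→ℚ n)) (ℕ→ℚ-* m n) ⟩
    ℕ→ℚ n + ℕ→ℚ m * ℕ→ℚ n           ≡⟨ eq (ℕ→ℚ m) (ℕ→ℚ n) ⟩
    (1ℚ + ℕ→ℚ m) * ℕ→ℚ n            ≡⟨ cong (_* ℕ→ℚ n) (ℕ→ℚ-suc m) ⟨
    ℕ→ℚ (suc m) * ℕ→ℚ n             ∎
    where
    open ≡-Reasoning
    eq : ∀ a b → b + a * b ≡ (1ℚ + a) * b
    eq = solve-∀ ringℚ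

  0≤ℕ→ℚ : ∀ n → 0ℚ ≤ ℕ→ℚ n
  0≤ℕ→ℚ zero    = ≤-refl
  0≤ℕ→ℚ (suc n) = subst (0ℚ ≤_) (sym (ℕ→ℚ-suc n)) (0≤+ 0≤1 (0≤ℕ→ℚ n))

  0<ℕ→ℚ : ∀ n → .{{ℕ.NonZero n}} → 0ℚ < ℕ→ℚ n
  0<ℕ→ℚ (suc n) = subst (0ℚ <_) (sym (ℕ→ℚ-suc n)) (+-mono-<-≤ (positive⁻¹ 1ℚ) (0≤ℕ→ℚ n))

  ℕ→ℚ-mono-≤ : ∀ {m n} → m ℕ.≤ n → ℕ→ℚ m ≤ ℕ→ℚ n
  ℕ→ℚ-mono-≤ {m} {n} h = subst (λ n → ℕ→ℚ m ≤ ℕ→ℚ n) (ℕ.m+[n∸m]≡n h)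
    (≤-from (0≤ℕ→ℚ (n ℕ.∸ m)) (trans (cong (_- ℕ→ℚ m) (ℕ→ℚ-+ m (n ℕ.∸ m))) (eq (ℕ→ℚ m) _)))
    where
    eq : ∀ a b → a + b - a ≡ b
    eq = solve-∀ ringℚ

  recip-inverse : ∀ n → .{{ℕ.NonZero n}} → recipℕ n * ℕ→ℚ n ≡ 1ℚ
  recip-inverse (suc n) = toℚᵘ-injective (begin
    toℚᵘ (recipℕ (suc n) * ℕ→ℚ (suc n))               ≈⟨ toℚᵘ-homo-* (recipℕ (suc n)) (ℕ→ℚ (suc n)) ⟩
    toℚᵘ (recipℕ (suc n)) ℚᵘ.* toℚᵘ (ℕ→ℚ (suc n))
      ≈⟨ ℚᵘ.*-cong (toℚᵘ-fromℚᵘ (ℚᵘ.mkℚᵘ (+ 1) n)) (toℚᵘ-fromℚᵘ (ℚᵘ.mkℚᵘ (+ suc n) 0)) ⟩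
    ℚᵘ.mkℚᵘ (+ 1) n ℚᵘ.* ℚᵘ.mkℚᵘ (+ suc n) 0           ≈⟨ ℚᵘ.*≡* (cong +_ eq) ⟩
    toℚᵘ 1ℚ                                           ∎)
    where
    open ℚᵘ.≃-Reasoning
    eq : (suc n ℕ.+ 0) ℕ.* 1 ≡ suc (n ℕ.* 1 ℕ.+ 0)
    eq = trans (ℕ.*-identityʳ _) (cong suc (trans (ℕ.+-identityʳ n) (sym (trans (ℕ.+-identityʳ _) (ℕ.*-identityʳ n)))))

  0<recip : ∀ n → .{{ℕ.NonZero n}} → 0ℚ < recipℕ n
  0<recip (suc n) = positive⁻¹ (recipℕ (suc n)) {{normalize-pos 1 (suc n)}}

  ÷ℚ-* : ∀ x {y} → y ≢ 0ℚ → (x ÷ℚ y) * y ≡ x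
  ÷ℚ-* x {y} y≢0 with y ≟ 0ℚ
  ... | yes e = ⊥-elim (y≢0 e)
  ... | no ne = trans (*-assoc x (1/ y) y) (trans (cong (_*_ x) (*-inverseˡ y)) (*-identityʳ x))
    where instance _ = ≢-nonZero ne

  -- The Iverson bracket. Sums over subsets of the field become weighted sums over all of it.
  ⟦_⟧ : ∀ {P : Set} → Dec P → ℚ
  ⟦ yes _ ⟧ = 1ℚ
  ⟦ no _  ⟧ = 0ℚ

  ⟦⟧-yes : ∀ {P : Set} (d : Dec P) → P → ⟦ d ⟧ ≡ 1ℚ
  ⟦⟧-yes (yes _) p = refl
  ⟦⟧-yes (no ¬p) p = ⊥-elim (¬p p)

  ⟦⟧-no : ∀ {P : Set} (d : Dec P) → ¬ P → ⟦ d ⟧ ≡ 0ℚ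
  ⟦⟧-no (yes p) ¬p = ⊥-elim (¬p p)
  ⟦⟧-no (no _)  ¬p = refl

  ⟦⟧-cong : ∀ {P Q : Set} (d : Dec P) (e : Dec Q) → (P → Q) → (Q → P) → ⟦ d ⟧ ≡ ⟦ e ⟧
  ⟦⟧-cong (yes p) e f g = sym (⟦⟧-yes e (f p))
  ⟦⟧-cong (no ¬p) e f g = sym (⟦⟧-no e (λ q → ¬p (g q)))

  0≤⟦⟧ : ∀ {P : Set} (d : Dec P) → 0ℚ ≤ ⟦ d ⟧
  0≤⟦⟧ (yes _) = 0≤1
  0≤⟦⟧ (no _)  = ≤-refl

  -- Inside a weighted sum an equation has to hold only on the support of the weight; restricted
  -- sums are rewritten in this way.
  ⟦⟧-weight : ∀ {P : Set} (d : Dec P) {a b : ℚ} → (P → a ≡ b) → ⟦ d ⟧ * a ≡ ⟦ d ⟧ * b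
  ⟦⟧-weight (yes p) h = cong (_*_ 1ℚ) (h p)
  ⟦⟧-weight (no _) {a} {b} h = trans (*-zeroˡ a) (sym (*-zeroˡ b))

-- Finite sums of rationals.

module FiniteSums where

  open RationalLemmas
  open import Defs using (ℕ→ℚ)
  import Algebra.Properties.Semiring.Sum as Sum
  open import Algebra.Bundles using (CommutativeRing)
  open import Data.Fin using (Fin; zero; suc)
  open import Data.Fin.Properties using (_≟_)
  open import Data.Fin.Permutation using (permutation)
  open import Data.List using (length; filter; tabulate; allFin)
  open import Data.Nat using (zero; suc)
  open import Data.Rational hiding (_≟_)
  open import Data.Rational.Properties hiding (_≟_)
  open import Function using (_∘_; id)
  open import Relation.Nullary using (yes; no)
  open import Relation.Unary using (Decidable)
  open import Relation.Binary.PropositionalEquality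
  open import Tactic.RingSolver using (solve-∀)

  private
    module Σℚ = Sum (CommutativeRing.semiring +-*-commutativeRing)

  abstract
    ∑ : ∀ {n} → (Fin n → ℚ) → ℚ
    ∑ = Σℚ.sum

    ∑-cong : ∀ {n} {f g : Fin n → ℚ} → (∀ i → f i ≡ g i) → ∑ f ≡ ∑ g
    ∑-cong = Σℚ.sum-cong-≗

    ∑-+ : ∀ {n} (f g : Fin n → ℚ) → ∑ (λ i → f i + g i) ≡ ∑ f + ∑ g
    ∑-+ = Σℚ.∑-distrib-+

    ∑-*ˡ : ∀ {n} c (f : Fin n → ℚ) → ∑ (λ i → c * f i) ≡ c * ∑ f
    ∑-*ˡ c f = sym (Σℚ.*-distribˡ-sum c f)

    ∑-*ʳ : ∀ {n} c (f : Fin n → ℚ) → ∑ (λ i → f i * c) ≡ ∑ f * c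
    ∑-*ʳ c f = sym (Σℚ.*-distribʳ-sum c f)

    ∑-swap : ∀ {m n} (f : Fin m → Fin n → ℚ) → ∑ (λ i → ∑ (f i)) ≡ ∑ (λ j → ∑ (λ i → f i j))
    ∑-swap = Σℚ.∑-comm

    ∑-neg : ∀ {n} (f : Fin n → ℚ) → ∑ (λ i → - f i) ≡ - ∑ f
    ∑-neg f = trans (∑-cong (λ i → eq (f i))) (trans (∑-*ˡ (- 1ℚ) f) (sym (eq (∑ f))))
      where
      eq : ∀ a → - a ≡ - 1ℚ * a
      eq = solve-∀ ringℚ

    ∑-- : ∀ {n} (f g : Fin n → ℚ) → ∑ (λ i → f i - g i) ≡ ∑ f - ∑ g
    ∑-- f g = trans (∑-+ f (λ i → - g i)) (cong (_+_ (∑ f)) (∑-neg g))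

    ∑-zero : ∀ {n} {f : Fin n → ℚ} → (∀ i → f i ≡ 0ℚ) → ∑ f ≡ 0ℚ
    ∑-zero {n} h = trans (∑-cong h) (Σℚ.sum-replicate-zero n)

    ∑-const : ∀ n c → ∑ {n} (λ _ → c) ≡ ℕ→ℚ n * c
    ∑-const zero    c = sym (*-zeroˡ c)
    ∑-const (suc n) c = trans (cong (_+_ c) (∑-const n c))
      (trans (eq c (ℕ→ℚ n)) (cong (_* c) (sym (ℕ→ℚ-suc n))))
      where
      eq : ∀ c m → c + m * c ≡ (1ℚ + m) * c
      eq = solve-∀ ringℚ

    ∑-perm : ∀ {n} (π π⁻¹ : Fin n → Fin n) → (∀ i → π (π⁻¹ i) ≡ i) → (∀ i → π⁻¹ (π i) ≡ i) →
             (f : Fin n → ℚ) → ∑ (λ i → f (π i)) ≡ ∑ f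
    ∑-perm π π⁻¹ inv₁ inv₂ f = sym (Σℚ.sum-permute f (permutation π π⁻¹ inv₁ inv₂))

    ∑-mono : ∀ {n} {f g : Fin n → ℚ} → (∀ i → f i ≤ g i) → ∑ f ≤ ∑ g
    ∑-mono {zero}  h = ≤-refl
    ∑-mono {suc n} h = +-mono-≤ (h zero) (∑-mono (h ∘ suc))

    0≤∑ : ∀ {n} {f : Fin n → ℚ} → (∀ i → 0ℚ ≤ f i) → 0ℚ ≤ ∑ f
    0≤∑ {n} {f} h = subst (_≤ ∑ f) (∑-zero {n} (λ _ → refl)) (∑-mono h)

    ∑-single : ∀ {n} (f : Fin n → ℚ) j → (∀ i → i ≢ j → f i ≡ 0ℚ) → ∑ f ≡ f j
    ∑-single {suc n} f zero h =
      trans (cong (_+_ (f zero)) (∑-zero (λ i → h (suc i) (λ ())))) (+-identityʳ _)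
    ∑-single {suc n} f (suc j) h =
      trans (cong₂ _+_ (h zero (λ ())) (∑-single (f ∘ suc) j (λ i ne → h (suc i) (λ { refl → ne refl }))))
            (+-identityˡ _)

    ∑-δ : ∀ {n} (j : Fin n) (f : Fin n → ℚ) → ∑ (λ i → ⟦ i ≟ j ⟧ * f i) ≡ f j
    ∑-δ j f = trans (∑-single _ j (λ i ne → trans (cong (_* f i) (⟦⟧-no (i ≟ j) ne)) (*-zeroˡ (f i))))
      (trans (cong (_* f j) (⟦⟧-yes (j ≟ j) refl)) (*-identityˡ (f j)))

    ∑-δ′ : ∀ {n} (j : Fin n) (f : Fin n → ℚ) → ∑ (λ i → ⟦ j ≟ i ⟧ * f i) ≡ f j
    ∑-δ′ j f = trans (∑-cong (λ i → cong (_* f i) (⟦⟧-cong (j ≟ i) (i ≟ j) sym sym))) (∑-δ j f)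

    -- Bridges to lists, because the bound on the number of roots is proved for lists without
    -- repetitions.
    ∑-count : ∀ {n} {P : Fin n → Set} (P? : Decidable P) →
              ∑ (λ i → ⟦ P? i ⟧) ≡ ℕ→ℚ (length (filter P? (allFin n)))
    ∑-count {n} P? = go n id
      where
      go : ∀ m (g : Fin m → Fin n) → ∑ (λ i → ⟦ P? (g i) ⟧) ≡ ℕ→ℚ (length (filter P? (tabulate g)))
      go zero    g = refl
      go (suc m) g with P? (g zero)
      ... | yes _ = trans (cong (_+_ 1ℚ) (go m (g ∘ suc)))
          (sym (ℕ→ℚ-suc (length (filter P? (tabulate (g ∘ suc))))))
      ... | no _  = trans (+-identityˡ _) (go m (g ∘ suc))

-- Finite fields: Fermat, roots of polynomials, Frobenius.

module FieldBasics where

  open RationalLemmas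
  open FiniteSums
  open import Defs using (ℕ→ℚ)
  open import Level using (0ℓ)
  open import Algebra.Bundles using (CommutativeRing; CommutativeMonoid)
  open import Algebra.Structures using (IsCommutativeRing)
  import Algebra.Properties.CommutativeMonoid.Sum as CMSum
  import Algebra.Properties.CommutativeSemiring.Binomial as Binomial
  import Algebra.Properties.CommutativeSemiring.Exp as Exp
  import Algebra.Properties.Ring as RingProperties
  import Algebra.Properties.Semiring.Mult as Mult
  open import Data.Empty using (⊥-elim)
  open import Data.Fin as Fin using (Fin; toℕ)
  open import Data.Fin.Patterns using (0F)
  open import Data.Fin.Properties using (_≟_; any?; punchInᵢ≢i; toℕ<n; toℕ-inject₁; toℕ-fromℕ)
  open import Data.Fin.Permutation using (permutation)
  open import Data.List using (List; []; _∷_; length; allFin)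
  open import Data.List.Relation.Unary.All as All using (All; []; _∷_)
  open import Data.List.Relation.Unary.All.Properties using (all-filter)
  open import Data.List.Relation.Unary.AllPairs using ([]; _∷_)
  open import Data.List.Relation.Unary.Unique.Propositional using (Unique)
  import Data.List.Relation.Unary.Unique.Propositional.Properties as Unique
  open import Data.Maybe using (nothing)
  open import Data.Nat as ℕ using (ℕ; zero; suc; z≤n; s≤s; NonZero)
  import Data.Nat.Properties as ℕ
  open import Data.Nat.Combinatorics using (_C_; nC1≡n; nCn≡1; nCk+nC[k+1]≡[n+1]C[k+1]; k>n⇒nCk≡0)
  open import Data.Nat.Divisibility using (_∣_; divides; m∣m*n; >⇒∤)
  open import Data.Nat.Primality using (Prime; euclidsLemma; ¬prime[0])
  open import Data.Nat.Tactic.RingSolver using () renaming (solve-∀ to solveℕ-∀)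
  open import Data.Product using (∃; _×_; _,_; proj₁; proj₂)
  open import Data.Rational hiding (_≟_; NonZero)
  open import Data.Rational.Properties hiding (_≟_)
  open import Data.Sum using (inj₁; inj₂)
  open import Relation.Nullary using (Dec; yes; no)
  open import Relation.Nullary.Decidable using (¬?)
  open import Relation.Binary.PropositionalEquality hiding (setoid)
  open import Tactic.RingSolver using (solve-∀)
  open import Tactic.RingSolver.Core.AlmostCommutativeRing using (AlmostCommutativeRing; fromCommutativeRing)

  -- The absorption identity, by induction through Pascal's rule. It exhibits a prime `suc p` as a
  -- divisor of k + 1 times the binomial coefficient, so that Euclid's lemma gives `prime∣C`.
  C-absorption : ∀ n k → suc k ℕ.* (suc n C suc k) ≡ suc n ℕ.* (n C k)
  C-absorption n zero = trans (ℕ.*-identityˡ (suc n C 1)) (trans (nC1≡n (suc n)) (sym (ℕ.*-identityʳ (suc n))))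
  C-absorption zero (suc k) = trans (cong (suc (suc k) ℕ.*_) (k>n⇒nCk≡0 {1} {suc (suc k)} (s≤s (s≤s z≤n))))
    (trans (ℕ.*-zeroʳ (suc (suc k))) (sym (cong (1 ℕ.*_) (k>n⇒nCk≡0 {0} {suc k} (s≤s z≤n)))))
  C-absorption (suc n) (suc k) = begin
    suc (suc k) ℕ.* (suc (suc n) C suc (suc k))
      ≡⟨ cong (suc (suc k) ℕ.*_) (nCk+nC[k+1]≡[n+1]C[k+1] (suc n) (suc k)) ⟨
    suc (suc k) ℕ.* (a ℕ.+ b)
      ≡⟨ eq₁ k a b ⟩
    a ℕ.+ (suc k ℕ.* a ℕ.+ suc (suc k) ℕ.* b)
      ≡⟨ cong (a ℕ.+_) (cong₂ ℕ._+_ (C-absorption n k) (C-absorption n (suc k))) ⟩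
    a ℕ.+ (suc n ℕ.* (n C k) ℕ.+ suc n ℕ.* (n C suc k))
      ≡⟨ cong (a ℕ.+_) (ℕ.*-distribˡ-+ (suc n) (n C k) (n C suc k)) ⟨
    a ℕ.+ suc n ℕ.* (n C k ℕ.+ n C suc k)
      ≡⟨ cong (λ z → a ℕ.+ suc n ℕ.* z) (nCk+nC[k+1]≡[n+1]C[k+1] n k) ⟩
    suc (suc n) ℕ.* a ∎
    where
    open ≡-Reasoning
    a = suc n C suc k
    b = suc n C suc (suc k)
    eq₁ : ∀ k a b → suc (suc k) ℕ.* (a ℕ.+ b) ≡ a ℕ.+ (suc k ℕ.* a ℕ.+ suc (suc k) ℕ.* b)
    eq₁ = solveℕ-∀

  prime∣C : ∀ p k → Prime (suc p) → k ℕ.< p → suc p ∣ suc p C suc k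
  prime∣C p k pp k<p with euclidsLemma (suc k) (suc p C suc k) pp
      (subst (suc p ∣_) (sym (C-absorption p k)) (m∣m*n (p C k)))
  ... | inj₁ h = ⊥-elim (>⇒∤ (s≤s k<p) h)
  ... | inj₂ h = h

  module _ (M : CommutativeMonoid 0ℓ 0ℓ) where
    open CommutativeMonoid M hiding (sym; trans) renaming (_∙_ to _·_)
    open CMSum M using (sum; sum-remove; sum-cong-≋; sum-replicate)
    open import Algebra.Properties.Monoid.Mult monoid using () renaming (_×_ to _⨰_)

    -- Used multiplicatively in `fermat`: a product over the whole field in which 0 receives the
    -- neutral factor.
    sum-const-except : ∀ {n} (i : Fin n) (g : Fin n → Carrier) a →
      g i ≈ ε → (∀ j → j ≢ i → g j ≈ a) → sum g ≈ (n ℕ.∸ 1) ⨰ a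
    sum-const-except {suc n} i g a gi gj = begin
      sum g                                     ≈⟨ sum-remove g ⟩
      g i · sum (λ j → g (Fin.punchIn i j))     ≈⟨ ∙-cong gi (sum-cong-≋ (λ j → gj _ (punchInᵢ≢i i j))) ⟩
      ε · sum {n} (λ _ → a)                     ≈⟨ identityˡ _ ⟩
      sum {n} (λ _ → a)                         ≈⟨ sum-replicate n ⟩
      n ⨰ a                                     ∎
      where open import Relation.Binary.Reasoning.Setoid setoid

  -- A field on `Fin n` with propositional equality: equality is decidable, every function respects
  -- it, and sums over the field are sums over `Fin n`.
  record FinField (n : ℕ) : Set where
    infixl 6 _⊕_
    infixl 7 _⊗_
    infix 8 ⊖_
    field
      _⊕_ _⊗_ : Fin n → Fin n → Fin n
      ⊖_ : Fin n → Fin n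
      𝟘 𝟙 : Fin n
      isCommutativeRing : IsCommutativeRing _≡_ _⊕_ _⊗_ ⊖_ 𝟘 𝟙
      𝟙≢𝟘 : 𝟙 ≢ 𝟘
      inverse : ∀ x → x ≢ 𝟘 → ∃ λ y → x ⊗ y ≡ 𝟙

    commutativeRing : CommutativeRing 0ℓ 0ℓ
    commutativeRing = record { isCommutativeRing = isCommutativeRing }

  module FieldTheory {n : ℕ} (𝔽 : FinField n) where
    open FinField 𝔽 public
    module R = CommutativeRing commutativeRing
    open Exp R.commutativeSemiring public using (_^_; ^-assocʳ; ^-distrib-*)
    open Mult R.semiring using (×1-homo-*; ×-assoc-*) renaming (_×_ to _⨰_)
    open RingProperties R.ring using (+-cancelˡ)

    F : Set
    F = Fin n

    N : ℕ
    N = n ℕ.∸ 1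

    semiringF : AlmostCommutativeRing 0ℓ 0ℓ
    semiringF = fromCommutativeRing commutativeRing (λ _ → nothing)

    module A = AlmostCommutativeRing semiringF using (_+_; _*_)

    n≡1+N : n ≡ suc N
    n≡1+N = go 𝟘
      where
      go : ∀ {m} → Fin m → m ≡ suc (m ℕ.∸ 1)
      go {suc m} _ = refl

    -- With the default value 𝟘 at 𝟘, inversion is an involution of all of F, so sums over F can be
    -- reindexed by it.
    inv : F → F
    inv x with x ≟ 𝟘
    ... | yes _ = 𝟘
    ... | no ne = proj₁ (inverse x ne)

    inv-𝟘 : inv 𝟘 ≡ 𝟘
    inv-𝟘 with 𝟘 ≟ 𝟘
    ... | yes _ = refl
    ... | no ne = ⊥-elim (ne refl)

    inv-inverseʳ : ∀ {x} → x ≢ 𝟘 → x ⊗ inv x ≡ 𝟙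
    inv-inverseʳ {x} ne with x ≟ 𝟘
    ... | yes e = ⊥-elim (ne e)
    ... | no ne′ = proj₂ (inverse x ne′)

    ⊗-cancelˡ : ∀ {x y z} → x ≢ 𝟘 → x ⊗ y ≡ x ⊗ z → y ≡ z
    ⊗-cancelˡ {x} {y} {z} ne e = trans (sym (h y)) (trans (cong (inv x ⊗_) e) (h z))
      where
      h : ∀ y → inv x ⊗ (x ⊗ y) ≡ y
      h y = trans (sym (R.*-assoc _ _ _))
        (trans (cong (_⊗ y) (trans (R.*-comm _ _) (inv-inverseʳ ne))) (R.*-identityˡ y))

    ⊗-nonzero : ∀ {x y} → x ≢ 𝟘 → y ≢ 𝟘 → x ⊗ y ≢ 𝟘
    ⊗-nonzero {x} nx ny e = ny (⊗-cancelˡ nx (trans e (sym (R.zeroʳ x))))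

    ⊗≡𝟙⇒nonzeroʳ : ∀ {x y} → x ⊗ y ≡ 𝟙 → y ≢ 𝟘
    ⊗≡𝟙⇒nonzeroʳ {x} e refl = 𝟙≢𝟘 (trans (sym e) (R.zeroʳ x))

    inv-nonzero : ∀ {x} → x ≢ 𝟘 → inv x ≢ 𝟘
    inv-nonzero ne = ⊗≡𝟙⇒nonzeroʳ (inv-inverseʳ ne)

    inv-involutive : ∀ x → inv (inv x) ≡ x
    inv-involutive x = by (x ≟ 𝟘)
      where
      by : Dec (x ≡ 𝟘) → inv (inv x) ≡ x
      by (yes refl) = trans (cong inv inv-𝟘) inv-𝟘
      by (no ne) = ⊗-cancelˡ (inv-nonzero ne)
        (trans (inv-inverseʳ (inv-nonzero ne)) (sym (trans (R.*-comm _ _) (inv-inverseʳ ne))))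

    ⊗-inv-cancelˡ : ∀ {x} → x ≢ 𝟘 → ∀ y → x ⊗ (inv x ⊗ y) ≡ y
    ⊗-inv-cancelˡ {x} ne y =
      trans (sym (R.*-assoc _ _ _)) (trans (cong (_⊗ y) (inv-inverseʳ ne)) (R.*-identityˡ y))

    inv-⊗-cancelˡ : ∀ {x} → x ≢ 𝟘 → ∀ y → inv x ⊗ (x ⊗ y) ≡ y
    inv-⊗-cancelˡ {x} ne y = ⊗-cancelˡ ne (⊗-inv-cancelˡ ne (x ⊗ y))

    ^-nonzero : ∀ {x} → x ≢ 𝟘 → ∀ d → x ^ d ≢ 𝟘
    ^-nonzero ne zero    = 𝟙≢𝟘
    ^-nonzero ne (suc d) = ⊗-nonzero ne (^-nonzero ne d)

    𝟘^ : ∀ d → .{{NonZero d}} → 𝟘 ^ d ≡ 𝟘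
    𝟘^ (suc d) = R.zeroˡ _

    𝟙^ : ∀ d → 𝟙 ^ d ≡ 𝟙
    𝟙^ zero    = refl
    𝟙^ (suc d) = trans (R.*-identityˡ _) (𝟙^ d)

    ^≡𝟙⇒nonzero : ∀ {x} d → .{{NonZero d}} → x ^ d ≡ 𝟙 → x ≢ 𝟘
    ^≡𝟙⇒nonzero d e refl = 𝟙≢𝟘 (trans (sym e) (𝟘^ d))

    ∑-scale : ∀ {a} → a ≢ 𝟘 → (f : F → ℚ) → ∑ (λ x → f (a ⊗ x)) ≡ ∑ f
    ∑-scale {a} ne = ∑-perm (a ⊗_) (inv a ⊗_) (⊗-inv-cancelˡ ne) (inv-⊗-cancelˡ ne)

    ∑-shift : ∀ a (f : F → ℚ) → ∑ (λ x → f (a ⊕ x)) ≡ ∑ f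
    ∑-shift a = ∑-perm (a ⊕_) (⊖ a ⊕_)
      (λ x → trans (sym (R.+-assoc _ _ _)) (trans (cong (_⊕ x) (R.-‿inverseʳ a)) (R.+-identityˡ x)))
      (λ x → trans (sym (R.+-assoc _ _ _)) (trans (cong (_⊕ x) (R.-‿inverseˡ a)) (R.+-identityˡ x)))

    ∑-inv : (f : F → ℚ) → ∑ (λ x → f (inv x)) ≡ ∑ f
    ∑-inv = ∑-perm inv inv inv-involutive inv-involutive

    nz : F → ℚ
    nz x = ⟦ ¬? (x ≟ 𝟘) ⟧

    nz-𝟘 : nz 𝟘 ≡ 0ℚ
    nz-𝟘 = ⟦⟧-no (¬? (𝟘 ≟ 𝟘)) (λ h → h refl)

    nz-nonzero : ∀ {x} → x ≢ 𝟘 → nz x ≡ 1ℚ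
    nz-nonzero {x} = ⟦⟧-yes (¬? (x ≟ 𝟘))

    ∑-nz : ∑ nz ≡ ℕ→ℚ N
    ∑-nz = begin
      ∑ nz                                       ≡⟨ ∑-cong h ⟩
      ∑ (λ x → 1ℚ - ⟦ x ≟ 𝟘 ⟧ * 1ℚ)              ≡⟨ ∑-- (λ _ → 1ℚ) (λ x → ⟦ x ≟ 𝟘 ⟧ * 1ℚ) ⟩
      ∑ {n} (λ _ → 1ℚ) - ∑ (λ x → ⟦ x ≟ 𝟘 ⟧ * 1ℚ)
        ≡⟨ cong₂ _-_ (∑-const n 1ℚ) (∑-δ 𝟘 (λ _ → 1ℚ)) ⟩
      ℕ→ℚ n * 1ℚ - 1ℚ                            ≡⟨ cong (λ z → z * 1ℚ - 1ℚ) (trans (cong ℕ→ℚ n≡1+N) (ℕ→ℚ-suc N)) ⟩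
      (1ℚ + ℕ→ℚ N) * 1ℚ - 1ℚ                     ≡⟨ eq (ℕ→ℚ N) ⟩
      ℕ→ℚ N                                      ∎
      where
      open ≡-Reasoning
      eq : ∀ a → (1ℚ + a) * 1ℚ - 1ℚ ≡ a
      eq = solve-∀ ringℚ
      h : ∀ x → nz x ≡ 1ℚ - ⟦ x ≟ 𝟘 ⟧ * 1ℚ
      h x with x ≟ 𝟘
      ... | yes _ = refl
      ... | no _  = refl

    module Π = CMSum R.*-commutativeMonoid

    -- Multiplication by a permutes the nonzero elements, so their product is unchanged although
    -- each factor gains an a. Giving 𝟘 the factor 𝟙 extends the product to all of F, where
    -- permutations of `Fin n` apply.
    fermat : ∀ {a} → a ≢ 𝟘 → a ^ N ≡ 𝟙
    fermat {a} ne = ⊗-cancelˡ Πf≢0 (begin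
      Π.sum f ⊗ a ^ N            ≡⟨ cong (Π.sum f ⊗_) Πg ⟨
      Π.sum f ⊗ Π.sum g          ≡⟨ R.*-comm _ _ ⟩
      Π.sum g ⊗ Π.sum f          ≡⟨ Π.∑-distrib-+ g f ⟨
      Π.sum (λ x → g x ⊗ f x)    ≡⟨ Π.sum-cong-≗ (λ x → gf x (x ≟ 𝟘)) ⟨
      Π.sum (λ x → f (a ⊗ x))    ≡⟨ Π.sum-permute f π ⟨
      Π.sum f                    ≡⟨ R.*-identityʳ _ ⟨
      Π.sum f ⊗ 𝟙                ∎)
      where
      open ≡-Reasoning
      π = permutation (a ⊗_) (inv a ⊗_) (⊗-inv-cancelˡ ne) (inv-⊗-cancelˡ ne)
      pick : ∀ {x} → Dec (x ≡ 𝟘) → F → F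
      pick (yes _) y = 𝟙
      pick (no _)  y = y
      pick-no : ∀ {x y} (d : Dec (x ≡ 𝟘)) → x ≢ 𝟘 → pick d y ≡ y
      pick-no (yes e) ne = ⊥-elim (ne e)
      pick-no (no _) ne = refl
      pick-yes : ∀ {x y} (d : Dec (x ≡ 𝟘)) → x ≡ 𝟘 → pick d y ≡ 𝟙
      pick-yes (yes _) e = refl
      pick-yes (no ne) e = ⊥-elim (ne e)
      f g : F → F
      f x = pick (x ≟ 𝟘) x
      g x = pick (x ≟ 𝟘) a
      gf : ∀ x → Dec (x ≡ 𝟘) → f (a ⊗ x) ≡ g x ⊗ f x
      gf x (yes e) = begin
        f (a ⊗ x) ≡⟨ pick-yes (a ⊗ x ≟ 𝟘) (trans (cong (a ⊗_) e) (R.zeroʳ a)) ⟩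
        𝟙         ≡⟨ R.*-identityˡ 𝟙 ⟨
        𝟙 ⊗ 𝟙     ≡⟨ cong₂ _⊗_ (pick-yes (x ≟ 𝟘) e) (pick-yes (x ≟ 𝟘) e) ⟨
        g x ⊗ f x ∎
      gf x (no nx) = trans (pick-no (a ⊗ x ≟ 𝟘) (⊗-nonzero ne nx))
        (sym (cong₂ _⊗_ (pick-no (x ≟ 𝟘) nx) (pick-no (x ≟ 𝟘) nx)))
      Πg : Π.sum g ≡ a ^ N
      Πg = sum-const-except R.*-commutativeMonoid 𝟘 g a (pick-yes (𝟘 ≟ 𝟘) refl) (λ j → pick-no (j ≟ 𝟘))
      sum≢0 : ∀ {m} (h : Fin m → F) → (∀ i → h i ≢ 𝟘) → Π.sum h ≢ 𝟘
      sum≢0 {zero}  h nh = 𝟙≢𝟘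
      sum≢0 {suc m} h nh = ⊗-nonzero (nh 0F) (sum≢0 (λ i → h (Fin.suc i)) (λ i → nh (Fin.suc i)))
      f≢0 : ∀ x → f x ≢ 𝟘
      f≢0 x e with x ≟ 𝟘
      ... | yes _ = 𝟙≢𝟘 e
      ... | no nx = nx e
      Πf≢0 : Π.sum f ≢ 𝟘
      Πf≢0 = sum≢0 f f≢0

    -- Monic polynomial functions of degree d, described through divided differences:
    -- f(x) − f(a) = (x − a) g(x), written without subtraction.
    Monic : ℕ → (F → F) → Set
    Monic zero    f = ∀ x → f x ≡ 𝟙
    Monic (suc d) f = ∀ a → ∃ λ g → Monic d g × (∀ x → f x ⊕ a ⊗ g x ≡ f a ⊕ x ⊗ g x)

    -- Terms of lower degree do not affect monicity. The shape is that of the divided difference in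
    -- `Monic-x⊗`.
    Monic-⊕ : ∀ d {g h} a → Monic (suc d) g → Monic d h → Monic (suc d) (λ x → g x ⊕ a ⊗ h x)
    Monic-⊕ zero {g} {h} a mg mh b with mg b
    ... | g′ , mg′ , e = g′ , mg′ , λ x → begin
      g x ⊕ a ⊗ h x ⊕ b ⊗ g′ x   ≡⟨ cong (λ z → g x ⊕ a ⊗ z ⊕ b ⊗ g′ x) (trans (mh x) (sym (mh b))) ⟩
      g x ⊕ a ⊗ h b ⊕ b ⊗ g′ x   ≡⟨ eq₁ (g x) (a ⊗ h b) (b ⊗ g′ x) ⟩
      g x ⊕ b ⊗ g′ x ⊕ a ⊗ h b   ≡⟨ cong (_⊕ a ⊗ h b) (e x) ⟩
      g b ⊕ x ⊗ g′ x ⊕ a ⊗ h b   ≡⟨ eq₁ (g b) (x ⊗ g′ x) (a ⊗ h b) ⟩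
      g b ⊕ a ⊗ h b ⊕ x ⊗ g′ x   ∎
      where
      open ≡-Reasoning
      eq₁ : ∀ a b c → a A.+ b A.+ c ≡ a A.+ c A.+ b
      eq₁ = solve-∀ semiringF
    Monic-⊕ (suc d) {g} {h} a mg mh b with mg b | mh b
    ... | g′ , mg′ , e | h′ , mh′ , e′ = (λ x → g′ x ⊕ a ⊗ h′ x) , Monic-⊕ d a mg′ mh′ , λ x → begin
      g x ⊕ a ⊗ h x ⊕ b ⊗ (g′ x ⊕ a ⊗ h′ x)          ≡⟨ eq₁ (g x) a (h x) b (g′ x) (h′ x) ⟩
      (g x ⊕ b ⊗ g′ x) ⊕ a ⊗ (h x ⊕ b ⊗ h′ x)        ≡⟨ cong₂ (λ y z → y ⊕ a ⊗ z) (e x) (e′ x) ⟩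
      (g b ⊕ x ⊗ g′ x) ⊕ a ⊗ (h b ⊕ x ⊗ h′ x)        ≡⟨ eq₁ (g b) a (h b) x (g′ x) (h′ x) ⟨
      g b ⊕ a ⊗ h b ⊕ x ⊗ (g′ x ⊕ a ⊗ h′ x)          ∎
      where
      open ≡-Reasoning
      eq₁ : ∀ g a h b g′ h′ → g A.+ a A.* h A.+ b A.* (g′ A.+ a A.* h′) ≡ (g A.+ b A.* g′) A.+ a A.* (h A.+ b A.* h′)
      eq₁ = solve-∀ semiringF

    -- x g(x) - a g(a) = (x - a)(g(x) + a h(x)), where h is the divided difference of g at a.
    Monic-x⊗ : ∀ d {g} → Monic d g → Monic (suc d) (λ x → x ⊗ g x)
    Monic-x⊗ zero {g} mg a = g , mg , λ x →
      trans (R.+-comm _ _) (cong (λ z → a ⊗ z ⊕ x ⊗ g x) (trans (mg x) (sym (mg a))))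
    Monic-x⊗ (suc d) {g} mg a with mg a
    ... | h , mh , e = (λ x → g x ⊕ a ⊗ h x) , Monic-⊕ d a mg mh , λ x → begin
      x ⊗ g x ⊕ a ⊗ (g x ⊕ a ⊗ h x)   ≡⟨ cong (λ z → x ⊗ g x ⊕ a ⊗ z) (e x) ⟩
      x ⊗ g x ⊕ a ⊗ (g a ⊕ x ⊗ h x)   ≡⟨ eq₁ x (g x) a (g a) (h x) ⟩
      a ⊗ g a ⊕ x ⊗ (g x ⊕ a ⊗ h x)   ∎
      where
      open ≡-Reasoning
      eq₁ : ∀ x gx a ga hx → x A.* gx A.+ a A.* (ga A.+ x A.* hx) ≡ a A.* ga A.+ x A.* (gx A.+ a A.* hx)
      eq₁ = solve-∀ semiringF

    Monic-^ : ∀ d → Monic d (_^ d)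
    Monic-^ zero    x = refl
    Monic-^ (suc d) = Monic-x⊗ d (Monic-^ d)

    Monic-zeros : ∀ d {f} → Monic d f → ∀ xs → Unique xs → All (λ x → f x ≡ 𝟘) xs → length xs ℕ.≤ d

    -- If a is one solution, the divided difference at a vanishes at every other one, which lowers
    -- the degree. An arbitrary value c costs nothing, as divided differences do not see constants.
    Monic-solutions : ∀ d {f} → Monic (suc d) f → ∀ c xs → Unique xs → All (λ x → f x ≡ c) xs →
                      length xs ℕ.≤ suc d
    Monic-solutions d mf c [] u h = z≤n
    Monic-solutions d {f} mf c (a ∷ xs) (a∉xs ∷ u) (fa ∷ fxs) with mf a
    ... | g , mg , e = s≤s (Monic-zeros d mg xs u (All.zipWith (λ { (fx , ne) → zero-g fx ne }) (fxs , a∉xs)))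
      where
      zero-g : ∀ {x} → f x ≡ c → a ≢ x → g x ≡ 𝟘
      zero-g {x} fx ne = by (g x ≟ 𝟘)
        where
        eq : a ⊗ g x ≡ x ⊗ g x
        eq = +-cancelˡ (f x) _ _ (trans (e x) (cong (_⊕ x ⊗ g x) (trans fa (sym fx))))
        by : Dec (g x ≡ 𝟘) → g x ≡ 𝟘
        by (yes z) = z
        by (no nz) = ⊥-elim (ne (⊗-cancelˡ nz (trans (R.*-comm _ _) (trans eq (R.*-comm _ _)))))

    Monic-zeros d mf [] u h = z≤n
    Monic-zeros zero mf (x ∷ xs) u (fx ∷ _) = ⊥-elim (𝟙≢𝟘 (trans (sym (mf x)) fx))
    Monic-zeros (suc d) mf (x ∷ xs) u h = Monic-solutions d mf 𝟘 (x ∷ xs) u h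

    count-^-≤ : ∀ d → .{{NonZero d}} → ∀ y → ∑ (λ x → ⟦ x ^ d ≟ y ⟧) ≤ ℕ→ℚ d
    count-^-≤ (suc d) y = subst (_≤ ℕ→ℚ (suc d)) (sym (∑-count (λ x → x ^ suc d ≟ y)))
      (ℕ→ℚ-mono-≤ (Monic-solutions d (Monic-^ (suc d)) y _
        (Unique.filter⁺ (λ x → x ^ suc d ≟ y) (Unique.allFin⁺ n)) (all-filter (λ x → x ^ suc d ≟ y) (allFin n))))

    -- Every x ≠ 0 is counted at y = x^d, and y^e = 1.
    N≤∑-fibres : ∀ d e → .{{NonZero d}} → N ≡ d ℕ.* e →
      ℕ→ℚ N ≤ ∑ (λ y → ⟦ y ^ e ≟ 𝟙 ⟧ * ∑ (λ x → ⟦ x ^ d ≟ y ⟧))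
    N≤∑-fibres d e eq = subst₂ _≤_ ∑-nz swap (∑-mono step)
      where
      g : F → F → ℚ
      g x y = ⟦ y ^ e ≟ 𝟙 ⟧ * ⟦ x ^ d ≟ y ⟧
      swap : ∑ (λ x → ∑ (g x)) ≡ ∑ (λ y → ⟦ y ^ e ≟ 𝟙 ⟧ * ∑ (λ x → ⟦ x ^ d ≟ y ⟧))
      swap = trans (∑-swap g) (∑-cong (λ y → ∑-*ˡ ⟦ y ^ e ≟ 𝟙 ⟧ (λ x → ⟦ x ^ d ≟ y ⟧)))
      inner : ∀ x → ∑ (g x) ≡ ⟦ (x ^ d) ^ e ≟ 𝟙 ⟧
      inner x = trans (∑-cong (λ y → *-comm ⟦ y ^ e ≟ 𝟙 ⟧ ⟦ x ^ d ≟ y ⟧)) (∑-δ′ (x ^ d) (λ y → ⟦ y ^ e ≟ 𝟙 ⟧))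
      step : ∀ x → nz x ≤ ∑ (g x)
      step x with x ≟ 𝟘
      ... | yes _ = subst (0ℚ ≤_) (sym (inner x)) (0≤⟦⟧ ((x ^ d) ^ e ≟ 𝟙))
      ... | no ne = ≤-reflexive (sym (trans (inner x)
        (⟦⟧-yes ((x ^ d) ^ e ≟ 𝟙) (trans (^-assocʳ x d e) (trans (cong (x ^_) (sym eq)) (fermat ne))))))

    -- At most e roots by the degree. At least e, because the d-th power map sends the N = d·e
    -- nonzero elements to such roots with fibres of at most d elements. This takes the place of the
    -- cyclicity of F*.
    count-roots : ∀ d e → .{{NonZero d}} → .{{NonZero e}} → N ≡ d ℕ.* e → ∑ (λ y → ⟦ y ^ e ≟ 𝟙 ⟧) ≡ ℕ→ℚ e
    count-roots d e eq = ≤-antisym (count-^-≤ e 𝟙) (≤-cancel* (0<ℕ→ℚ d) (begin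
      ℕ→ℚ d * ℕ→ℚ e                                             ≡⟨ ℕ→ℚ-* d e ⟨
      ℕ→ℚ (d ℕ.* e)                                             ≡⟨ cong ℕ→ℚ eq ⟨
      ℕ→ℚ N                                                     ≤⟨ N≤∑-fibres d e eq ⟩
      ∑ (λ y → ⟦ y ^ e ≟ 𝟙 ⟧ * ∑ (λ x → ⟦ x ^ d ≟ y ⟧))         ≤⟨ ∑-mono (λ y → *-monoˡ-≤-nonNeg ⟦ y ^ e ≟ 𝟙 ⟧ {{nonNegative (0≤⟦⟧ (y ^ e ≟ 𝟙))}} (count-^-≤ d y)) ⟩
      ∑ (λ y → ⟦ y ^ e ≟ 𝟙 ⟧ * ℕ→ℚ d)                           ≡⟨ ∑-*ʳ (ℕ→ℚ d) (λ y → ⟦ y ^ e ≟ 𝟙 ⟧) ⟩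
      ∑ (λ y → ⟦ y ^ e ≟ 𝟙 ⟧) * ℕ→ℚ d                           ≡⟨ *-comm _ (ℕ→ℚ d) ⟩
      ℕ→ℚ d * ∑ (λ y → ⟦ y ^ e ≟ 𝟙 ⟧)                           ∎))
      where open ≤-Reasoning

    -- The count of fibres is tight, so none is empty: an empty fibre over y would leave room for
    -- only (e - 1)·d of the e·d nonzero elements.
    root⇒power : ∀ d e → .{{NonZero d}} → .{{NonZero e}} → N ≡ d ℕ.* e →
      ∀ {y} → y ^ e ≡ 𝟙 → ∃ λ x → x ^ d ≡ y
    root⇒power d e eq {y} ye with any? (λ x → x ^ d ≟ y)
    ... | yes h = h
    ... | no ¬h = ⊥-elim (<-irrefl refl (begin-strict
      ℕ→ℚ d * ℕ→ℚ e                                             ≡⟨ ℕ→ℚ-* d e ⟨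
      ℕ→ℚ (d ℕ.* e)                                             ≡⟨ cong ℕ→ℚ eq ⟨
      ℕ→ℚ N                                                     ≤⟨ N≤∑-fibres d e eq ⟩
      ∑ (λ z → ⟦ z ^ e ≟ 𝟙 ⟧ * ∑ (λ x → ⟦ x ^ d ≟ z ⟧))         ≤⟨ ∑-mono step ⟩
      ∑ (λ z → ⟦ z ^ e ≟ 𝟙 ⟧ * ℕ→ℚ d - ⟦ z ≟ y ⟧ * ℕ→ℚ d)       ≡⟨ ∑-- (λ z → ⟦ z ^ e ≟ 𝟙 ⟧ * ℕ→ℚ d) (λ z → ⟦ z ≟ y ⟧ * ℕ→ℚ d) ⟩
      ∑ (λ z → ⟦ z ^ e ≟ 𝟙 ⟧ * ℕ→ℚ d) - ∑ (λ z → ⟦ z ≟ y ⟧ * ℕ→ℚ d)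
        ≡⟨ cong₂ _-_ (∑-*ʳ (ℕ→ℚ d) (λ y → ⟦ y ^ e ≟ 𝟙 ⟧)) (∑-δ y (λ _ → ℕ→ℚ d)) ⟩
      ∑ (λ y → ⟦ y ^ e ≟ 𝟙 ⟧) * ℕ→ℚ d - ℕ→ℚ d                   ≡⟨ cong (λ z → z * ℕ→ℚ d - ℕ→ℚ d) (count-roots d e eq) ⟩
      ℕ→ℚ e * ℕ→ℚ d - ℕ→ℚ d                                     <⟨ <-from (0<ℕ→ℚ d) (arith (ℕ→ℚ e) (ℕ→ℚ d)) ⟩
      ℕ→ℚ d * ℕ→ℚ e                                             ∎))
      where
      open ≤-Reasoning
      arith : ∀ e d → d * e - (e * d - d) ≡ d
      arith = solve-∀ ringℚ
      eq₁ : ∀ a b → a * b ≡ a * b - 0ℚ * b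
      eq₁ = solve-∀ ringℚ
      none : ∀ z → z ≡ y → ∑ (λ x → ⟦ x ^ d ≟ z ⟧) ≡ 0ℚ
      none z refl = ∑-zero (λ x → ⟦⟧-no (x ^ d ≟ y) (λ h → ¬h (x , h)))
      step : ∀ z → ⟦ z ^ e ≟ 𝟙 ⟧ * ∑ (λ x → ⟦ x ^ d ≟ z ⟧) ≤ ⟦ z ^ e ≟ 𝟙 ⟧ * ℕ→ℚ d - ⟦ z ≟ y ⟧ * ℕ→ℚ d
      step z with z ≟ y
      ... | yes refl = ≤-reflexive (trans (cong₂ _*_ (⟦⟧-yes (z ^ e ≟ 𝟙) ye) (none z refl))
        (trans (*-zeroʳ 1ℚ) (trans (sym (+-inverseʳ (1ℚ * ℕ→ℚ d))) (cong (λ t → t * ℕ→ℚ d - 1ℚ * ℕ→ℚ d) (sym (⟦⟧-yes (z ^ e ≟ 𝟙) ye))))))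
      ... | no _ = subst (⟦ z ^ e ≟ 𝟙 ⟧ * ∑ (λ x → ⟦ x ^ d ≟ z ⟧) ≤_) (eq₁ ⟦ z ^ e ≟ 𝟙 ⟧ (ℕ→ℚ d))
        (*-monoˡ-≤-nonNeg ⟦ z ^ e ≟ 𝟙 ⟧ {{nonNegative (0≤⟦⟧ (z ^ e ≟ 𝟙))}} (count-^-≤ d z))

    module ΣF = CMSum R.+-commutativeMonoid

    -- Adding 𝟙 permutes F, so the sum of all elements equals itself plus n copies of 𝟙.
    n⨰𝟙 : n ⨰ 𝟙 ≡ 𝟘
    n⨰𝟙 = +-cancelˡ (ΣF.sum (λ x → x)) _ _ (begin
      ΣF.sum (λ x → x) ⊕ n ⨰ 𝟙                       ≡⟨ cong (ΣF.sum (λ x → x) ⊕_) (ΣF.sum-replicate n) ⟨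
      ΣF.sum (λ x → x) ⊕ ΣF.sum {n} (λ _ → 𝟙)        ≡⟨ ΣF.∑-distrib-+ (λ x → x) (λ _ → 𝟙) ⟨
      ΣF.sum (λ x → x ⊕ 𝟙)                           ≡⟨ ΣF.sum-permute (λ x → x) π ⟨
      ΣF.sum (λ x → x)                               ≡⟨ R.+-identityʳ _ ⟨
      ΣF.sum (λ x → x) ⊕ 𝟘                           ∎)
      where
      open ≡-Reasoning
      π = permutation (_⊕ 𝟙) (_⊕ ⊖ 𝟙)
        (λ x → trans (R.+-assoc _ _ _) (trans (cong (x ⊕_) (R.-‿inverseˡ 𝟙)) (R.+-identityʳ x)))
        (λ x → trans (R.+-assoc _ _ _) (trans (cong (x ⊕_) (R.-‿inverseʳ 𝟙)) (R.+-identityʳ x)))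

    module _ {p m : ℕ} (pp : Prime p) (n≡p^m : n ≡ p ℕ.^ m) where

      -- The multiple p^m of 𝟙 is the m-th power of p·𝟙, and a field has no nonzero nilpotent
      -- elements.
      p⨰𝟙 : p ⨰ 𝟙 ≡ 𝟘
      p⨰𝟙 = by (p ⨰ 𝟙 ≟ 𝟘)
        where
        hom : ∀ m → (p ℕ.^ m) ⨰ 𝟙 ≡ (p ⨰ 𝟙) ^ m
        hom zero    = R.+-identityʳ 𝟙
        hom (suc m) = trans (×1-homo-* p (p ℕ.^ m)) (cong (p ⨰ 𝟙 ⊗_) (hom m))
        by : Dec (p ⨰ 𝟙 ≡ 𝟘) → p ⨰ 𝟙 ≡ 𝟘
        by (yes e) = e
        by (no ne) = ⊥-elim (^-nonzero ne m (trans (sym (hom m)) (trans (cong (_⨰ 𝟙) (sym n≡p^m)) n⨰𝟙)))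

      ∣⇒⨰≡𝟘 : ∀ {k} → p ∣ k → ∀ x → k ⨰ x ≡ 𝟘
      ∣⇒⨰≡𝟘 {k} (divides c refl) x = begin
        (c ℕ.* p) ⨰ x                ≡⟨ cong ((c ℕ.* p) ⨰_) (R.*-identityˡ x) ⟨
        (c ℕ.* p) ⨰ (𝟙 ⊗ x)          ≡⟨ ×-assoc-* (c ℕ.* p) 𝟙 x ⟨
        (c ℕ.* p) ⨰ 𝟙 ⊗ x            ≡⟨ cong (_⊗ x) (×1-homo-* c p) ⟩
        c ⨰ 𝟙 ⊗ (p ⨰ 𝟙) ⊗ x          ≡⟨ cong (λ z → c ⨰ 𝟙 ⊗ z ⊗ x) p⨰𝟙 ⟩
        c ⨰ 𝟙 ⊗ 𝟘 ⊗ x                ≡⟨ cong (_⊗ x) (R.zeroʳ _) ⟩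
        𝟘 ⊗ x                        ≡⟨ R.zeroˡ x ⟩
        𝟘                            ∎
        where open ≡-Reasoning

      frobenius : ∀ x y → (x ⊕ y) ^ p ≡ x ^ p ⊕ y ^ p
      frobenius x y = go p refl
        where
        open ≡-Reasoning
        go : ∀ p′ → p ≡ p′ → (x ⊕ y) ^ p′ ≡ x ^ p′ ⊕ y ^ p′
        go zero    e = ⊥-elim (¬prime[0] (subst Prime e pp))
        go (suc l) refl = begin
          (x ⊕ y) ^ suc l                                 ≡⟨ Binomial.theorem R.commutativeSemiring (suc l) x y ⟩
          t Fin.zero ⊕ ΣF.sum s                           ≡⟨ cong (t Fin.zero ⊕_) (ΣF.sum-init-last s) ⟩
          t Fin.zero ⊕ (ΣF.sum (λ i → s (Fin.inject₁ i)) ⊕ s (Fin.fromℕ l))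
            ≡⟨ cong₂ _⊕_ first (cong₂ _⊕_ (trans (ΣF.sum-cong-≗ middle) (ΣF.sum-replicate-zero l)) last) ⟩
          y ^ suc l ⊕ (𝟘 ⊕ x ^ suc l)                     ≡⟨ cong (y ^ suc l ⊕_) (R.+-identityˡ _) ⟩
          y ^ suc l ⊕ x ^ suc l                           ≡⟨ R.+-comm _ _ ⟩
          x ^ suc l ⊕ y ^ suc l                           ∎
          where
          t : Fin (suc (suc l)) → F
          t = Binomial.binomialTerm R.commutativeSemiring x y (suc l)
          s : Fin (suc l) → F
          s i = t (Fin.suc i)
          first : t Fin.zero ≡ y ^ suc l
          first = trans (R.+-identityʳ _) (R.*-identityˡ _)
          middle : ∀ i → s (Fin.inject₁ i) ≡ 𝟘
          middle i = ∣⇒⨰≡𝟘 (subst (λ k → suc l ∣ suc l C suc k) (sym (toℕ-inject₁ i))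
            (prime∣C l (toℕ i) pp (toℕ<n i))) _
          last : s (Fin.fromℕ l) ≡ x ^ suc l
          last = begin
            (suc l C suc (toℕ (Fin.fromℕ l))) ⨰ (x ^ suc (toℕ (Fin.fromℕ l)) ⊗ y ^ (l ℕ.∸ toℕ (Fin.fromℕ l)))
              ≡⟨ cong (λ k → (suc l C suc k) ⨰ (x ^ suc k ⊗ y ^ (l ℕ.∸ k))) (toℕ-fromℕ l) ⟩
            (suc l C suc l) ⨰ (x ^ suc l ⊗ y ^ (l ℕ.∸ l))
              ≡⟨ cong₂ (λ c k → c ⨰ (x ^ suc l ⊗ y ^ k)) (nCn≡1 (suc l)) (ℕ.n∸n≡0 l) ⟩
            (x ^ suc l ⊗ 𝟙) ⊕ 𝟘  ≡⟨ trans (R.+-identityʳ _) (R.*-identityʳ _) ⟩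
            x ^ suc l            ∎

      frobenius^ : ∀ e x y → (x ⊕ y) ^ (p ℕ.^ e) ≡ x ^ (p ℕ.^ e) ⊕ y ^ (p ℕ.^ e)
      frobenius^ zero    x y = trans (R.*-identityʳ _) (sym (cong₂ _⊕_ (R.*-identityʳ x) (R.*-identityʳ y)))
      frobenius^ (suc e) x y = begin
        (x ⊕ y) ^ (p ℕ.* p ℕ.^ e)                          ≡⟨ ^-assocʳ (x ⊕ y) p (p ℕ.^ e) ⟨
        ((x ⊕ y) ^ p) ^ (p ℕ.^ e)                          ≡⟨ cong (_^ (p ℕ.^ e)) (frobenius x y) ⟩
        (x ^ p ⊕ y ^ p) ^ (p ℕ.^ e)                        ≡⟨ frobenius^ e (x ^ p) (y ^ p) ⟩
        (x ^ p) ^ (p ℕ.^ e) ⊕ (y ^ p) ^ (p ℕ.^ e)          ≡⟨ cong₂ _⊕_ (^-assocʳ x p (p ℕ.^ e)) (^-assocʳ y p (p ℕ.^ e)) ⟩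
        x ^ (p ℕ.* p ℕ.^ e) ⊕ y ^ (p ℕ.* p ℕ.^ e)          ∎
        where open ≡-Reasoning

-- Positive semidefinite kernels on the multiplicative group.

module Kernels where

  open RationalLemmas
  open FiniteSums
  open FieldBasics
  open import Defs using (ℕ→ℚ; recipℕ)
  open import Data.Empty using (⊥-elim)
  open import Data.Fin using (Fin)
  open import Data.Fin.Properties using (_≟_)
  open import Data.List using (List; []; _∷_)
  open import Data.List.Relation.Unary.All as All using ([]; _∷_)
  open import Data.List.Relation.Unary.AllPairs using ([]; _∷_)
  open import Data.Nat as ℕ using (ℕ; zero; suc; NonZero)
  import Data.Nat.Properties as ℕ
  open import Data.Nat.Coprimality using (Coprime; coprime-Bézout)
  open import Data.Nat.DivMod using (m*[n/m]≡n)
  open import Data.Nat.Divisibility using (_∣_; divides)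
  open import Data.Nat.GCD using (module Bézout)
  open import Data.Nat.ListAction using (product)
  open import Data.Nat.Primality using (Prime; prime⇒nonZero; ¬prime[1]; ¬prime[0])
  open import Data.Nat.Tactic.RingSolver using () renaming (solve-∀ to solveℕ-∀)
  open import Data.Product using (∃; _×_; _,_; proj₁; proj₂)
  open import Data.Rational hiding (_≟_; NonZero)
  open import Data.Rational.Properties hiding (_≟_)
  open import Relation.Nullary using (Dec; yes; no)
  open import Relation.Nullary.Decidable using (¬?)
  open import Relation.Binary.PropositionalEquality
  open import Tactic.RingSolver using (solve-∀)

  2ℚ : ℚ
  2ℚ = 1ℚ + 1ℚ

  ∑-lin₂ : ∀ {n} c₁ c₂ (f₁ f₂ : Fin n → ℚ) →
    ∑ (λ i → c₁ * f₁ i + c₂ * f₂ i) ≡ c₁ * ∑ f₁ + c₂ * ∑ f₂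
  ∑-lin₂ c₁ c₂ f₁ f₂ = trans (∑-+ (λ i → c₁ * f₁ i) (λ i → c₂ * f₂ i)) (cong₂ _+_ (∑-*ˡ c₁ f₁) (∑-*ˡ c₂ f₂))

  ∑-lin₄ : ∀ {n} c₁ c₂ c₃ c₄ (f₁ f₂ f₃ f₄ : Fin n → ℚ) →
    ∑ (λ i → (c₁ * f₁ i + c₂ * f₂ i) + (c₃ * f₃ i + c₄ * f₄ i)) ≡
    (c₁ * ∑ f₁ + c₂ * ∑ f₂) + (c₃ * ∑ f₃ + c₄ * ∑ f₄)
  ∑-lin₄ c₁ c₂ c₃ c₄ f₁ f₂ f₃ f₄ =
    trans (∑-+ (λ i → c₁ * f₁ i + c₂ * f₂ i) (λ i → c₃ * f₃ i + c₄ * f₄ i))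
      (cong₂ _+_ (∑-lin₂ c₁ c₂ f₁ f₂) (∑-lin₂ c₃ c₄ f₃ f₄))

  inverse-mod : ∀ {m p} → Coprime m (suc (suc p)) → ∃ λ a → ∃ λ b → a ℕ.* m ≡ 1 ℕ.+ b ℕ.* suc (suc p)
  inverse-mod {m} {p} c with coprime-Bézout c
  ... | Bézout.+- x y eq = x , y , sym eq
  ... | Bézout.-+ x zero ()
  -- Here 1 + x·m = (y + 1)·P with P = p + 2. Multiplying by P - 1, which is -1 modulo P, corrects
  -- the sign; the quotient is (P - 1)(y + 1) - 1, written without subtraction.
  ... | Bézout.-+ x (suc y) eq = suc p ℕ.* x , y ℕ.+ p ℕ.* suc y , ℕ.+-cancelˡ-≡ (suc p) _ _ (begin
    suc p ℕ.+ suc p ℕ.* x ℕ.* m                  ≡⟨ eq₁ p x m ⟩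
    suc p ℕ.* (1 ℕ.+ x ℕ.* m)                    ≡⟨ cong (suc p ℕ.*_) eq ⟩
    suc p ℕ.* (suc y ℕ.* suc (suc p))            ≡⟨ eq₂ p y ⟩
    suc p ℕ.+ (1 ℕ.+ (y ℕ.+ p ℕ.* suc y) ℕ.* suc (suc p)) ∎)
    where
    open ≡-Reasoning
    eq₁ : ∀ p x m → suc p ℕ.+ suc p ℕ.* x ℕ.* m ≡ suc p ℕ.* (1 ℕ.+ x ℕ.* m)
    eq₁ = solveℕ-∀
    eq₂ : ∀ p y → suc p ℕ.* (suc y ℕ.* suc (suc p)) ≡ suc p ℕ.+ (1 ℕ.+ (y ℕ.+ p ℕ.* suc y) ℕ.* suc (suc p))
    eq₂ = solveℕ-∀

  -- Total division, with value 0 for the divisor 0, so that exponents N/p can be written without a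
  -- side condition.
  _div_ : ℕ → ℕ → ℕ
  m div zero  = 0
  m div suc d = m ℕ./ suc d

  ∣⇒≡*div : ∀ {d m} → .{{NonZero d}} → d ∣ m → m ≡ d ℕ.* (m div d)
  ∣⇒≡*div {suc d} h = sym (m*[n/m]≡n h)

  module KernelTheory {n : ℕ} (𝔽 : FinField n) where
    open FieldTheory 𝔽 public

    -- Test functions vanish at 𝟘, because χ(x/y) makes sense on F* only and the values of a kernel
    -- at 𝟘 are arbitrary.
    PSD : (F → F → ℚ) → Set
    PSD K = (f : F → ℚ) → f 𝟘 ≡ 0ℚ → 0ℚ ≤ ∑ (λ x → ∑ (λ y → f x * f y * K x y))

    record Kernel (K : F → F → ℚ) : Set where
      field
        diag  : ∀ {x} → x ≢ 𝟘 → K x x ≡ 1ℚ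
        scale : ∀ {z} x y → z ≢ 𝟘 → K (z ⊗ x) (z ⊗ y) ≡ K x y
        K-sym : ∀ x y → K x y ≡ K y x
        psd   : PSD K

    -- `gram` is the orthogonality of characters: for the average u over a set of characters closed
    -- under inversion, summing u(x, z)u(y, z) over z gives u(x, y) times N divided by the size of
    -- the set.
    record Factor (u : F → F → ℚ) : Set where
      field
        diag  : ∀ {x} → x ≢ 𝟘 → u x x ≡ 1ℚ
        scale : ∀ {z} x y → z ≢ 𝟘 → u (z ⊗ x) (z ⊗ y) ≡ u x y
        u-sym : ∀ x y → u x y ≡ u y x
        κ     : ℚ
        0<κ   : 0ℚ < κ
        gram  : ∀ {x y} → x ≢ 𝟘 → y ≢ 𝟘 → κ * u x y ≡ ∑ (λ z → nz z * (u x z * u y z))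

    Kernel-1 : Kernel (λ _ _ → 1ℚ)
    Kernel-1 = record
      { diag  = λ _ → refl
      ; scale = λ _ _ _ → refl
      ; K-sym = λ _ _ → refl
      ; psd   = λ f _ → subst (0ℚ ≤_) (sym (trans
          (∑-cong (λ x → trans (∑-cong (λ y → *-identityʳ (f x * f y))) (∑-*ˡ (f x) f)))
          (∑-*ʳ (∑ f) f))) (0≤sq (∑ f))
      }

    -- The Schur product theorem, for a factor with an explicit Gram decomposition.
    Kernel-* : ∀ {u K} → Factor u → Kernel K → Kernel (λ x y → u x y * K x y)
    Kernel-* {u} {K} U 𝒦 = record
      { diag  = λ ne → trans (cong₂ _*_ (U.diag ne) (𝒦.diag ne)) (*-identityˡ 1ℚ)
      ; scale = λ x y ne → cong₂ _*_ (U.scale x y ne) (𝒦.scale x y ne)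
      ; K-sym = λ x y → cong₂ _*_ (U.u-sym x y) (𝒦.K-sym x y)
      ; psd   = psd′
      }
      where
      module U = Factor U
      module 𝒦 = Kernel 𝒦
      psd′ : PSD (λ x y → u x y * K x y)
      psd′ f f0 = ≤-cancel* U.0<κ (subst₂ _≤_ (sym (*-zeroʳ U.κ)) (sym total) (0≤∑ slice))
        where
        open ≡-Reasoning
        -- f weighted by the z-th Gram vector of u. It still vanishes at 𝟘, so the semidefiniteness
        -- of K applies to each slice.
        fz : F → F → ℚ
        fz z x = f x * u x z
        T : F → F → F → ℚ
        T x y z = nz z * (fz z x * fz z y * K x y)
        slice : ∀ z → 0ℚ ≤ nz z * ∑ (λ x → ∑ (λ y → fz z x * fz z y * K x y))
        slice z = 0≤* (0≤⟦⟧ (¬? (z ≟ 𝟘))) (𝒦.psd (fz z) (trans (cong (_* u 𝟘 z) f0) (*-zeroˡ (u 𝟘 z))))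
        e₁ : ∀ κ a b u k → κ * (a * b * (u * k)) ≡ (a * b * k) * (κ * u)
        e₁ = solve-∀ ringℚ
        e₂ : ∀ a b k n u v → (a * b * k) * (n * (u * v)) ≡ n * (a * u * (b * v) * k)
        e₂ = solve-∀ ringℚ
        e₃ : ∀ κ b u k → κ * (0ℚ * b * (u * k)) ≡ 0ℚ
        e₃ = solve-∀ ringℚ
        e₄ : ∀ κ a u k → κ * (a * 0ℚ * (u * k)) ≡ 0ℚ
        e₄ = solve-∀ ringℚ
        e₅ : ∀ n u b k → n * (0ℚ * u * b * k) ≡ 0ℚ
        e₅ = solve-∀ ringℚ
        e₆ : ∀ n a u k → n * (a * (0ℚ * u) * k) ≡ 0ℚ
        e₆ = solve-∀ ringℚ
        -- The Gram identity is available only for nonzero x and y; elsewhere both sides vanish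
        -- together with f.
        pointwise : ∀ x y → Dec (x ≡ 𝟘) → Dec (y ≡ 𝟘) → U.κ * (f x * f y * (u x y * K x y)) ≡ ∑ (T x y)
        pointwise x y (yes refl) _ = trans
          (trans (cong (λ t → U.κ * (t * f y * (u 𝟘 y * K 𝟘 y))) f0) (e₃ U.κ (f y) (u 𝟘 y) (K 𝟘 y)))
          (sym (∑-zero (λ z → trans (cong (λ t → nz z * (t * u 𝟘 z * fz z y * K 𝟘 y)) f0) (e₅ (nz z) (u 𝟘 z) (fz z y) (K 𝟘 y)))))
        pointwise x y (no _) (yes refl) = trans
          (trans (cong (λ t → U.κ * (f x * t * (u x 𝟘 * K x 𝟘))) f0) (e₄ U.κ (f x) (u x 𝟘) (K x 𝟘)))
          (sym (∑-zero (λ z → trans (cong (λ t → nz z * (fz z x * (t * u 𝟘 z) * K x 𝟘)) f0) (e₆ (nz z) (fz z x) (u 𝟘 z) (K x 𝟘)))))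
        pointwise x y (no nx) (no ny) = begin
          U.κ * (f x * f y * (u x y * K x y))                             ≡⟨ e₁ U.κ (f x) (f y) (u x y) (K x y) ⟩
          (f x * f y * K x y) * (U.κ * u x y)                             ≡⟨ cong (_*_ (f x * f y * K x y)) (U.gram nx ny) ⟩
          (f x * f y * K x y) * ∑ (λ z → nz z * (u x z * u y z))          ≡⟨ ∑-*ˡ (f x * f y * K x y) (λ z → nz z * (u x z * u y z)) ⟨
          ∑ (λ z → (f x * f y * K x y) * (nz z * (u x z * u y z)))        ≡⟨ ∑-cong (λ z → e₂ (f x) (f y) (K x y) (nz z) (u x z) (u y z)) ⟩
          ∑ (T x y)                                                       ∎
        total : U.κ * ∑ (λ x → ∑ (λ y → f x * f y * (u x y * K x y))) ≡
                ∑ (λ z → nz z * ∑ (λ x → ∑ (λ y → fz z x * fz z y * K x y)))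
        total = begin
          U.κ * ∑ (λ x → ∑ (λ y → f x * f y * (u x y * K x y)))
            ≡⟨ ∑-*ˡ U.κ (λ x → ∑ (λ y → f x * f y * (u x y * K x y))) ⟨
          ∑ (λ x → U.κ * ∑ (λ y → f x * f y * (u x y * K x y)))
            ≡⟨ ∑-cong (λ x → ∑-*ˡ U.κ (λ y → f x * f y * (u x y * K x y))) ⟨
          ∑ (λ x → ∑ (λ y → U.κ * (f x * f y * (u x y * K x y))))
            ≡⟨ ∑-cong (λ x → ∑-cong (λ y → pointwise x y (x ≟ 𝟘) (y ≟ 𝟘))) ⟩
          ∑ (λ x → ∑ (λ y → ∑ (T x y)))
            ≡⟨ ∑-cong (λ x → ∑-swap (T x)) ⟩
          ∑ (λ x → ∑ (λ z → ∑ (λ y → T x y z)))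
            ≡⟨ ∑-swap (λ x z → ∑ (λ y → T x y z)) ⟩
          ∑ (λ z → ∑ (λ x → ∑ (λ y → T x y z)))
            ≡⟨ ∑-cong (λ z → trans (∑-cong (λ x → ∑-*ˡ (nz z) (λ y → fz z x * fz z y * K x y)))
                 (∑-*ˡ (nz z) (λ x → ∑ (λ y → fz z x * fz z y * K x y)))) ⟩
          ∑ (λ z → nz z * ∑ (λ x → ∑ (λ y → fz z x * fz z y * K x y))) ∎

    -- For N = d·e and nonzero x, y this indicates that x/y is a d-th power; it is the average of
    -- χ(x/y) over the characters of order dividing d.
    sim : ℕ → F → F → ℚ
    sim e x y = ⟦ x ^ e ≟ y ^ e ⟧

    sim-refl : ∀ e x → sim e x x ≡ 1ℚ
    sim-refl e x = ⟦⟧-yes (x ^ e ≟ x ^ e) refl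

    sim-sym : ∀ e x y → sim e x y ≡ sim e y x
    sim-sym e x y = ⟦⟧-cong (x ^ e ≟ y ^ e) (y ^ e ≟ x ^ e) sym sym

    sim-scale : ∀ e {z} x y → z ≢ 𝟘 → sim e (z ⊗ x) (z ⊗ y) ≡ sim e x y
    sim-scale e {z} x y ne = ⟦⟧-cong ((z ⊗ x) ^ e ≟ (z ⊗ y) ^ e) (x ^ e ≟ y ^ e)
      (λ h → ⊗-cancelˡ (^-nonzero ne e) (trans (sym (^-distrib-* z x e)) (trans h (^-distrib-* z y e))))
      (λ h → trans (^-distrib-* z x e) (trans (cong (z ^ e ⊗_) h) (sym (^-distrib-* z y e))))

    nz-scale : ∀ {z} x → z ≢ 𝟘 → nz (z ⊗ x) ≡ nz x
    nz-scale {z} x ne = ⟦⟧-cong (¬? (z ⊗ x ≟ 𝟘)) (¬? (x ≟ 𝟘))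
      (λ { h refl → h (R.zeroʳ z) }) (λ nx → ⊗-nonzero ne nx)

    nz-weight : ∀ x {a b : ℚ} → (x ≢ 𝟘 → a ≡ b) → nz x * a ≡ nz x * b
    nz-weight x = ⟦⟧-weight (¬? (x ≟ 𝟘))

    module _ (d e : ℕ) .{{_ : NonZero d}} .{{_ : NonZero e}} (N≡ : N ≡ d ℕ.* e) where

      ∑-sim-𝟙 : ∑ (λ z → nz z * sim e z 𝟙) ≡ ℕ→ℚ e
      ∑-sim-𝟙 = trans (∑-cong h) (count-roots d e N≡)
        where
        h : ∀ z → nz z * sim e z 𝟙 ≡ ⟦ z ^ e ≟ 𝟙 ⟧
        h z = trans (by (z ^ e ≟ 𝟙 ^ e)) (⟦⟧-cong (z ^ e ≟ 𝟙 ^ e) (z ^ e ≟ 𝟙) (λ t → trans t (𝟙^ e)) (λ t → trans t (sym (𝟙^ e))))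
          where
          by : (t : Dec (z ^ e ≡ 𝟙 ^ e)) → nz z * ⟦ t ⟧ ≡ ⟦ t ⟧
          by (yes t) = trans (*-identityʳ (nz z)) (nz-nonzero (^≡𝟙⇒nonzero e (trans t (𝟙^ e))))
          by (no _)  = *-zeroʳ (nz z)

      ∑-sim : ∀ {x} → x ≢ 𝟘 → ∑ (λ z → nz z * sim e x z) ≡ ℕ→ℚ e
      ∑-sim {x} ne = trans (sym (∑-scale ne (λ z → nz z * sim e x z))) (trans (∑-cong h) ∑-sim-𝟙)
        where
        h : ∀ z → nz (x ⊗ z) * sim e x (x ⊗ z) ≡ nz z * sim e z 𝟙
        h z = cong₂ _*_ (nz-scale z ne) (trans (cong (λ t → sim e t (x ⊗ z)) (sym (R.*-identityʳ x)))
          (trans (sim-scale e 𝟙 z ne) (sim-sym e 𝟙 z)))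

      -- On the class of x, where z^e = x^e, the second factor is constant, since there the e′-th
      -- powers agree too. What is left is the size of that class.
      ∑-sim-sim : ∀ e′ → (∀ x z → x ^ e ≡ z ^ e → x ^ e′ ≡ z ^ e′) → ∀ {x} y → x ≢ 𝟘 →
        ∑ (λ z → nz z * (sim e x z * sim e′ y z)) ≡ sim e′ x y * ℕ→ℚ e
      ∑-sim-sim e′ coarser {x} y ne = trans (∑-cong h)
        (trans (∑-*ˡ (sim e′ x y) (λ z → nz z * sim e x z)) (cong (_*_ (sim e′ x y)) (∑-sim ne)))
        where
        eq : ∀ a b c → a * (b * c) ≡ c * (a * b)
        eq = solve-∀ ringℚ
        h : ∀ z → nz z * (sim e x z * sim e′ y z) ≡ sim e′ x y * (nz z * sim e x z)
        h z = trans (cong (_*_ (nz z)) (⟦⟧-weight (x ^ e ≟ z ^ e) {sim e′ y z} {sim e′ x y}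
          (λ xz → ⟦⟧-cong (y ^ e′ ≟ z ^ e′) (x ^ e′ ≟ y ^ e′)
            (λ yz → trans (coarser x z xz) (sym yz)) (λ xy → trans (sym xy) (coarser x z xz)))))
          (eq (nz z) (sim e x z) (sim e′ x y))

    -- The exponent that tests for p-th powers when p divides N. It is also used with p = 4.
    E : ℕ → ℕ
    E p = N div p

    -- u p x y is the average of χ(x/y) over the p − 1 characters χ of order p: it is 1 if x/y is a p-th power,
    -- and −1/(p−1) otherwise.
    a b : ℕ → ℚ
    a p = recipℕ (p ℕ.∸ 1)
    b p = 1ℚ + a p

    u : ℕ → F → F → ℚ
    u p x y = b p * sim (E p) x y - a p

    PrimeDivisor : ℕ → Set
    PrimeDivisor p = Prime p × p ∣ N × NonZero N

    module _ {p : ℕ} (pd : PrimeDivisor p) where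
      private
        pp  = proj₁ pd
        p∣N = proj₁ (proj₂ pd)
        instance
          N≢0 : NonZero N
          N≢0 = proj₂ (proj₂ pd)
          p≢0 : NonZero p
          p≢0 = prime⇒nonZero pp

      N≡p*E : N ≡ p ℕ.* E p
      N≡p*E = ∣⇒≡*div p∣N

      E≢0 : NonZero (E p)
      E≢0 = ℕ.m*n≢0⇒n≢0 p {{subst NonZero N≡p*E N≢0}}

      a-inverse : a p * (ℕ→ℚ p - 1ℚ) ≡ 1ℚ
      a-inverse = go p pp
        where
        eq : ∀ a m → a * (1ℚ + m - 1ℚ) ≡ a * m
        eq = solve-∀ ringℚ
        go : ∀ p → Prime p → a p * (ℕ→ℚ p - 1ℚ) ≡ 1ℚ
        go zero h = ⊥-elim (¬prime[0] h)
        go (suc zero) h = ⊥-elim (¬prime[1] h)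
        go (suc (suc p)) h = trans (cong (λ t → a (suc (suc p)) * (t - 1ℚ)) (ℕ→ℚ-suc (suc p)))
          (trans (eq (recipℕ (suc p)) (ℕ→ℚ (suc p))) (recip-inverse (suc p)))

      0<a : 0ℚ < a p
      0<a = go p pp
        where
        go : ∀ p → Prime p → 0ℚ < a p
        go zero h = ⊥-elim (¬prime[0] h)
        go (suc zero) h = ⊥-elim (¬prime[1] h)
        go (suc (suc p)) h = 0<recip (suc p)

      b≡ap : b p ≡ a p * ℕ→ℚ p
      b≡ap = trans (cong (_+ a p) (sym a-inverse)) (eq (a p) (ℕ→ℚ p))
        where
        eq : ∀ a p → a * (p - 1ℚ) + a ≡ a * p
        eq = solve-∀ ringℚ

      bE≡aN : b p * ℕ→ℚ (E p) ≡ a p * ℕ→ℚ N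
      bE≡aN = trans (cong (_* ℕ→ℚ (E p)) b≡ap) (trans (*-assoc (a p) (ℕ→ℚ p) (ℕ→ℚ (E p)))
        (cong (_*_ (a p)) (trans (sym (ℕ→ℚ-* p (E p))) (cong ℕ→ℚ (sym N≡p*E)))))

      -- The p characters of order dividing p have equal weight in the indicator of p-th powers: the
      -- trivial one gives 1/p, and the other p - 1, with average `u p`, give the rest.
      sim≡u : ∀ x y → sim (E p) x y ≡ recipℕ p + (1ℚ - recipℕ p) * u p x y
      sim≡u x y = sym (begin
        i + (1ℚ - i) * (b p * s - a p)           ≡⟨ cong (λ t → i + (1ℚ - i) * (t * s - a p)) b≡ap ⟩
        i + (1ℚ - i) * (a p * P * s - a p)       ≡⟨ eq i (a p) P s ⟩
        i + a p * (P - i * P) * s - (a p - a p * i) ≡⟨ cong (λ t → i + a p * (P - t) * s - (a p - a p * i)) (recip-inverse p) ⟩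
        i + a p * (P - 1ℚ) * s - (a p - a p * i) ≡⟨ cong (λ t → i + t * s - (a p - a p * i)) a-inverse ⟩
        i + 1ℚ * s - (a p - a p * i)             ≡⟨ cong (λ t → i + 1ℚ * s - t) a-ai ⟩
        i + 1ℚ * s - i                           ≡⟨ eq′ i s ⟩
        s ∎)
        where
        open ≡-Reasoning
        i = recipℕ p
        P = ℕ→ℚ p
        s = sim (E p) x y
        eq : ∀ i a p s → i + (1ℚ - i) * (a * p * s - a) ≡ i + a * (p - i * p) * s - (a - a * i)
        eq = solve-∀ ringℚ
        eq′ : ∀ i s → i + 1ℚ * s - i ≡ s
        eq′ = solve-∀ ringℚ
        eq″ : ∀ i a p → a * (i * p) - a * i ≡ i * (a * (p - 1ℚ))
        eq″ = solve-∀ ringℚ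
        a-ai : a p - a p * i ≡ i
        a-ai = begin
          a p - a p * i               ≡⟨ cong (_- a p * i) (*-identityʳ (a p)) ⟨
          a p * 1ℚ - a p * i          ≡⟨ cong (λ t → a p * t - a p * i) (recip-inverse p) ⟨
          a p * (i * P) - a p * i     ≡⟨ eq″ i (a p) P ⟩
          i * (a p * (P - 1ℚ))        ≡⟨ cong (_*_ i) a-inverse ⟩
          i * 1ℚ                      ≡⟨ *-identityʳ i ⟩
          i                           ∎

      -- κ = N/(p - 1), where p - 1 is the number of characters averaged. The product is multiplied
      -- out into four sums that count classes, and `bE≡aN` makes them combine.
      Factor-u : Factor (u p)
      Factor-u = record
        { diag  = λ {x} _ → trans (cong (λ t → b p * t - a p) (sim-refl (E p) x)) (eq₀ (a p))
        ; scale = λ x y ne → cong (λ t → b p * t - a p) (sim-scale (E p) x y ne)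
        ; u-sym = λ x y → cong (λ t → b p * t - a p) (sim-sym (E p) x y)
        ; κ     = a p * ℕ→ℚ N
        ; 0<κ   = 0<* 0<a (0<ℕ→ℚ N)
        ; gram  = gram
        }
        where
        open ≡-Reasoning
        e = E p
        instance
          _ = E≢0
        eq₀ : ∀ a → (1ℚ + a) * 1ℚ - a ≡ 1ℚ
        eq₀ = solve-∀ ringℚ
        eq₁ : ∀ a b n s t → n * ((b * s - a) * (b * t - a)) ≡
          ((b * b) * (n * (s * t)) + (- (a * b)) * (n * s)) + ((- (a * b)) * (n * t) + (a * a) * n)
        eq₁ = solve-∀ ringℚ
        eq₂ : ∀ a b e s N → ((b * b) * (s * e) + (- (a * b)) * e) + ((- (a * b)) * e + (a * a) * N) ≡
          (b * e) * (b * s - 2ℚ * a) + (a * a) * N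
        eq₂ = solve-∀ ringℚ
        eq₃ : ∀ a b s N → (a * N) * (b * s - 2ℚ * a) + (a * a) * N ≡ (a * N) * (b * s - a)
        eq₃ = solve-∀ ringℚ
        gram : ∀ {x y} → x ≢ 𝟘 → y ≢ 𝟘 → a p * ℕ→ℚ N * u p x y ≡ ∑ (λ z → nz z * (u p x z * u p y z))
        gram {x} {y} nx ny = sym (begin
          ∑ (λ z → nz z * (u p x z * u p y z))
            ≡⟨ ∑-cong (λ z → eq₁ (a p) (b p) (nz z) (sim e x z) (sim e y z)) ⟩
          _ ≡⟨ ∑-lin₄ (b p * b p) (- (a p * b p)) (- (a p * b p)) (a p * a p)
                 (λ z → nz z * (sim e x z * sim e y z)) (λ z → nz z * sim e x z) (λ z → nz z * sim e y z) nz ⟩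
          _ ≡⟨ cong₂ _+_
                 (cong₂ (λ s t → b p * b p * s + - (a p * b p) * t) (∑-sim-sim p e N≡p*E e (λ _ _ h → h) y nx) (∑-sim p e N≡p*E nx))
                 (cong₂ (λ s t → - (a p * b p) * s + a p * a p * t) (∑-sim p e N≡p*E ny) ∑-nz) ⟩
          _ ≡⟨ eq₂ (a p) (b p) (ℕ→ℚ e) (sim e x y) (ℕ→ℚ N) ⟩
          _ ≡⟨ cong (λ t → t * (b p * sim e x y - 2ℚ * a p) + a p * a p * ℕ→ℚ N) bE≡aN ⟩
          _ ≡⟨ eq₃ (a p) (b p) (sim e x y) (ℕ→ℚ N) ⟩
          a p * ℕ→ℚ N * u p x y ∎)

      u≡1 : ∀ {z} → z ^ E p ≡ 𝟙 → u p z 𝟙 ≡ 1ℚ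
      u≡1 {z} h = trans (cong (λ t → b p * t - a p) (⟦⟧-yes (z ^ E p ≟ 𝟙 ^ E p) (trans h (sym (𝟙^ (E p)))))) (eq (a p))
        where
        eq : ∀ a → (1ℚ + a) * 1ℚ - a ≡ 1ℚ
        eq = solve-∀ ringℚ

    -- In terms of characters: K averages characters whose order divides m.
    PowerInvariant : ℕ → (F → F → ℚ) → Set
    PowerInvariant m K = ∀ {g} x y → g ≢ 𝟘 → K (g ^ m ⊗ x) y ≡ K x y

    sim-powerInvariant : ∀ {d e m} → N ≡ d ℕ.* e → d ∣ m → PowerInvariant m (sim e)
    sim-powerInvariant {d} {e} {m} N≡ (divides c refl) {g} x y ne =
      cong (λ t → ⟦ t ≟ y ^ e ⟧) (begin
        (g ^ (c ℕ.* d) ⊗ x) ^ e            ≡⟨ ^-distrib-* (g ^ (c ℕ.* d)) x e ⟩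
        (g ^ (c ℕ.* d)) ^ e ⊗ x ^ e        ≡⟨ cong (_⊗ x ^ e) (^-assocʳ g (c ℕ.* d) e) ⟩
        g ^ (c ℕ.* d ℕ.* e) ⊗ x ^ e        ≡⟨ cong (λ k → g ^ k ⊗ x ^ e) (trans (ℕ.*-assoc c d e) (cong (c ℕ.*_) (sym N≡))) ⟩
        g ^ (c ℕ.* N) ⊗ x ^ e              ≡⟨ cong (_⊗ x ^ e) (^-assocʳ g c N) ⟨
        (g ^ c) ^ N ⊗ x ^ e                ≡⟨ cong (_⊗ x ^ e) (fermat (^-nonzero ne c)) ⟩
        𝟙 ⊗ x ^ e                          ≡⟨ R.*-identityˡ (x ^ e) ⟩
        x ^ e                              ∎)
      where open ≡-Reasoning

    u-powerInvariant : ∀ {p m} → PrimeDivisor p → p ∣ m → PowerInvariant m (u p)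
    u-powerInvariant {p} pd p∣m x y ne =
      cong (λ t → b p * t - a p) (sim-powerInvariant (N≡p*E pd) p∣m x y ne)

    -- Replace x by g^m x and average over g: K does not change, and u averages to zero since m is
    -- invertible modulo p.
    ∑-u*K≡0 : ∀ {p m K} → PrimeDivisor p → Coprime m p → PowerInvariant m K →
      ∑ (λ x → nz x * (u p x 𝟙 * K x 𝟙)) ≡ 0ℚ
    ∑-u*K≡0 {p} {m} {K} pd@(pp , _ , N≢0) cop inv-K = go p refl
      where
      open ≡-Reasoning
      e = E p
      instance
        _ = E≢0 pd
        _ = prime⇒nonZero pp
        _ = N≢0
      S = ∑ (λ x → nz x * (u p x 𝟙 * K x 𝟙))

      module _ {c d : ℕ} (cm : c ℕ.* m ≡ 1 ℕ.+ d ℕ.* p) where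
        -- z^e is a p-th root of unity because e·p = N, so exponents of z^e matter only modulo p.
        cp : ∀ {z} → z ≢ 𝟘 → (z ^ e) ^ (c ℕ.* m) ≡ z ^ e
        cp {z} nz′ = begin
          (z ^ e) ^ (c ℕ.* m)                 ≡⟨ cong ((z ^ e) ^_) cm ⟩
          z ^ e ⊗ (z ^ e) ^ (d ℕ.* p)         ≡⟨ cong (z ^ e ⊗_) (^-assocʳ z e (d ℕ.* p)) ⟩
          z ^ e ⊗ z ^ (e ℕ.* (d ℕ.* p))       ≡⟨ cong (λ k → z ^ e ⊗ z ^ k) (trans (eqℕ e d p) (cong (ℕ._* d) (sym (N≡p*E pd)))) ⟩
          z ^ e ⊗ z ^ (N ℕ.* d)               ≡⟨ cong (z ^ e ⊗_) (^-assocʳ z N d) ⟨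
          z ^ e ⊗ (z ^ N) ^ d                 ≡⟨ cong (λ t → z ^ e ⊗ t ^ d) (fermat nz′) ⟩
          z ^ e ⊗ 𝟙 ^ d                       ≡⟨ cong (z ^ e ⊗_) (𝟙^ d) ⟩
          z ^ e ⊗ 𝟙                           ≡⟨ R.*-identityʳ (z ^ e) ⟩
          z ^ e                               ∎
          where
          eqℕ : ∀ e d p → e ℕ.* (d ℕ.* p) ≡ p ℕ.* e ℕ.* d
          eqℕ = solveℕ-∀

        swap^ : ∀ z i j → (z ^ i) ^ j ≡ (z ^ j) ^ i
        swap^ z i j = trans (^-assocʳ z i j) (trans (cong (z ^_) (ℕ.*-comm i j)) (sym (^-assocʳ z j i)))

        -- Modulo p-th powers the exponents c and m are inverse to each other, so g^m x is trivial
        -- there exactly if x^c g is. In the second form g has exponent 1, and the sum over g can be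
        -- rescaled by x^c.
        sim-twist : ∀ {x g} → x ≢ 𝟘 → g ≢ 𝟘 → sim e (g ^ m ⊗ x) 𝟙 ≡ sim e (x ^ c ⊗ g) 𝟙
        sim-twist {x} {g} nx ng = ⟦⟧-cong ((g ^ m ⊗ x) ^ e ≟ 𝟙 ^ e) ((x ^ c ⊗ g) ^ e ≟ 𝟙 ^ e)
          (λ h → trans (trans fwd (cong (_^ c) h)) (trans (cong (_^ c) (𝟙^ e)) (trans (𝟙^ c) (sym (𝟙^ e)))))
          (λ h → trans (trans bwd (cong (_^ m) h)) (trans (cong (_^ m) (𝟙^ e)) (trans (𝟙^ m) (sym (𝟙^ e)))))
          where
          fwd : (x ^ c ⊗ g) ^ e ≡ ((g ^ m ⊗ x) ^ e) ^ c
          fwd = sym (begin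
            ((g ^ m ⊗ x) ^ e) ^ c                ≡⟨ cong (_^ c) (^-distrib-* (g ^ m) x e) ⟩
            ((g ^ m) ^ e ⊗ x ^ e) ^ c            ≡⟨ ^-distrib-* ((g ^ m) ^ e) (x ^ e) c ⟩
            ((g ^ m) ^ e) ^ c ⊗ (x ^ e) ^ c      ≡⟨ cong₂ _⊗_ (cong (_^ c) (swap^ g m e)) (swap^ x e c) ⟩
            ((g ^ e) ^ m) ^ c ⊗ (x ^ c) ^ e      ≡⟨ cong (_⊗ (x ^ c) ^ e) (trans (^-assocʳ (g ^ e) m c)
                                                      (trans (cong ((g ^ e) ^_) (ℕ.*-comm m c)) (cp ng))) ⟩
            g ^ e ⊗ (x ^ c) ^ e                  ≡⟨ R.*-comm _ _ ⟩
            (x ^ c) ^ e ⊗ g ^ e                  ≡⟨ ^-distrib-* (x ^ c) g e ⟨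
            (x ^ c ⊗ g) ^ e                      ∎)
          bwd : (g ^ m ⊗ x) ^ e ≡ ((x ^ c ⊗ g) ^ e) ^ m
          bwd = sym (begin
            ((x ^ c ⊗ g) ^ e) ^ m                ≡⟨ cong (_^ m) (^-distrib-* (x ^ c) g e) ⟩
            ((x ^ c) ^ e ⊗ g ^ e) ^ m            ≡⟨ ^-distrib-* ((x ^ c) ^ e) (g ^ e) m ⟩
            ((x ^ c) ^ e) ^ m ⊗ (g ^ e) ^ m      ≡⟨ cong₂ _⊗_ (cong (_^ m) (swap^ x c e)) (swap^ g e m) ⟩
            ((x ^ e) ^ c) ^ m ⊗ (g ^ m) ^ e      ≡⟨ cong (_⊗ (g ^ m) ^ e) (trans (^-assocʳ (x ^ e) c m) (cp nx)) ⟩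
            x ^ e ⊗ (g ^ m) ^ e                  ≡⟨ R.*-comm _ _ ⟩
            (g ^ m) ^ e ⊗ x ^ e                  ≡⟨ ^-distrib-* (g ^ m) x e ⟨
            (g ^ m ⊗ x) ^ e                      ∎)

        average : ∀ {x} → x ≢ 𝟘 → ∑ (λ g → nz g * u p (g ^ m ⊗ x) 𝟙) ≡ 0ℚ
        average {x} nx = begin
          ∑ (λ g → nz g * u p (g ^ m ⊗ x) 𝟙)
            ≡⟨ ∑-cong (λ g → nz-weight g (λ ng → cong (λ t → b p * t - a p) (sim-twist nx ng))) ⟩
          ∑ (λ g → nz g * u p (x ^ c ⊗ g) 𝟙)
            ≡⟨ ∑-cong (λ g → cong (_* u p (x ^ c ⊗ g) 𝟙) (nz-scale g (^-nonzero nx c))) ⟨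
          ∑ (λ g → nz (x ^ c ⊗ g) * u p (x ^ c ⊗ g) 𝟙)
            ≡⟨ ∑-scale (^-nonzero nx c) (λ g → nz g * u p g 𝟙) ⟩
          ∑ (λ g → nz g * u p g 𝟙)
            ≡⟨ ∑-cong (λ g → eq₁ (nz g) (b p) (sim e g 𝟙) (a p)) ⟩
          ∑ (λ g → b p * (nz g * sim e g 𝟙) + (- a p) * nz g)
            ≡⟨ ∑-lin₂ (b p) (- a p) (λ g → nz g * sim e g 𝟙) nz ⟩
          b p * ∑ (λ g → nz g * sim e g 𝟙) + (- a p) * ∑ nz
            ≡⟨ cong₂ (λ s t → b p * s + (- a p) * t) (∑-sim-𝟙 p e (N≡p*E pd)) ∑-nz ⟩
          b p * ℕ→ℚ e + (- a p) * ℕ→ℚ N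
            ≡⟨ cong (_+ (- a p) * ℕ→ℚ N) (bE≡aN pd) ⟩
          a p * ℕ→ℚ N + (- a p) * ℕ→ℚ N
            ≡⟨ eq₂ (a p) (ℕ→ℚ N) ⟩
          0ℚ ∎
          where
          eq₁ : ∀ n b s a → n * (b * s - a) ≡ b * (n * s) + (- a) * n
          eq₁ = solve-∀ ringℚ
          eq₂ : ∀ a n → a * n + (- a) * n ≡ 0ℚ
          eq₂ = solve-∀ ringℚ

        N*S≡0 : ℕ→ℚ N * S ≡ 0ℚ
        N*S≡0 = begin
          ℕ→ℚ N * S                                    ≡⟨ cong (_* S) ∑-nz ⟨
          ∑ nz * S                                     ≡⟨ ∑-*ʳ S nz ⟨
          ∑ (λ g → nz g * S)                           ≡⟨ ∑-cong (λ g → nz-weight g (shift g)) ⟩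
          ∑ (λ g → nz g * ∑ (λ x → nz x * (u p (g ^ m ⊗ x) 𝟙 * K x 𝟙)))
            ≡⟨ ∑-cong (λ g → ∑-*ˡ (nz g) (λ x → nz x * (u p (g ^ m ⊗ x) 𝟙 * K x 𝟙))) ⟨
          ∑ (λ g → ∑ (λ x → nz g * (nz x * (u p (g ^ m ⊗ x) 𝟙 * K x 𝟙))))
            ≡⟨ ∑-swap (λ g x → nz g * (nz x * (u p (g ^ m ⊗ x) 𝟙 * K x 𝟙))) ⟩
          ∑ (λ x → ∑ (λ g → nz g * (nz x * (u p (g ^ m ⊗ x) 𝟙 * K x 𝟙))))
            ≡⟨ ∑-zero inner ⟩
          0ℚ ∎
          where
          eq₁ : ∀ ng nx u k → ng * (nx * (u * k)) ≡ nx * k * (ng * u)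
          eq₁ = solve-∀ ringℚ
          shift : ∀ g → g ≢ 𝟘 → S ≡ ∑ (λ x → nz x * (u p (g ^ m ⊗ x) 𝟙 * K x 𝟙))
          shift g ng = trans (sym (∑-scale (^-nonzero ng m) (λ x → nz x * (u p x 𝟙 * K x 𝟙))))
            (∑-cong (λ x → cong₂ _*_ (nz-scale x (^-nonzero ng m)) (cong (_*_ (u p (g ^ m ⊗ x) 𝟙)) (inv-K x 𝟙 ng))))
          inner : ∀ x → ∑ (λ g → nz g * (nz x * (u p (g ^ m ⊗ x) 𝟙 * K x 𝟙))) ≡ 0ℚ
          inner x = trans (∑-cong (λ g → eq₁ (nz g) (nz x) (u p (g ^ m ⊗ x) 𝟙) (K x 𝟙)))
            (trans (∑-*ˡ (nz x * K x 𝟙) (λ g → nz g * u p (g ^ m ⊗ x) 𝟙)) (by (x ≟ 𝟘)))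
            where
            by : Dec (x ≡ 𝟘) → nz x * K x 𝟙 * ∑ (λ g → nz g * u p (g ^ m ⊗ x) 𝟙) ≡ 0ℚ
            by (yes refl) = trans (cong (λ t → t * K 𝟘 𝟙 * Σu) nz-𝟘) (trans (cong (_* Σu) (*-zeroˡ (K 𝟘 𝟙))) (*-zeroˡ Σu))
              where Σu = ∑ (λ g → nz g * u p (g ^ m ⊗ 𝟘) 𝟙)
            by (no nx) = trans (cong (_*_ (nz x * K x 𝟙)) (average nx)) (*-zeroʳ (nz x * K x 𝟙))

      cancelN : ℕ→ℚ N * S ≡ 0ℚ → S ≡ 0ℚ
      cancelN h = ≤-antisym
        (≤-cancel* (0<ℕ→ℚ N) (≤-reflexive (trans h (sym (*-zeroʳ (ℕ→ℚ N))))))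
        (≤-cancel* (0<ℕ→ℚ N) (≤-reflexive (trans (*-zeroʳ (ℕ→ℚ N)) (sym h))))

      go : ∀ p′ → p ≡ p′ → S ≡ 0ℚ
      go zero e = ⊥-elim (¬prime[0] (subst Prime e pp))
      go (suc zero) e = ⊥-elim (¬prime[1] (subst Prime e pp))
      go (suc (suc p′)) refl with inverse-mod {m} {p′} cop
      ... | c , d , cm = cancelN (N*S≡0 {c} {d} cm)

-- Kernel sums along an affine line over 𝔽_q.

module Lines where

  open RationalLemmas
  open FiniteSums
  open FieldBasics
  open Kernels
  open import Defs using (ℕ→ℚ)
  import Algebra.Properties.CommutativeSemigroup as CommutativeSemigroupProperties
  import Algebra.Properties.Ring as RingProperties
  open import Data.Fin.Properties using (_≟_)
  open import Data.Nat as ℕ using (ℕ; NonZero)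
  import Data.Nat.Properties as ℕ
  open import Data.Product using (∃; _×_; _,_; proj₁; proj₂)
  open import Data.Rational hiding (_≟_; NonZero)
  open import Data.Rational.Properties hiding (_≟_)
  open import Relation.Nullary using (¬_; Dec; yes; no)
  open import Relation.Nullary.Decidable using (¬?)
  open import Relation.Binary.PropositionalEquality
  open import Tactic.RingSolver using (solve-∀)

  record LineData {n : ℕ} (𝔽 : FinField n) : Set where
    open FieldTheory 𝔽
    field
      q         : ℕ
      1<q       : 1 ℕ.< q
      n≡q*q     : n ≡ q ℕ.* q
      frobenius-q : ∀ x y → (x ⊕ y) ^ q ≡ x ^ q ⊕ y ^ q
      θ₁ θ₂     : F
      independent : ∀ a b → a ^ q ≡ a → b ^ q ≡ b → a ⊗ θ₁ ⊕ b ⊗ θ₂ ≡ 𝟘 → a ≡ 𝟘 × b ≡ 𝟘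
      spanning  : ∀ ξ → ∃ λ a → ∃ λ b → a ^ q ≡ a × b ^ q ≡ b × ξ ≡ a ⊗ θ₁ ⊕ b ⊗ θ₂

  module LineTheory {n : ℕ} {𝔽 : FinField n} (𝓛 : LineData 𝔽) where
    open KernelTheory 𝔽 public
    open LineData 𝓛 public
    open CommutativeSemigroupProperties R.+-commutativeSemigroup using (interchange)

    instance
      q≢0 : NonZero q
      q≢0 = ℕ.>-nonZero (ℕ.<-trans (ℕ.s≤s ℕ.z≤n) 1<q)

    InSub : F → Set
    InSub x = x ^ q ≡ x

    inSub? : ∀ x → Dec (InSub x)
    inSub? x = x ^ q ≟ x

    w : F → ℚ
    w x = ⟦ inSub? x ⟧

    sub-𝟘 : InSub 𝟘
    sub-𝟘 = 𝟘^ q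

    sub-𝟙 : InSub 𝟙
    sub-𝟙 = 𝟙^ q

    sub-⊕ : ∀ {x y} → InSub x → InSub y → InSub (x ⊕ y)
    sub-⊕ {x} {y} hx hy = trans (frobenius-q x y) (cong₂ _⊕_ hx hy)

    sub-⊗ : ∀ {x y} → InSub x → InSub y → InSub (x ⊗ y)
    sub-⊗ {x} {y} hx hy = trans (^-distrib-* x y q) (cong₂ _⊗_ hx hy)

    ⊕-cancelˡ : ∀ x {y z} → x ⊕ y ≡ x ⊕ z → y ≡ z
    ⊕-cancelˡ x {y} {z} = RingProperties.+-cancelˡ R.ring x y z

    sub-⊖ : ∀ {x} → InSub x → InSub (⊖ x)
    sub-⊖ {x} hx = ⊕-cancelˡ x (begin
      x ⊕ (⊖ x) ^ q       ≡⟨ cong (_⊕ (⊖ x) ^ q) hx ⟨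
      x ^ q ⊕ (⊖ x) ^ q   ≡⟨ frobenius-q x (⊖ x) ⟨
      (x ⊕ ⊖ x) ^ q       ≡⟨ cong (_^ q) (R.-‿inverseʳ x) ⟩
      𝟘 ^ q               ≡⟨ sub-𝟘 ⟩
      𝟘                   ≡⟨ R.-‿inverseʳ x ⟨
      x ⊕ ⊖ x             ∎)
      where open ≡-Reasoning

    sub-inv : ∀ {x} → InSub x → InSub (inv x)
    sub-inv {x} hx = by (x ≟ 𝟘)
      where
      by : Dec (x ≡ 𝟘) → InSub (inv x)
      by (yes refl) = subst InSub (sym inv-𝟘) sub-𝟘
      by (no ne) = ⊗-cancelˡ ne (begin
        x ⊗ inv x ^ q       ≡⟨ cong (_⊗ inv x ^ q) hx ⟨
        x ^ q ⊗ inv x ^ q   ≡⟨ ^-distrib-* x (inv x) q ⟨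
        (x ⊗ inv x) ^ q     ≡⟨ cong (_^ q) (inv-inverseʳ ne) ⟩
        𝟙 ^ q               ≡⟨ sub-𝟙 ⟩
        𝟙                   ≡⟨ inv-inverseʳ ne ⟨
        x ⊗ inv x           ∎)
        where open ≡-Reasoning

    w-in : ∀ {x} → InSub x → w x ≡ 1ℚ
    w-in {x} = ⟦⟧-yes (inSub? x)

    w-weight : ∀ x {a b : ℚ} → (InSub x → a ≡ b) → w x * a ≡ w x * b
    w-weight x = ⟦⟧-weight (inSub? x)

    w-shift : ∀ {a} x → InSub a → w (a ⊕ x) ≡ w x
    w-shift {a} x ha = ⟦⟧-cong (inSub? (a ⊕ x)) (inSub? x)
      (λ h → subst InSub (cancel x) (sub-⊕ (sub-⊖ ha) h)) (sub-⊕ ha)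
      where
      cancel : ∀ x → ⊖ a ⊕ (a ⊕ x) ≡ x
      cancel x = trans (sym (R.+-assoc _ _ _)) (trans (cong (_⊕ x) (R.-‿inverseˡ a)) (R.+-identityˡ x))

    w-scale : ∀ {a} x → a ≢ 𝟘 → InSub a → w (a ⊗ x) ≡ w x
    w-scale {a} x ne ha = ⟦⟧-cong (inSub? (a ⊗ x)) (inSub? x)
      (λ h → subst InSub (inv-⊗-cancelˡ ne x) (sub-⊗ (sub-inv ha) h)) (sub-⊗ ha)

    w-inv : ∀ x → w (inv x) ≡ w x
    w-inv x = ⟦⟧-cong (inSub? (inv x)) (inSub? x) (λ h → subst InSub (inv-involutive x) (sub-inv h)) sub-inv

    nz-inv : ∀ x → nz (inv x) ≡ nz x
    nz-inv x = ⟦⟧-cong (¬? (inv x ≟ 𝟘)) (¬? (x ≟ 𝟘)) (λ { h refl → h inv-𝟘 }) inv-nonzero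

    comb : F → F → F
    comb a b = a ⊗ θ₁ ⊕ b ⊗ θ₂

    line : F → F
    line α = θ₁ ⊕ α ⊗ θ₂

    comb-𝟙 : ∀ α → comb 𝟙 α ≡ line α
    comb-𝟙 α = cong (_⊕ α ⊗ θ₂) (R.*-identityˡ θ₁)

    comb-𝟘 : ∀ b → comb 𝟘 b ≡ b ⊗ θ₂
    comb-𝟘 b = trans (cong (_⊕ b ⊗ θ₂) (R.zeroˡ θ₁)) (R.+-identityˡ _)

    line-nonzero : ∀ {α} → InSub α → line α ≢ 𝟘
    line-nonzero {α} hα e = 𝟙≢𝟘 (proj₁ (independent 𝟙 α sub-𝟙 hα (trans (comb-𝟙 α) e)))

    θ₂-nonzero : θ₂ ≢ 𝟘
    θ₂-nonzero e = 𝟙≢𝟘 (proj₂ (independent 𝟘 𝟙 sub-𝟘 sub-𝟙 (trans (comb-𝟘 𝟙) (trans (R.*-identityˡ θ₂) e))))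

    comb-⊕ : ∀ a b c d → comb (a ⊕ c) (b ⊕ d) ≡ comb a b ⊕ comb c d
    comb-⊕ a b c d = trans (cong₂ _⊕_ (R.distribʳ θ₁ a c) (R.distribʳ θ₂ b d))
      (interchange (a ⊗ θ₁) (c ⊗ θ₁) (b ⊗ θ₂) (d ⊗ θ₂))

    comb-injective : ∀ {a b c d} → InSub a → InSub b → InSub c → InSub d → comb a b ≡ comb c d → a ≡ c × b ≡ d
    comb-injective {a} {b} {c} {d} ha hb hc hd e = diff (proj₁ h) , diff (proj₂ h)
      where
      open ≡-Reasoning
      comb-⊖ : comb (⊖ c) (⊖ d) ≡ ⊖ comb c d
      comb-⊖ = ⊕-cancelˡ (comb c d) (begin
        comb c d ⊕ comb (⊖ c) (⊖ d)    ≡⟨ comb-⊕ c d (⊖ c) (⊖ d) ⟨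
        comb (c ⊕ ⊖ c) (d ⊕ ⊖ d)       ≡⟨ cong₂ comb (R.-‿inverseʳ c) (R.-‿inverseʳ d) ⟩
        comb 𝟘 𝟘                       ≡⟨ trans (comb-𝟘 𝟘) (R.zeroˡ θ₂) ⟩
        𝟘                              ≡⟨ R.-‿inverseʳ (comb c d) ⟨
        comb c d ⊕ ⊖ comb c d          ∎)
      h : a ⊕ ⊖ c ≡ 𝟘 × b ⊕ ⊖ d ≡ 𝟘
      h = independent (a ⊕ ⊖ c) (b ⊕ ⊖ d) (sub-⊕ ha (sub-⊖ hc)) (sub-⊕ hb (sub-⊖ hd))
        (trans (comb-⊕ a b (⊖ c) (⊖ d)) (trans (cong₂ _⊕_ e comb-⊖) (R.-‿inverseʳ (comb c d))))
      diff : ∀ {x y} → x ⊕ ⊖ y ≡ 𝟘 → x ≡ y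
      diff {x} {y} h = begin
        x              ≡⟨ R.+-identityʳ x ⟨
        x ⊕ 𝟘          ≡⟨ cong (x ⊕_) (R.-‿inverseˡ y) ⟨
        x ⊕ (⊖ y ⊕ y)  ≡⟨ R.+-assoc x (⊖ y) y ⟨
        x ⊕ ⊖ y ⊕ y    ≡⟨ cong (_⊕ y) h ⟩
        𝟘 ⊕ y          ≡⟨ R.+-identityˡ y ⟩
        y              ∎

    -- The coordinates (a, b) of aθ₁ + bθ₂ run once over all pairs from 𝔽_q. Spreading h over point
    -- masses allows the sums to be interchanged, after which each ξ is hit by a single pair.
    ∑-basis : (h : F → ℚ) → ∑ (λ a → ∑ (λ b → w a * (w b * h (comb a b)))) ≡ ∑ h
    ∑-basis h = begin
      ∑ (λ a → ∑ (λ b → w a * (w b * h (comb a b))))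
        ≡⟨ ∑-cong (λ a → ∑-cong (λ b → spread a b)) ⟩
      ∑ (λ a → ∑ (λ b → ∑ (λ ξ → h ξ * hit ξ a b)))
        ≡⟨ ∑-cong (λ a → ∑-swap (λ b ξ → h ξ * hit ξ a b)) ⟩
      ∑ (λ a → ∑ (λ ξ → ∑ (λ b → h ξ * hit ξ a b)))
        ≡⟨ ∑-swap (λ a ξ → ∑ (λ b → h ξ * hit ξ a b)) ⟩
      ∑ (λ ξ → ∑ (λ a → ∑ (λ b → h ξ * hit ξ a b)))
        ≡⟨ ∑-cong once ⟩
      ∑ h ∎
      where
      open ≡-Reasoning
      hit : F → F → F → ℚ
      hit ξ a b = w a * (w b * ⟦ comb a b ≟ ξ ⟧)
      eq : ∀ a b s h → a * (b * (s * h)) ≡ h * (a * (b * s))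
      eq = solve-∀ ringℚ
      spread : ∀ a b → w a * (w b * h (comb a b)) ≡ ∑ (λ ξ → h ξ * hit ξ a b)
      spread a b = begin
        w a * (w b * h (comb a b))                              ≡⟨ cong (λ t → w a * (w b * t)) (∑-δ′ (comb a b) h) ⟨
        w a * (w b * ∑ (λ ξ → ⟦ comb a b ≟ ξ ⟧ * h ξ))          ≡⟨ cong (_*_ (w a)) (∑-*ˡ (w b) (λ ξ → ⟦ comb a b ≟ ξ ⟧ * h ξ)) ⟨
        w a * ∑ (λ ξ → w b * (⟦ comb a b ≟ ξ ⟧ * h ξ))          ≡⟨ ∑-*ˡ (w a) (λ ξ → w b * (⟦ comb a b ≟ ξ ⟧ * h ξ)) ⟨
        ∑ (λ ξ → w a * (w b * (⟦ comb a b ≟ ξ ⟧ * h ξ)))        ≡⟨ ∑-cong (λ ξ → eq (w a) (w b) ⟦ comb a b ≟ ξ ⟧ (h ξ)) ⟩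
        ∑ (λ ξ → h ξ * hit ξ a b)                               ∎
      once : ∀ ξ → ∑ (λ a → ∑ (λ b → h ξ * hit ξ a b)) ≡ h ξ
      once ξ with spanning ξ
      ... | a₀ , b₀ , ha₀ , hb₀ , ξ≡ = begin
        ∑ (λ a → ∑ (λ b → h ξ * hit ξ a b))   ≡⟨ ∑-single _ a₀ (λ a ne → ∑-zero (λ b → miss a b (λ e → ne (proj₁ e)))) ⟩
        ∑ (λ b → h ξ * hit ξ a₀ b)            ≡⟨ ∑-single _ b₀ (λ b ne → miss a₀ b (λ e → ne (proj₂ e))) ⟩
        h ξ * hit ξ a₀ b₀                     ≡⟨ cong (_*_ (h ξ)) (cong₂ _*_ (w-in ha₀) (cong₂ _*_ (w-in hb₀) (⟦⟧-yes (comb a₀ b₀ ≟ ξ) (sym ξ≡)))) ⟩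
        h ξ * (1ℚ * (1ℚ * 1ℚ))                ≡⟨ *-identityʳ (h ξ) ⟩
        h ξ                                   ∎
        where
        miss : ∀ a b → ¬ (a ≡ a₀ × b ≡ b₀) → h ξ * hit ξ a b ≡ 0ℚ
        miss a b ne = trans (cong (_*_ (h ξ)) (trans
            (w-weight a {w b * ⟦ comb a b ≟ ξ ⟧} {0ℚ} (λ ha → trans (w-weight b {⟦ comb a b ≟ ξ ⟧} {0ℚ} (λ hb →
              ⟦⟧-no (comb a b ≟ ξ) (λ e → ne (comb-injective ha hb ha₀ hb₀ (trans e ξ≡))))) (*-zeroʳ (w b))))
            (*-zeroʳ (w a)))) (*-zeroʳ (h ξ))

    -- The change of variables with h = 1 gives |𝔽_q|² = |F| = q², and nonnegative square roots are
    -- unique.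
    ∑-w : ∑ w ≡ ℕ→ℚ q
    ∑-w = sq-cancel-≡ (0≤∑ (λ x → 0≤⟦⟧ (inSub? x))) (0≤ℕ→ℚ q) (begin
      ∑ w * ∑ w                                         ≡⟨ ∑-*ʳ (∑ w) w ⟨
      ∑ (λ a → w a * ∑ w)                               ≡⟨ ∑-cong (λ a → ∑-*ˡ (w a) w) ⟨
      ∑ (λ a → ∑ (λ b → w a * w b))                     ≡⟨ ∑-cong (λ a → ∑-cong (λ b → cong (_*_ (w a)) (*-identityʳ (w b)))) ⟨
      ∑ (λ a → ∑ (λ b → w a * (w b * 1ℚ)))              ≡⟨ ∑-basis (λ _ → 1ℚ) ⟩
      ∑ {n} (λ _ → 1ℚ)                                  ≡⟨ ∑-const n 1ℚ ⟩
      ℕ→ℚ n * 1ℚ                                        ≡⟨ *-identityʳ (ℕ→ℚ n) ⟩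
      ℕ→ℚ n                                             ≡⟨ cong ℕ→ℚ n≡q*q ⟩
      ℕ→ℚ (q ℕ.* q)                                     ≡⟨ ℕ→ℚ-* q q ⟩
      ℕ→ℚ q * ℕ→ℚ q                                     ∎)
      where open ≡-Reasoning

    w* : F → ℚ
    w* x = nz x * w x

    w≡δ+w* : ∀ x → w x ≡ ⟦ x ≟ 𝟘 ⟧ + w* x
    w≡δ+w* x with x ≟ 𝟘
    ... | yes refl = trans (w-in sub-𝟘) (cong (_+_ 1ℚ) (sym (*-zeroˡ (w 𝟘))))
    ... | no _ = trans (sym (*-identityˡ (w x))) (sym (+-identityˡ (1ℚ * w x)))

    ∑-w-split : (g : F → ℚ) → ∑ (λ x → w x * g x) ≡ g 𝟘 + ∑ (λ x → w* x * g x)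
    ∑-w-split g = begin
      ∑ (λ x → w x * g x)                            ≡⟨ ∑-cong (λ x → trans (cong (_* g x) (w≡δ+w* x)) (*-distribʳ-+ (g x) ⟦ x ≟ 𝟘 ⟧ (w* x))) ⟩
      ∑ (λ x → ⟦ x ≟ 𝟘 ⟧ * g x + w* x * g x)         ≡⟨ ∑-+ (λ x → ⟦ x ≟ 𝟘 ⟧ * g x) (λ x → w* x * g x) ⟩
      ∑ (λ x → ⟦ x ≟ 𝟘 ⟧ * g x) + ∑ (λ x → w* x * g x) ≡⟨ cong (_+ ∑ (λ x → w* x * g x)) (∑-δ 𝟘 g) ⟩
      g 𝟘 + ∑ (λ x → w* x * g x)                     ∎
      where open ≡-Reasoning

    w*-weight : ∀ x {a b : ℚ} → (x ≢ 𝟘 → InSub x → a ≡ b) → w* x * a ≡ w* x * b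
    w*-weight x {a} {b} h = trans (*-assoc (nz x) (w x) a)
      (trans (nz-weight x (λ nx → w-weight x (h nx))) (sym (*-assoc (nz x) (w x) b)))

    ∑-w* : ∑ w* ≡ ℕ→ℚ q - 1ℚ
    ∑-w* = trans (eq (∑ w*)) (cong (_- 1ℚ) (trans (sym split) ∑-w))
      where
      eq : ∀ a → a ≡ 1ℚ + a - 1ℚ
      eq = solve-∀ ringℚ
      split : ∑ w ≡ 1ℚ + ∑ w*
      split = trans (∑-cong (λ x → sym (*-identityʳ (w x)))) (trans (∑-w-split (λ _ → 1ℚ))
        (cong (_+_ 1ℚ) (∑-cong (λ x → *-identityʳ (w* x)))))

    module _ {K : F → F → ℚ} (𝒦 : Kernel K) where
      open Kernel 𝒦

      -- If K averages χ(x/y) over a set of characters χ, then T and M average the sums of χ over the line and their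
      -- squared absolute values, while Z and V average the sums of χ over F* and 𝔽_q*.
      T M Z V X : ℚ
      T = ∑ (λ α → w α * K (line α) 𝟙)
      M = ∑ (λ α → w α * ∑ (λ α′ → w α′ * K (line α) (line α′)))
      Z = ∑ (λ z → nz z * K z 𝟙)
      V = ∑ (λ z → w* z * K z 𝟙)
      X = ∑ (λ z → (1ℚ - w z) * K z 𝟙)

      -- Positive semidefiniteness applied to the function −T at 𝟙 plus the indicator of the line.
      T²≤M : T * T ≤ M
      -- As K(1, 1) = 1, the form comes out as T² - 2T² + M; the coefficient -T is the one that
      -- minimises it.
      T²≤M = ≤-from (subst (0ℚ ≤_) total (psd f f-𝟘)) (eq T M)
        where
        open ≡-Reasoning
        eq : ∀ t m → m - t * t ≡ (- t) * ((- t) * 1ℚ + t) + ((- t) * t + m)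
        eq = solve-∀ ringℚ
        l f : F → ℚ
        l x = ∑ (λ α → w α * ⟦ line α ≟ x ⟧)
        f x = (- T) * ⟦ 𝟙 ≟ x ⟧ + l x
        f-𝟘 : f 𝟘 ≡ 0ℚ
        f-𝟘 = trans (cong₂ (λ s t → (- T) * s + t) (⟦⟧-no (𝟙 ≟ 𝟘) 𝟙≢𝟘)
          (∑-zero (λ α → trans (w-weight α {⟦ line α ≟ 𝟘 ⟧} {0ℚ} (λ hα → ⟦⟧-no (line α ≟ 𝟘) (line-nonzero hα))) (*-zeroʳ (w α)))))
          (eq₀ (- T))
          where
          eq₀ : ∀ t → t * 0ℚ + 0ℚ ≡ 0ℚ
          eq₀ = solve-∀ ringℚ
        against : (g : F → ℚ) → ∑ (λ x → f x * g x) ≡ (- T) * g 𝟙 + ∑ (λ α → w α * g (line α))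
        against g = begin
          ∑ (λ x → f x * g x)
            ≡⟨ ∑-cong (λ x → eq₁ (- T) ⟦ 𝟙 ≟ x ⟧ (l x) (g x)) ⟩
          ∑ (λ x → (- T) * (⟦ 𝟙 ≟ x ⟧ * g x) + l x * g x)
            ≡⟨ ∑-+ (λ x → (- T) * (⟦ 𝟙 ≟ x ⟧ * g x)) (λ x → l x * g x) ⟩
          ∑ (λ x → (- T) * (⟦ 𝟙 ≟ x ⟧ * g x)) + ∑ (λ x → l x * g x)
            ≡⟨ cong₂ _+_ (trans (∑-*ˡ (- T) (λ x → ⟦ 𝟙 ≟ x ⟧ * g x)) (cong (_*_ (- T)) (∑-δ′ 𝟙 g))) onLine ⟩
          (- T) * g 𝟙 + ∑ (λ α → w α * g (line α)) ∎
          where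
          eq₁ : ∀ t s l g → (t * s + l) * g ≡ t * (s * g) + l * g
          eq₁ = solve-∀ ringℚ
          onLine : ∑ (λ x → l x * g x) ≡ ∑ (λ α → w α * g (line α))
          onLine = begin
            ∑ (λ x → l x * g x)
              ≡⟨ ∑-cong (λ x → ∑-*ʳ (g x) (λ α → w α * ⟦ line α ≟ x ⟧)) ⟨
            ∑ (λ x → ∑ (λ α → w α * ⟦ line α ≟ x ⟧ * g x))
              ≡⟨ ∑-swap (λ x α → w α * ⟦ line α ≟ x ⟧ * g x) ⟩
            ∑ (λ α → ∑ (λ x → w α * ⟦ line α ≟ x ⟧ * g x))
              ≡⟨ ∑-cong (λ α → trans (∑-cong (λ x → *-assoc (w α) ⟦ line α ≟ x ⟧ (g x))) (∑-*ˡ (w α) (λ x → ⟦ line α ≟ x ⟧ * g x))) ⟩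
            ∑ (λ α → w α * ∑ (λ x → ⟦ line α ≟ x ⟧ * g x))
              ≡⟨ ∑-cong (λ α → cong (_*_ (w α)) (∑-δ′ (line α) g)) ⟩
            ∑ (λ α → w α * g (line α)) ∎
        G : F → ℚ
        G x = (- T) * K x 𝟙 + ∑ (λ α → w α * K x (line α))
        G-𝟙 : G 𝟙 ≡ (- T) * 1ℚ + T
        G-𝟙 = cong₂ (λ s t → (- T) * s + t) (diag 𝟙≢𝟘) (∑-cong (λ α → cong (_*_ (w α)) (K-sym 𝟙 (line α))))
        G-line : ∑ (λ α → w α * G (line α)) ≡ (- T) * T + M
        G-line = begin
          ∑ (λ α → w α * G (line α))
            ≡⟨ ∑-cong (λ α → eq₂ (w α) (- T) (K (line α) 𝟙) (∑ (λ α′ → w α′ * K (line α) (line α′)))) ⟩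
          ∑ (λ α → (- T) * (w α * K (line α) 𝟙) + w α * ∑ (λ α′ → w α′ * K (line α) (line α′)))
            ≡⟨ ∑-+ (λ α → (- T) * (w α * K (line α) 𝟙)) (λ α → w α * ∑ (λ α′ → w α′ * K (line α) (line α′))) ⟩
          ∑ (λ α → (- T) * (w α * K (line α) 𝟙)) + M
            ≡⟨ cong (_+ M) (∑-*ˡ (- T) (λ α → w α * K (line α) 𝟙)) ⟩
          (- T) * T + M ∎
          where
          eq₂ : ∀ w t k s → w * (t * k + s) ≡ t * (w * k) + w * s
          eq₂ = solve-∀ ringℚ
        total : ∑ (λ x → ∑ (λ y → f x * f y * K x y)) ≡ (- T) * ((- T) * 1ℚ + T) + ((- T) * T + M)
        total = begin
          ∑ (λ x → ∑ (λ y → f x * f y * K x y))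
            ≡⟨ ∑-cong (λ x → trans (∑-cong (λ y → *-assoc (f x) (f y) (K x y))) (∑-*ˡ (f x) (λ y → f y * K x y))) ⟩
          ∑ (λ x → f x * ∑ (λ y → f y * K x y))
            ≡⟨ ∑-cong (λ x → cong (_*_ (f x)) (against (K x))) ⟩
          ∑ (λ x → f x * G x)
            ≡⟨ against G ⟩
          (- T) * G 𝟙 + ∑ (λ α → w α * G (line α))
            ≡⟨ cong₂ (λ s t → (- T) * s + t) G-𝟙 G-line ⟩
          (- T) * ((- T) * 1ℚ + T) + ((- T) * T + M) ∎

      -- Off-diagonal quotients of points of the line run over F∖𝔽_q exactly once.
      off-diagonal : ∑ (λ α → w α * ∑ (λ t → w* t * K (line α ⊕ t ⊗ θ₂) (line α))) ≡ X
      off-diagonal = begin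
        ∑ (λ α → w α * ∑ (λ t → w* t * K (line α ⊕ t ⊗ θ₂) (line α)))
          ≡⟨ ∑-cong (λ α → cong (_*_ (w α)) (invert α)) ⟩
        ∑ (λ α → w α * ∑ (λ s → w* s * k (s ⊗ line α)))
          ≡⟨ ∑-cong (λ α → ∑-*ˡ (w α) (λ s → w* s * k (s ⊗ line α))) ⟨
        ∑ (λ α → ∑ (λ s → w α * (w* s * k (s ⊗ line α))))
          ≡⟨ ∑-swap (λ α s → w α * (w* s * k (s ⊗ line α))) ⟩
        ∑ (λ s → ∑ (λ α → w α * (w* s * k (s ⊗ line α))))
          ≡⟨ ∑-cong (λ s → trans (∑-cong (λ α → eq₁ (w α) (w* s) (k (s ⊗ line α)))) (∑-*ˡ (w* s) (λ α → w α * k (s ⊗ line α)))) ⟩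
        ∑ (λ s → w* s * ∑ (λ α → w α * k (s ⊗ line α)))
          ≡⟨ ∑-cong (λ s → w*-weight s (rescale s)) ⟩
        ∑ (λ s → w* s * ∑ (λ b → w b * k (comb s b)))
          ≡⟨ ∑-cong (λ s → trans (sym (∑-*ˡ (w* s) (λ b → w b * k (comb s b)))) (∑-cong (λ b → onPlane s b))) ⟩
        ∑ (λ s → ∑ (λ b → w s * (w b * ((1ℚ - w (inv θ₂ ⊗ comb s b)) * k (comb s b)))))
          ≡⟨ ∑-basis (λ ξ → (1ℚ - w (inv θ₂ ⊗ ξ)) * k ξ) ⟩
        ∑ (λ ξ → (1ℚ - w (inv θ₂ ⊗ ξ)) * k ξ)
          ≡⟨ ∑-scale θ₂-nonzero (λ ξ → (1ℚ - w (inv θ₂ ⊗ ξ)) * k ξ) ⟨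
        ∑ (λ z → (1ℚ - w (inv θ₂ ⊗ (θ₂ ⊗ z))) * k (θ₂ ⊗ z))
          ≡⟨ ∑-cong möbius ⟩
        ∑ (λ z → (1ℚ - w (𝟙 ⊕ inv z)) * K (𝟙 ⊕ inv z) 𝟙)
          ≡⟨ ∑-inv (λ z → (1ℚ - w (𝟙 ⊕ z)) * K (𝟙 ⊕ z) 𝟙) ⟩
        ∑ (λ z → (1ℚ - w (𝟙 ⊕ z)) * K (𝟙 ⊕ z) 𝟙)
          ≡⟨ ∑-shift 𝟙 (λ z → (1ℚ - w z) * K z 𝟙) ⟩
        X ∎
        where
        open ≡-Reasoning
        k : F → ℚ
        k ξ = K (ξ ⊕ θ₂) ξ
        eq₁ : ∀ a b c → a * (b * c) ≡ b * (a * c)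
        eq₁ = solve-∀ ringℚ
        -- With s = 1/t both arguments are multiplied by s, so the displacement tθ₂ becomes the
        -- fixed θ₂.
        invert : ∀ α → ∑ (λ t → w* t * K (line α ⊕ t ⊗ θ₂) (line α)) ≡ ∑ (λ s → w* s * k (s ⊗ line α))
        invert α = trans (sym (∑-inv (λ t → w* t * K (line α ⊕ t ⊗ θ₂) (line α)))) (∑-cong h)
          where
          h : ∀ s → w* (inv s) * K (line α ⊕ inv s ⊗ θ₂) (line α) ≡ w* s * k (s ⊗ line α)
          h s = trans (cong (_* K (line α ⊕ inv s ⊗ θ₂) (line α)) (cong₂ _*_ (nz-inv s) (w-inv s)))
            (w*-weight s (λ ns _ → trans (sym (scale (line α ⊕ inv s ⊗ θ₂) (line α) ns))
              (cong (λ t → K t (s ⊗ line α)) (trans (R.distribˡ s (line α) (inv s ⊗ θ₂))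
                (cong (s ⊗ line α ⊕_) (⊗-inv-cancelˡ ns θ₂))))))
        s⊗line : ∀ s α → s ⊗ line α ≡ comb s (s ⊗ α)
        s⊗line s α = trans (R.distribˡ s θ₁ (α ⊗ θ₂)) (cong (s ⊗ θ₁ ⊕_) (sym (R.*-assoc s α θ₂)))
        -- The substitution b = sα turns s times a point of the line into the point with coordinates
        -- (s, b).
        rescale : ∀ s → s ≢ 𝟘 → InSub s → ∑ (λ α → w α * k (s ⊗ line α)) ≡ ∑ (λ b → w b * k (comb s b))
        rescale s ns hs = trans (∑-cong (λ α → cong₂ _*_ (sym (w-scale α ns hs)) (cong k (s⊗line s α))))
          (∑-scale ns (λ b → w b * k (comb s b)))
        -- s = 0 means lying on the 𝔽_q-span of θ₂. The restriction s ≠ 0 thus becomes a condition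
        -- on the point alone, as `∑-basis` requires.
        off : ∀ s b → InSub s → InSub b → nz s ≡ 1ℚ - w (inv θ₂ ⊗ comb s b)
        off s b hs hb = by (s ≟ 𝟘)
          where
          by : Dec (s ≡ 𝟘) → nz s ≡ 1ℚ - w (inv θ₂ ⊗ comb s b)
          by (yes refl) = trans nz-𝟘 (cong (_-_ 1ℚ) (sym (trans (cong w (trans (cong (inv θ₂ ⊗_) (trans (comb-𝟘 b) (R.*-comm b θ₂)))
            (inv-⊗-cancelˡ θ₂-nonzero b))) (w-in hb))))
          by (no ns) = trans (nz-nonzero ns) (cong (_-_ 1ℚ) (sym (⟦⟧-no (inSub? (inv θ₂ ⊗ comb s b)) (λ hc →
            ns (proj₁ (comb-injective hs hb sub-𝟘 hc (sym (trans (comb-𝟘 _) (trans (R.*-comm _ θ₂) (⊗-inv-cancelˡ θ₂-nonzero (comb s b)))))))))))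
        onPlane : ∀ s b → w* s * (w b * k (comb s b)) ≡ w s * (w b * ((1ℚ - w (inv θ₂ ⊗ comb s b)) * k (comb s b)))
        onPlane s b = trans (eq₂ (nz s) (w s) (w b) (k (comb s b)))
          (w-weight s (λ hs → w-weight b (λ hb → cong (_* k (comb s b)) (off s b hs hb))))
          where
          eq₂ : ∀ n s b k → n * s * (b * k) ≡ s * (b * (n * k))
          eq₂ = solve-∀ ringℚ
        -- For ξ = θ₂z the quotient (ξ + θ₂)/ξ is 1 + 1/z, and z ↦ 1 + 1/z maps the complement of
        -- 𝔽_q to itself. Elements of 𝔽_q, including 𝟘, have weight 0.
        möbius : ∀ z → (1ℚ - w (inv θ₂ ⊗ (θ₂ ⊗ z))) * k (θ₂ ⊗ z) ≡ (1ℚ - w (𝟙 ⊕ inv z)) * K (𝟙 ⊕ inv z) 𝟙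
        möbius z = trans (cong (λ t → (1ℚ - w t) * k (θ₂ ⊗ z)) (inv-⊗-cancelˡ θ₂-nonzero z)) (trans (by (inSub? z))
          (cong (λ t → (1ℚ - t) * K (𝟙 ⊕ inv z) 𝟙) (sym (trans (w-shift (inv z) sub-𝟙) (w-inv z)))))
          where
          by : (d : Dec (InSub z)) → (1ℚ - ⟦ d ⟧) * k (θ₂ ⊗ z) ≡ (1ℚ - ⟦ d ⟧) * K (𝟙 ⊕ inv z) 𝟙
          by (yes _) = trans (*-zeroˡ (k (θ₂ ⊗ z))) (sym (*-zeroˡ (K (𝟙 ⊕ inv z) 𝟙)))
          by (no nz∉) = cong (_*_ 1ℚ) (begin
            K (θ₂ ⊗ z ⊕ θ₂) (θ₂ ⊗ z)         ≡⟨ cong (λ t → K t (θ₂ ⊗ z)) (trans (cong (θ₂ ⊗ z ⊕_) (sym (R.*-identityʳ θ₂))) (sym (R.distribˡ θ₂ z 𝟙))) ⟩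
            K (θ₂ ⊗ (z ⊕ 𝟙)) (θ₂ ⊗ z)        ≡⟨ scale (z ⊕ 𝟙) z θ₂-nonzero ⟩
            K (z ⊕ 𝟙) z                      ≡⟨ cong₂ K (sym (trans (R.distribˡ z 𝟙 (inv z)) (cong₂ _⊕_ (R.*-identityʳ z) (inv-inverseʳ nz0)))) (sym (R.*-identityʳ z)) ⟩
            K (z ⊗ (𝟙 ⊕ inv z)) (z ⊗ 𝟙)      ≡⟨ scale (𝟙 ⊕ inv z) 𝟙 nz0 ⟩
            K (𝟙 ⊕ inv z) 𝟙                  ∎)
            where
            nz0 : z ≢ 𝟘
            nz0 refl = nz∉ sub-𝟘

      -- Each of the q diagonal pairs contributes K(x, x) = 1; the remaining pairs are those of
      -- `off-diagonal`, after the shift α′ = α + t.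
      M≡q+X : M ≡ ℕ→ℚ q + X
      M≡q+X = begin
        ∑ (λ α → w α * ∑ (λ α′ → w α′ * K (line α) (line α′)))
          ≡⟨ ∑-cong (λ α → cong (_*_ (w α)) (∑-cong (λ α′ → cong (_*_ (w α′)) (K-sym (line α) (line α′))))) ⟩
        ∑ (λ α → w α * ∑ (λ α′ → w α′ * K (line α′) (line α)))
          ≡⟨ ∑-cong (λ α → w-weight α (row α)) ⟩
        ∑ (λ α → w α * (1ℚ + ∑ (λ t → w* t * K (line α ⊕ t ⊗ θ₂) (line α))))
          ≡⟨ ∑-cong (λ α → eq₁ (w α) (∑ (λ t → w* t * K (line α ⊕ t ⊗ θ₂) (line α)))) ⟩
        ∑ (λ α → w α + w α * ∑ (λ t → w* t * K (line α ⊕ t ⊗ θ₂) (line α)))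
          ≡⟨ ∑-+ w (λ α → w α * ∑ (λ t → w* t * K (line α ⊕ t ⊗ θ₂) (line α))) ⟩
        ∑ w + ∑ (λ α → w α * ∑ (λ t → w* t * K (line α ⊕ t ⊗ θ₂) (line α)))
          ≡⟨ cong₂ _+_ ∑-w off-diagonal ⟩
        ℕ→ℚ q + X ∎
        where
        open ≡-Reasoning
        eq₁ : ∀ w s → w * (1ℚ + s) ≡ w + w * s
        eq₁ = solve-∀ ringℚ
        line-⊕ : ∀ α t → line (α ⊕ t) ≡ line α ⊕ t ⊗ θ₂
        line-⊕ α t = trans (cong (θ₁ ⊕_) (R.distribʳ θ₂ α t)) (sym (R.+-assoc θ₁ (α ⊗ θ₂) (t ⊗ θ₂)))
        row : ∀ α → InSub α → ∑ (λ α′ → w α′ * K (line α′) (line α)) ≡ 1ℚ + ∑ (λ t → w* t * K (line α ⊕ t ⊗ θ₂) (line α))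
        row α hα = begin
          ∑ (λ α′ → w α′ * K (line α′) (line α))
            ≡⟨ ∑-shift α (λ α′ → w α′ * K (line α′) (line α)) ⟨
          ∑ (λ t → w (α ⊕ t) * K (line (α ⊕ t)) (line α))
            ≡⟨ ∑-cong (λ t → cong₂ (λ s v → s * K v (line α)) (w-shift t hα) (line-⊕ α t)) ⟩
          ∑ (λ t → w t * K (line α ⊕ t ⊗ θ₂) (line α))
            ≡⟨ ∑-w-split (λ t → K (line α ⊕ t ⊗ θ₂) (line α)) ⟩
          K (line α ⊕ 𝟘 ⊗ θ₂) (line α) + ∑ (λ t → w* t * K (line α ⊕ t ⊗ θ₂) (line α))
            ≡⟨ cong (_+ ∑ (λ t → w* t * K (line α ⊕ t ⊗ θ₂) (line α)))
                 (trans (cong (λ v → K v (line α)) (trans (cong (line α ⊕_) (R.zeroˡ θ₂)) (R.+-identityʳ (line α)))) (diag (line-nonzero hα))) ⟩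
          1ℚ + ∑ (λ t → w* t * K (line α ⊕ t ⊗ θ₂) (line α)) ∎

      -- The value `K 𝟘 𝟙` is uncontrolled, but 𝟘 lies in 𝔽_q and has weight 0 on both sides.
      X≡Z-V : X ≡ Z - V
      X≡Z-V = trans (∑-cong h) (∑-- (λ z → nz z * K z 𝟙) (λ z → w* z * K z 𝟙))
        where
        eq₁ : ∀ k → (1ℚ - 1ℚ) * k ≡ 0ℚ * k - 0ℚ * 1ℚ * k
        eq₁ = solve-∀ ringℚ
        eq₂ : ∀ w k → (1ℚ - w) * k ≡ 1ℚ * k - 1ℚ * w * k
        eq₂ = solve-∀ ringℚ
        h : ∀ z → (1ℚ - w z) * K z 𝟙 ≡ nz z * K z 𝟙 - w* z * K z 𝟙
        h z = by (z ≟ 𝟘)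
          where
          by : Dec (z ≡ 𝟘) → (1ℚ - w z) * K z 𝟙 ≡ nz z * K z 𝟙 - w* z * K z 𝟙
          by (yes refl) = trans (cong (λ t → (1ℚ - t) * K 𝟘 𝟙) (w-in sub-𝟘)) (trans (eq₁ (K 𝟘 𝟙))
            (sym (cong₂ (λ s t → s * K 𝟘 𝟙 - s * t * K 𝟘 𝟙) nz-𝟘 (w-in sub-𝟘))))
          by (no ne) = trans (eq₂ (w z) (K z 𝟙)) (sym (cong (λ s → s * K z 𝟙 - s * w z * K z 𝟙) (nz-nonzero ne)))

      0<q-1 : 0ℚ < ℕ→ℚ q - 1ℚ
      0<q-1 = <⇒0< (<-≤-trans (<-from {1ℚ} {ℕ→ℚ 2} {1ℚ} (positive⁻¹ 1ℚ) refl) (ℕ→ℚ-mono-≤ {2} {q} 1<q))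

      -- Semidefiniteness applied to the indicator of 𝔽_q*. By scaling, every row has the same sum
      -- V, so the form equals (q - 1)·V.
      0≤V : 0ℚ ≤ V
      0≤V = ≤-cancel* 0<q-1 (subst₂ _≤_ (sym (*-zeroʳ (ℕ→ℚ q - 1ℚ))) total
        (psd w* (trans (cong (_* w 𝟘) nz-𝟘) (*-zeroˡ (w 𝟘)))))
        where
        open ≡-Reasoning
        row : ∀ x → x ≢ 𝟘 → InSub x → ∑ (λ y → w* y * K x y) ≡ V
        row x nx hx = trans (sym (∑-scale nx (λ y → w* y * K x y))) (∑-cong (λ z →
          cong₂ _*_ (cong₂ _*_ (nz-scale z nx) (w-scale z nx hx))
            (trans (cong (λ t → K t (x ⊗ z)) (sym (R.*-identityʳ x))) (trans (scale 𝟙 z nx) (K-sym 𝟙 z)))))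
        total : ∑ (λ x → ∑ (λ y → w* x * w* y * K x y)) ≡ (ℕ→ℚ q - 1ℚ) * V
        total = begin
          ∑ (λ x → ∑ (λ y → w* x * w* y * K x y))
            ≡⟨ ∑-cong (λ x → trans (∑-cong (λ y → *-assoc (w* x) (w* y) (K x y))) (∑-*ˡ (w* x) (λ y → w* y * K x y))) ⟩
          ∑ (λ x → w* x * ∑ (λ y → w* y * K x y))
            ≡⟨ ∑-cong (λ x → w*-weight x (row x)) ⟩
          ∑ (λ x → w* x * V)       ≡⟨ ∑-*ʳ V w* ⟩
          ∑ w* * V                 ≡⟨ cong (_* V) ∑-w* ⟩
          (ℕ→ℚ q - 1ℚ) * V         ∎

      T²≤q : Z ≡ 0ℚ → T * T ≤ ℕ→ℚ q
      T²≤q Z≡0 = ≤-trans T²≤M (≤-from 0≤V (trans (cong (λ t → ℕ→ℚ q - t)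
        (trans M≡q+X (cong (_+_ (ℕ→ℚ q)) (trans X≡Z-V (cong (_- V) Z≡0))))) (eq (ℕ→ℚ q) V)))
        where
        eq : ∀ q v → q - (q + (0ℚ - v)) ≡ v
        eq = solve-∀ ringℚ

      T²≤1 : Z ≡ 0ℚ → (∀ z → z ≢ 𝟘 → InSub z → K z 𝟙 ≡ 1ℚ) → T * T ≤ 1ℚ
      T²≤1 Z≡0 triv = subst (T * T ≤_) M≡1 T²≤M
        where
        V≡ : V ≡ ℕ→ℚ q - 1ℚ
        V≡ = trans (∑-cong (λ z → trans (w*-weight z (triv z)) (*-identityʳ (w* z)))) ∑-w*
        eq : ∀ q → q + (0ℚ - (q - 1ℚ)) ≡ 1ℚ
        eq = solve-∀ ringℚ
        M≡1 : M ≡ 1ℚ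
        M≡1 = trans M≡q+X (trans (cong (_+_ (ℕ→ℚ q)) (trans X≡Z-V (cong₂ _-_ Z≡0 V≡))) (eq (ℕ→ℚ q)))

-- Characters of given order and the sieve inequality.

module Sieve where

  open RationalLemmas
  open FiniteSums
  open FieldBasics
  open Kernels
  open Lines
  open import Defs using (ℕ→ℚ; recipℕ; sumRecip)
  open import Data.Bool using (Bool; true; false; _∧_)
  open import Data.Empty using (⊥-elim)
  open import Data.Fin.Properties using (_≟_)
  open import Data.List using (List; []; _∷_; foldr; map)
  open import Data.List.Membership.Propositional using (_∈_)
  open import Data.List.Relation.Unary.Any using (here; there)
  open import Data.List.Relation.Unary.All as All using (All; []; _∷_)
  open import Data.List.Relation.Unary.AllPairs using ([]; _∷_)
  open import Data.List.Relation.Unary.Unique.Propositional using (Unique)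
  open import Data.Nat as ℕ using (ℕ; suc; NonZero)
  import Data.Nat.Properties as ℕ
  open import Data.Nat.Coprimality using (Coprime; 1-coprimeTo)
  open import Data.Nat.Divisibility using (_∣_; _∣?_; divides; ∣-trans; ∣-refl; m∣m*n; n∣m*n; ∣m+n∣m⇒∣n; *-pres-∣)
  open import Data.Nat.ListAction using (product)
  open import Data.Nat.Primality using (Prime; euclidsLemma; prime⇒irreducible; prime⇒nonZero; prime[2]; ¬prime[1])
  open import Data.Nat.Primality.Factorisation using (factorisationHasAllPrimeFactors)
  open import Data.Nat.Tactic.RingSolver using () renaming (solve-∀ to solveℕ-∀)
  open import Data.Product using (_×_; _,_; proj₁; proj₂)
  open import Data.Rational hiding (_≟_; NonZero)
  open import Data.Rational.Properties hiding (_≟_)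
  open import Data.Sum using (inj₁; inj₂)
  open import Relation.Nullary using (¬_; Dec; does; yes; no)
  open import Relation.Nullary.Decidable using (¬?)
  open import Relation.Binary.PropositionalEquality
  open import Tactic.RingSolver using (solve-∀)

  ∑ₗ : (ℕ → ℚ) → List ℕ → ℚ
  ∑ₗ f ps = foldr _+_ 0ℚ (map f ps)

  0≤1-recip : ∀ {p} → Prime p → 0ℚ ≤ 1ℚ - recipℕ p
  0≤1-recip {p} pp = ≤⇒0≤ (≤-cancel* (0<ℕ→ℚ p) (subst₂ _≤_
    (sym (trans (*-comm (ℕ→ℚ p) (recipℕ p)) (recip-inverse p))) (sym (*-identityʳ (ℕ→ℚ p)))
    (ℕ→ℚ-mono-≤ {1} {p} (ℕ.>-nonZero⁻¹ p))))
    where instance _ = prime⇒nonZero pp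

  ∈⇒∣product : ∀ {p ps} → p ∈ ps → p ∣ product ps
  ∈⇒∣product {ps = x ∷ ps} (here refl) = m∣m*n (product ps)
  ∈⇒∣product {ps = x ∷ ps} (there h)   = ∣-trans (∈⇒∣product h) (n∣m*n x)

  prime∣prime⇒≡ : ∀ {p r} → Prime p → Prime r → p ∣ r → p ≡ r
  prime∣prime⇒≡ pp pr h with prime⇒irreducible pr h
  ... | inj₁ refl = ⊥-elim (¬prime[1] pp)
  ... | inj₂ e    = e

  -- Four times the product of ps is a multiple of the order of every character in the factors other
  -- than `u p`; `∑-u*K≡0` needs such an exponent prime to p.
  coprime-4product : ∀ {p ps} → Prime p → p ≢ 2 → All Prime ps → All (p ≢_) ps → Coprime (product ps ℕ.* 4) p
  coprime-4product {p} {ps} pp p≢2 primes p∉ {d} (d∣m , d∣p) with prime⇒irreducible pp d∣p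
  ... | inj₁ d≡1 = d≡1
  ... | inj₂ refl with euclidsLemma (product ps) 4 pp d∣m
  ...   | inj₁ h = ⊥-elim (All.lookup p∉ (factorisationHasAllPrimeFactors pp h primes) refl)
  ...   | inj₂ h with euclidsLemma 2 2 pp h
  ...     | inj₁ t = ⊥-elim (p≢2 (prime∣prime⇒≡ pp prime[2] t))
  ...     | inj₂ t = ⊥-elim (p≢2 (prime∣prime⇒≡ pp prime[2] t))

  2∣ : ∀ {m} → 4 ∣ m → 2 ∣ m
  2∣ = ∣-trans (divides {2} {4} 2 refl)

  does-true : ∀ {P : Set} (d : Dec P) → does d ≡ true → P
  does-true (yes p) _ = p

  ∧-true : ∀ x {y} → x ∧ y ≡ true → x ≡ true × y ≡ true
  ∧-true true h = refl , h

  -- The 2-part of the order of a character; testing squares and fourth powers involves only 1, 2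
  -- and 4.
  data Tail : Set where
    one two four : Tail

  module SieveTheory {n : ℕ} {𝔽 : FinField n} (𝓛 : LineData 𝔽) (2∣q+1 : 2 ∣ LineData.q 𝓛 ℕ.+ 1) where
    open LineTheory 𝓛 public

    N≡[q-1][q+1] : N ≡ (q ℕ.∸ 1) ℕ.* (q ℕ.+ 1)
    N≡[q-1][q+1] = trans (cong (ℕ._∸ 1) n≡q*q) (go q 1<q)
      where
      go : ∀ q → 1 ℕ.< q → q ℕ.* q ℕ.∸ 1 ≡ (q ℕ.∸ 1) ℕ.* (q ℕ.+ 1)
      go (suc q) _ = eq q
        where
        eq : ∀ q → q ℕ.+ q ℕ.* suc q ≡ q ℕ.* suc (q ℕ.+ 1)
        eq = solveℕ-∀

    2∣q-1 : 2 ∣ q ℕ.∸ 1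
    2∣q-1 = ∣m+n∣m⇒∣n (subst (2 ∣_) (go q 1<q) 2∣q+1) ∣-refl
      where
      go : ∀ q → 1 ℕ.< q → q ℕ.+ 1 ≡ 2 ℕ.+ (q ℕ.∸ 1)
      go (suc q) _ = cong suc (ℕ.+-comm q 1)

    4∣N : 4 ∣ N
    4∣N = subst (4 ∣_) (sym N≡[q-1][q+1]) (*-pres-∣ 2∣q-1 2∣q+1)

    N≢0 : NonZero N
    N≢0 = subst NonZero (sym N≡[q-1][q+1])
      (ℕ.m*n≢0 (q ℕ.∸ 1) (q ℕ.+ 1) {{ℕ.>-nonZero (ℕ.m<n⇒0<n∸m 1<q)}} {{ℕ.>-nonZero (ℕ.≤-trans (ℕ.s≤s ℕ.z≤n) (ℕ.m≤n+m 1 q))}})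

    pd2 : PrimeDivisor 2
    pd2 = prime[2] , 2∣ 4∣N , N≢0

    N≡4*E₄ : N ≡ 4 ℕ.* E 4
    N≡4*E₄ = ∣⇒≡*div 4∣N

    E₂≡2*E₄ : E 2 ≡ 2 ℕ.* E 4
    E₂≡2*E₄ = ℕ.*-cancelˡ-≡ (E 2) (2 ℕ.* E 4) 2 (trans (sym (N≡p*E pd2)) (trans N≡4*E₄ (ℕ.*-assoc 2 2 (E 4))))

    instance
      E₂≢0 : NonZero (E 2)
      E₂≢0 = E≢0 pd2

      E₄≢0 : NonZero (E 4)
      E₄≢0 = ℕ.m*n≢0⇒n≢0 4 {{subst NonZero N≡4*E₄ N≢0}}

    E₄-finer : ∀ x z → x ^ E 4 ≡ z ^ E 4 → x ^ E 2 ≡ z ^ E 2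
    E₄-finer x z h = trans (square x) (trans (cong (_^ 2) h) (sym (square z)))
      where
      square : ∀ x → x ^ E 2 ≡ (x ^ E 4) ^ 2
      square x = trans (cong (x ^_) (trans E₂≡2*E₄ (ℕ.*-comm 2 (E 4)))) (sym (^-assocʳ x (E 4) 2))

    -- The mean of the two characters of order 4. The indicators of fourth powers and of squares are
    -- ¼(1 + χ₂ + 2u₄) and ½(1 + χ₂); solving for u₄ gives this formula. Its value is 1 if x/y is a
    -- fourth power, -1 if it is another square, and 0 otherwise.
    u₄ : F → F → ℚ
    u₄ x y = 2ℚ * sim (E 4) x y - sim (E 2) x y

    Factor-u₄ : Factor u₄
    Factor-u₄ = record
      { diag  = λ {x} _ → cong₂ (λ s t → 2ℚ * s - t) (sim-refl (E 4) x) (sim-refl (E 2) x)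
      ; scale = λ x y ne → cong₂ (λ s t → 2ℚ * s - t) (sim-scale (E 4) x y ne) (sim-scale (E 2) x y ne)
      ; u-sym = λ x y → cong₂ (λ s t → 2ℚ * s - t) (sim-sym (E 4) x y) (sim-sym (E 2) x y)
      -- N/2, as two characters are averaged.
      ; κ     = ℕ→ℚ (E 2)
      ; 0<κ   = 0<ℕ→ℚ (E 2)
      ; gram  = gram
      }
      where
      open ≡-Reasoning
      E₂ℚ : ℕ→ℚ (E 2) ≡ 2ℚ * ℕ→ℚ (E 4)
      E₂ℚ = trans (cong ℕ→ℚ E₂≡2*E₄) (ℕ→ℚ-* 2 (E 4))
      eq₁ : ∀ n a b c d → n * ((2ℚ * a - b) * (2ℚ * c - d)) ≡
        (2ℚ * 2ℚ * (n * (a * c)) + (- 2ℚ) * (n * (a * d))) + ((- 2ℚ) * (n * (c * b)) + 1ℚ * (n * (b * d)))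
      eq₁ = solve-∀ ringℚ
      eq₂ : ∀ e s t → (2ℚ * 2ℚ * (s * e) + (- 2ℚ) * (t * e)) + ((- 2ℚ) * (t * e) + 1ℚ * (t * (2ℚ * e))) ≡ 2ℚ * e * (2ℚ * s - t)
      eq₂ = solve-∀ ringℚ
      gram : ∀ {x y} → x ≢ 𝟘 → y ≢ 𝟘 → ℕ→ℚ (E 2) * u₄ x y ≡ ∑ (λ z → nz z * (u₄ x z * u₄ y z))
      gram {x} {y} nx ny = sym (begin
        ∑ (λ z → nz z * (u₄ x z * u₄ y z))
          ≡⟨ ∑-cong (λ z → eq₁ (nz z) (sim (E 4) x z) (sim (E 2) x z) (sim (E 4) y z) (sim (E 2) y z)) ⟩
        _ ≡⟨ ∑-lin₄ (2ℚ * 2ℚ) (- 2ℚ) (- 2ℚ) 1ℚ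
               (λ z → nz z * (sim (E 4) x z * sim (E 4) y z)) (λ z → nz z * (sim (E 4) x z * sim (E 2) y z))
               (λ z → nz z * (sim (E 4) y z * sim (E 2) x z)) (λ z → nz z * (sim (E 2) x z * sim (E 2) y z)) ⟩
        _ ≡⟨ cong₂ _+_
               (cong₂ (λ s t → 2ℚ * 2ℚ * s + (- 2ℚ) * t) (∑-sim-sim 4 (E 4) N≡4*E₄ (E 4) (λ _ _ h → h) y nx)
                 (∑-sim-sim 4 (E 4) N≡4*E₄ (E 2) E₄-finer y nx))
               (cong₂ (λ s t → (- 2ℚ) * s + 1ℚ * t)
                 (trans (∑-sim-sim 4 (E 4) N≡4*E₄ (E 2) E₄-finer x ny) (cong (_* ℕ→ℚ (E 4)) (sim-sym (E 2) y x)))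
                 (trans (∑-sim-sim 2 (E 2) (N≡p*E pd2) (E 2) (λ _ _ h → h) y nx) (cong (_*_ (sim (E 2) x y)) E₂ℚ))) ⟩
        _ ≡⟨ eq₂ (ℕ→ℚ (E 4)) (sim (E 4) x y) (sim (E 2) x y) ⟩
        2ℚ * ℕ→ℚ (E 4) * u₄ x y  ≡⟨ cong (_* u₄ x y) E₂ℚ ⟨
        ℕ→ℚ (E 2) * u₄ x y ∎)

    -- The factors 1ℚ give these the exact form that `Kernel-*` produces from `Kernel-1`.
    tailK : Tail → F → F → ℚ
    tailK one  x y = 1ℚ
    tailK two  x y = u 2 x y * 1ℚ
    tailK four x y = u₄ x y * 1ℚ

    -- For distinct odd primes C this is the average over the characters whose order is the product
    -- of C times the order named by the tail.
    kern : List ℕ → Tail → F → F → ℚ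
    kern []      v x y = tailK v x y
    kern (p ∷ C) v x y = u p x y * kern C v x y

    OddPrimeDivisor : ℕ → Set
    OddPrimeDivisor p = PrimeDivisor p × p ≢ 2

    Kernel-kern : ∀ {C} v → All OddPrimeDivisor C → Kernel (kern C v)
    Kernel-kern one  [] = Kernel-1
    Kernel-kern two  [] = Kernel-* (Factor-u pd2) Kernel-1
    Kernel-kern four [] = Kernel-* Factor-u₄ Kernel-1
    Kernel-kern v ((pd , _) ∷ h) = Kernel-* (Factor-u pd) (Kernel-kern v h)

    kern-powerInvariant : ∀ {m C} v → All OddPrimeDivisor C → All (_∣ m) C → 4 ∣ m → PowerInvariant m (kern C v)
    kern-powerInvariant one  [] [] 4∣m x y ne = refl
    kern-powerInvariant two  [] [] 4∣m x y ne = cong (_* 1ℚ) (u-powerInvariant pd2 (2∣ 4∣m) x y ne)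
    kern-powerInvariant four [] [] 4∣m x y ne = cong (_* 1ℚ) (cong₂ (λ s t → 2ℚ * s - t)
      (sim-powerInvariant {4} {E 4} N≡4*E₄ 4∣m x y ne) (sim-powerInvariant {2} {E 2} (N≡p*E pd2) (2∣ 4∣m) x y ne))
    kern-powerInvariant v ((pd , _) ∷ h) (p∣m ∷ C∣m) 4∣m x y ne =
      cong₂ _*_ (u-powerInvariant pd p∣m x y ne) (kern-powerInvariant v h C∣m 4∣m x y ne)

    data Nontrivial : List ℕ → Tail → Set where
      cons : ∀ {p C v} → Nontrivial (p ∷ C) v
      two  : Nontrivial [] two
      four : Nontrivial [] four

    -- A leading odd prime p is split off, since the other factors are invariant under an exponent
    -- coprime to p. The tail `four` alone is not of this form and is summed directly, using E₂ =
    -- 2E₄.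
    ∑-kern≡0 : ∀ {C v} → Nontrivial C v → All OddPrimeDivisor C → Unique C → ∑ (λ z → nz z * kern C v z 𝟙) ≡ 0ℚ
    ∑-kern≡0 {p ∷ C} {v} cons ((pd , p≢2) ∷ h) (p∉C ∷ _) = ∑-u*K≡0 {p} {product C ℕ.* 4} {kern C v} pd
      (coprime-4product (proj₁ pd) p≢2 (All.map (λ o → proj₁ (proj₁ o)) h) p∉C)
      (kern-powerInvariant v h (All.tabulate (λ r∈C → ∣-trans (∈⇒∣product r∈C) (m∣m*n 4))) (n∣m*n (product C)))
    ∑-kern≡0 two [] _ = ∑-u*K≡0 {2} {1} {λ _ _ → 1ℚ} pd2 (1-coprimeTo 2) (λ _ _ _ → refl)
    ∑-kern≡0 four [] _ = begin
      ∑ (λ z → nz z * (u₄ z 𝟙 * 1ℚ))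
        ≡⟨ ∑-cong (λ z → eq₁ (nz z) (sim (E 4) z 𝟙) (sim (E 2) z 𝟙)) ⟩
      ∑ (λ z → 2ℚ * (nz z * sim (E 4) z 𝟙) + (- 1ℚ) * (nz z * sim (E 2) z 𝟙))
        ≡⟨ ∑-lin₂ 2ℚ (- 1ℚ) (λ z → nz z * sim (E 4) z 𝟙) (λ z → nz z * sim (E 2) z 𝟙) ⟩
      2ℚ * ∑ (λ z → nz z * sim (E 4) z 𝟙) + (- 1ℚ) * ∑ (λ z → nz z * sim (E 2) z 𝟙)
        ≡⟨ cong₂ (λ s t → 2ℚ * s + (- 1ℚ) * t) (∑-sim-𝟙 4 (E 4) N≡4*E₄)
             (trans (∑-sim-𝟙 2 (E 2) (N≡p*E pd2)) (trans (cong ℕ→ℚ E₂≡2*E₄) (ℕ→ℚ-* 2 (E 4)))) ⟩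
      2ℚ * ℕ→ℚ (E 4) + (- 1ℚ) * (2ℚ * ℕ→ℚ (E 4))
        ≡⟨ eq₂ (ℕ→ℚ (E 4)) ⟩
      0ℚ ∎
      where
      open ≡-Reasoning
      eq₁ : ∀ n s t → n * ((2ℚ * s - t) * 1ℚ) ≡ 2ℚ * (n * s) + (- 1ℚ) * (n * t)
      eq₁ = solve-∀ ringℚ
      eq₂ : ∀ e → 2ℚ * e + (- 1ℚ) * (2ℚ * e) ≡ 0ℚ
      eq₂ = solve-∀ ringℚ

    -- z^(q - 1) = 1, and d ∣ q + 1 makes e = N/d a multiple of q - 1.
    sub-root : ∀ {d e z} → .{{NonZero d}} → N ≡ d ℕ.* e → d ∣ q ℕ.+ 1 → z ≢ 𝟘 → InSub z → z ^ e ≡ 𝟙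
    sub-root {d} {e} {z} N≡ (divides c q+1≡) ne hz = begin
      z ^ e                         ≡⟨ cong (z ^_) e≡ ⟩
      z ^ ((q ℕ.∸ 1) ℕ.* c)         ≡⟨ ^-assocʳ z (q ℕ.∸ 1) c ⟨
      (z ^ (q ℕ.∸ 1)) ^ c           ≡⟨ cong (_^ c) (z^[q-1] q 1<q hz) ⟩
      𝟙 ^ c                         ≡⟨ 𝟙^ c ⟩
      𝟙                             ∎
      where
      open ≡-Reasoning
      z^[q-1] : ∀ q → 1 ℕ.< q → z ^ q ≡ z → z ^ (q ℕ.∸ 1) ≡ 𝟙
      z^[q-1] (suc q) _ h = ⊗-cancelˡ ne (trans h (sym (R.*-identityʳ z)))
      eqℕ : ∀ a c d → a ℕ.* (c ℕ.* d) ≡ d ℕ.* (a ℕ.* c)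
      eqℕ = solveℕ-∀
      e≡ : e ≡ (q ℕ.∸ 1) ℕ.* c
      e≡ = ℕ.*-cancelˡ-≡ e ((q ℕ.∸ 1) ℕ.* c) d (trans (sym N≡) (trans N≡[q-1][q+1]
        (trans (cong ((q ℕ.∸ 1) ℕ.*_) q+1≡) (eqℕ (q ℕ.∸ 1) c d))))

    -- Whether the characters are trivial on 𝔽_q*: the quadratic one always is, because 2 divides q
    -- + 1; the quartic ones are if 4 does.
    tailTrivial : Tail → Bool
    tailTrivial one  = true
    tailTrivial two  = true
    tailTrivial four = does (4 ∣? (q ℕ.+ 1))

    divides-q+1 : ℕ → Bool
    divides-q+1 p = does (p ∣? (q ℕ.+ 1))

    trivial : List ℕ → Tail → Bool
    trivial []      v = tailTrivial v
    trivial (p ∷ C) v = divides-q+1 p ∧ trivial C v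

    kern-trivial : ∀ {C} v → All OddPrimeDivisor C → trivial C v ≡ true → ∀ z → z ≢ 𝟘 → InSub z → kern C v z 𝟙 ≡ 1ℚ
    kern-trivial one  [] t z ne hz = refl
    kern-trivial two  [] t z ne hz = cong (_* 1ℚ) (u≡1 pd2 (sub-root {2} {E 2} (N≡p*E pd2) 2∣q+1 ne hz))
    kern-trivial four [] t z ne hz = cong (_* 1ℚ) (cong₂ (λ s t → 2ℚ * s - t) (one! (E 4) r₄)
        (one! (E 2) (trans (E₄-finer z 𝟙 (trans r₄ (sym (𝟙^ (E 4))))) (𝟙^ (E 2)))))
      where
      r₄ : z ^ E 4 ≡ 𝟙
      r₄ = sub-root {4} {E 4} N≡4*E₄ (does-true (4 ∣? (q ℕ.+ 1)) t) ne hz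
      one! : ∀ e → z ^ e ≡ 𝟙 → sim e z 𝟙 ≡ 1ℚ
      one! e h = ⟦⟧-yes (z ^ e ≟ 𝟙 ^ e) (trans h (sym (𝟙^ e)))
    kern-trivial {p ∷ C} v ((pd , _) ∷ h) t z ne hz = cong₂ _*_
      (u≡1 pd (sub-root {p} {E p} {{prime⇒nonZero (proj₁ pd)}} (N≡p*E pd) (does-true (p ∣? (q ℕ.+ 1)) (proj₁ split)) ne hz))
      (kern-trivial v h (proj₂ split) z ne hz)
      where
      split = ∧-true (divides-q+1 p) t

    -- The trivial character sums to q; subtracting q + 1 leaves an error of absolute value 1, the same as for the
    -- other characters that are trivial on 𝔽_q*.
    main : List ℕ → Tail → ℚ
    main [] one = ℕ→ℚ (q ℕ.+ 1)
    main [] two = 0ℚ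
    main [] four = 0ℚ
    main (p ∷ C) v = 0ℚ

    TC : List ℕ → Tail → ℚ
    TC C v = ∑ (λ α → w α * kern C v (line α) 𝟙)

    module Bounds {r : ℚ} (0≤r : 0ℚ ≤ r) (q≤r² : ℕ→ℚ q ≤ r * r) where

      size : Bool → ℚ
      size true  = 1ℚ
      size false = r

      TC-bound : ∀ {C v} → Nontrivial C v → All OddPrimeDivisor C → Unique C → ∣ TC C v ∣≤ size (trivial C v)
      TC-bound {C} {v} nt h uniq with trivial C v in eq
      ... | true  = sq≤⇒∣∣≤ {TC C v} 0≤1 (T²≤1 (Kernel-kern v h) (∑-kern≡0 nt h uniq) (kern-trivial v h eq))
      ... | false = sq≤⇒∣∣≤ {TC C v} 0≤r (≤-trans (T²≤q (Kernel-kern v h) (∑-kern≡0 nt h uniq)) q≤r²)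

      ∣x-0∣≤ : ∀ {x b} → ∣ x ∣≤ b → ∣ x - 0ℚ ∣≤ b
      ∣x-0∣≤ {x} {b} = subst (∣_∣≤ b) (sym (+-identityʳ x))

      TC-main-bound : ∀ {C} v → All OddPrimeDivisor C → Unique C → ∣ TC C v - main C v ∣≤ size (trivial C v)
      TC-main-bound one [] uniq = subst (∣_∣≤ 1ℚ) (sym eq) (≤-trans (nonPositive⁻¹ (- 1ℚ)) 0≤1 , ≤-refl)
        where
        arith : ∀ a → a - (a + 1ℚ) ≡ - 1ℚ
        arith = solve-∀ ringℚ
        eq : TC [] one - ℕ→ℚ (q ℕ.+ 1) ≡ - 1ℚ
        eq = trans (cong₂ _-_ (trans (∑-cong (λ α → *-identityʳ (w α))) ∑-w) (ℕ→ℚ-+ q 1)) (arith (ℕ→ℚ q))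
      TC-main-bound two  [] uniq = ∣x-0∣≤ {TC [] two} (TC-bound two [] uniq)
      TC-main-bound four [] uniq = ∣x-0∣≤ {TC [] four} (TC-bound four [] uniq)
      TC-main-bound {p ∷ C} v h@(_ ∷ _) uniq = ∣x-0∣≤ {TC (p ∷ C) v} (TC-bound cons h uniq)

      -- By `1-u≡` each factor is `b p` times the indicator of not being a p-th power. Only the sign
      -- and the zeros of the product matter, so it stays unnormalised and expands into kernels with
      -- coefficients ±1.
      free : List ℕ → F → ℚ
      free []      x = 1ℚ
      free (p ∷ K) x = (1ℚ - u p x 𝟙) * free K x

      -- C collects the primes already moved from the product `free` into the kernel; `S-∷`
      -- multiplies the product out one prime at a time.
      S : List ℕ → List ℕ → Tail → ℚ
      S K C v = ∑ (λ α → w α * (free K (line α) * kern C v (line α) 𝟙))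

      S-[] : ∀ C v → S [] C v ≡ TC C v
      S-[] C v = ∑-cong (λ α → cong (_*_ (w α)) (*-identityˡ (kern C v (line α) 𝟙)))

      S-∷ : ∀ p K C v → S (p ∷ K) C v ≡ S K C v - S K (p ∷ C) v
      S-∷ p K C v = trans (∑-cong (λ α → eq (w α) (u p (line α) 𝟙) (free K (line α)) (kern C v (line α) 𝟙)))
        (∑-- (λ α → w α * (free K (line α) * kern C v (line α) 𝟙)) (λ α → w α * (free K (line α) * kern (p ∷ C) v (line α) 𝟙)))
        where
        eq : ∀ w u f k → w * ((1ℚ - u) * f * k) ≡ w * (f * k) - w * (f * (u * k))
        eq = solve-∀ ringℚ

      -- The sum, over all subsets of K, of the bounds for the kernels with that subset adjoined;
      -- the Boolean records whether triviality on 𝔽_q* persists.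
      bound : List ℕ → Bool → ℚ
      bound []      t = size t
      bound (p ∷ K) t = bound K t + bound K (divides-q+1 p ∧ t)

      S-bound : ∀ {K C} v → All OddPrimeDivisor K → All OddPrimeDivisor C → Unique K → Unique C →
        All (λ p → All (p ≢_) C) K → ∣ S K C v - main C v ∣≤ bound K (trivial C v)
      S-bound {[]} {C} v [] hC uK uC disj =
        subst (λ s → ∣ s - main C v ∣≤ size (trivial C v)) (sym (S-[] C v)) (TC-main-bound v hC uC)
      S-bound {p ∷ K} {C} v (hp ∷ hK) hC (p∉K ∷ uK) uC (p∉C ∷ disj) =
        subst (∣_∣≤ bound (p ∷ K) (trivial C v)) (sym eq)
          -- The branch containing p has no main term, as `main (p ∷ C) v` is 0.
          (∣-∣≤ {S K C v - main C v} {S K (p ∷ C) v - 0ℚ}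
            (S-bound v hK hC uK uC disj)
            (S-bound v hK (hp ∷ hC) uK (p∉C ∷ uC) (All.zipWith (λ { (p≢s , s∉C) → (λ e → p≢s (sym e)) ∷ s∉C }) (p∉K , disj))))
        where
        arith : ∀ a b m → a - b - m ≡ a - m - (b - 0ℚ)
        arith = solve-∀ ringℚ
        eq : S (p ∷ K) C v - main C v ≡ S K C v - main C v - (S K (p ∷ C) v - 0ℚ)
        eq = trans (cong (_- main C v) (S-∷ p K C v)) (arith (S K C v) (S K (p ∷ C) v) (main C v))

      -- The sum weighted by `free` and by 1 + u₂ - 2u₄, which is `g₄`. The weights 1 + 1 + 2 in
      -- `bound₄` are the source of the factor 4.
      S₄ : List ℕ → List ℕ → ℚ
      S₄ K C = S K C one + S K C two - 2ℚ * S K C four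

      bound₄ : List ℕ → List ℕ → ℚ
      bound₄ K C = bound K (trivial C one) + bound K (trivial C two) + 2ℚ * bound K (trivial C four)

      module _ {K} (hK : All OddPrimeDivisor K) (uK : Unique K) where

        S₄-lower : ℕ→ℚ (q ℕ.+ 1) - bound₄ K [] ≤ S₄ K []
        S₄-lower = ≤-from
          (0≤+ (0≤+ (≤⇒0≤ (proj₂ (bd one))) (≤⇒0≤ (proj₂ (bd two)))) (0≤* {2ℚ} (nonNegative⁻¹ 2ℚ) (≤⇒0≤ (proj₁ (bd four)))))
          (arith (S K [] one) (S K [] two) (S K [] four) (ℕ→ℚ (q ℕ.+ 1)) (bound K (trivial [] one)) (bound K (trivial [] two)) (bound K (trivial [] four)))
          where
          bd : ∀ v → ∣ S K [] v - main [] v ∣≤ bound K (trivial [] v)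
          bd v = S-bound v hK [] uK [] (All.map (λ _ → []) hK)
          arith : ∀ s t f m x y z → (s + t - 2ℚ * f) - (m - (x + y + 2ℚ * z)) ≡
            (x - (- (s - m))) + (y - (- (t - 0ℚ))) + 2ℚ * (z - (f - 0ℚ))
          arith = solve-∀ ringℚ

        S₄-upper : ∀ {p} → OddPrimeDivisor p → All (p ≢_) K → S₄ K (p ∷ []) ≤ bound₄ K (p ∷ [])
        S₄-upper {p} hp p∉K = ≤-from
          (0≤+ (0≤+ (≤⇒0≤ (proj₁ (bd one))) (≤⇒0≤ (proj₁ (bd two)))) (0≤* {2ℚ} (nonNegative⁻¹ 2ℚ) (≤⇒0≤ (proj₂ (bd four)))))
          (arith (S K (p ∷ []) one) (S K (p ∷ []) two) (S K (p ∷ []) four)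
            (bound K (trivial (p ∷ []) one)) (bound K (trivial (p ∷ []) two)) (bound K (trivial (p ∷ []) four)))
          where
          bd : ∀ v → ∣ S K (p ∷ []) v - 0ℚ ∣≤ bound K (trivial (p ∷ []) v)
          bd v = S-bound v hK (hp ∷ []) uK ([] ∷ []) (All.map (λ p≢s → (λ e → p≢s (sym e)) ∷ []) p∉K)
          arith : ∀ s t f x y z → (x + y + 2ℚ * z) - (s + t - 2ℚ * f) ≡
            (x - (s - 0ℚ)) + (y - (t - 0ℚ)) + 2ℚ * (z - (- (f - 0ℚ)))
          arith = solve-∀ ringℚ

      Good : List ℕ → F → Set
      Good ps x = All (λ p → x ^ E p ≢ 𝟙) ps × x ^ E 2 ≡ 𝟙 × x ^ E 4 ≢ 𝟙

      -- Four times the indicator function of the squares that are not fourth powers.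
      g₄ : F → ℚ
      g₄ x = 1ℚ + u 2 x 𝟙 * 1ℚ - 2ℚ * (u₄ x 𝟙 * 1ℚ)

      sim𝟙-no : ∀ e x → x ^ e ≢ 𝟙 → sim e x 𝟙 ≡ 0ℚ
      sim𝟙-no e x h = ⟦⟧-no (x ^ e ≟ 𝟙 ^ e) (λ t → h (trans t (𝟙^ e)))

      sim𝟙-yes : ∀ e x → x ^ e ≡ 𝟙 → sim e x 𝟙 ≡ 1ℚ
      sim𝟙-yes e x h = ⟦⟧-yes (x ^ e ≟ 𝟙 ^ e) (trans h (sym (𝟙^ e)))

      g₄≡ : ∀ x → g₄ x ≡ 2ℚ * 2ℚ * (sim (E 2) x 𝟙 - sim (E 4) x 𝟙)
      g₄≡ x = eq (sim (E 2) x 𝟙) (sim (E 4) x 𝟙)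
        where
        eq : ∀ s t → 1ℚ + ((1ℚ + 1ℚ) * s - 1ℚ) * 1ℚ - 2ℚ * ((2ℚ * t - s) * 1ℚ) ≡ 2ℚ * 2ℚ * (s - t)
        eq = solve-∀ ringℚ

      g₄-bad : ∀ x → ¬ (x ^ E 2 ≡ 𝟙 × x ^ E 4 ≢ 𝟙) → g₄ x ≡ 0ℚ
      g₄-bad x bad = trans (g₄≡ x) (by (x ^ E 2 ≟ 𝟙) (x ^ E 4 ≟ 𝟙))
        where
        by : Dec (x ^ E 2 ≡ 𝟙) → Dec (x ^ E 4 ≡ 𝟙) → 2ℚ * 2ℚ * (sim (E 2) x 𝟙 - sim (E 4) x 𝟙) ≡ 0ℚ
        by (yes s) (no t)  = ⊥-elim (bad (s , t))
        by (yes s) (yes t) = cong₂ (λ a b → 2ℚ * 2ℚ * (a - b)) (sim𝟙-yes (E 2) x s) (sim𝟙-yes (E 4) x t)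
        by (no s)  (no t)  = cong₂ (λ a b → 2ℚ * 2ℚ * (a - b)) (sim𝟙-no (E 2) x s) (sim𝟙-no (E 4) x t)
        by (no s)  (yes t) = ⊥-elim (s (trans (E₄-finer x 𝟙 (trans t (sym (𝟙^ (E 4))))) (𝟙^ (E 2))))

      0≤g₄ : ∀ x → 0ℚ ≤ g₄ x
      0≤g₄ x with x ^ E 2 ≟ 𝟙 | x ^ E 4 ≟ 𝟙
      ... | yes s | no t = subst (0ℚ ≤_) (sym (trans (g₄≡ x) (cong₂ (λ a b → 2ℚ * 2ℚ * (a - b)) (sim𝟙-yes (E 2) x s) (sim𝟙-no (E 4) x t))))
        (nonNegative⁻¹ (2ℚ * 2ℚ * (1ℚ - 0ℚ)))
      ... | no s  | _     = ≤-reflexive (sym (g₄-bad x (λ h → s (proj₁ h))))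
      ... | yes s | yes t = ≤-reflexive (sym (g₄-bad x (λ h → proj₂ h t)))

      1-u≡ : ∀ p x → 1ℚ - u p x 𝟙 ≡ b p * (1ℚ - sim (E p) x 𝟙)
      1-u≡ p x = eq (a p) (sim (E p) x 𝟙)
        where
        eq : ∀ a s → 1ℚ - ((1ℚ + a) * s - a) ≡ (1ℚ + a) * (1ℚ - s)
        eq = solve-∀ ringℚ

      0≤free : ∀ {K} → All OddPrimeDivisor K → ∀ x → 0ℚ ≤ free K x
      0≤free [] x = 0≤1
      0≤free {p ∷ K} ((pd , _) ∷ h) x = 0≤* (subst (0ℚ ≤_) (sym (1-u≡ p x))
        (0≤* {b p} (0≤+ 0≤1 (<⇒≤ (0<a pd))) (0≤1-⟦⟧ (x ^ E p ≟ 𝟙 ^ E p)))) (0≤free h x)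
        where
        0≤1-⟦⟧ : ∀ {P : Set} (d : Dec P) → 0ℚ ≤ 1ℚ - ⟦ d ⟧
        0≤1-⟦⟧ (yes _) = ≤-refl
        0≤1-⟦⟧ (no _)  = 0≤1

      free-bad : ∀ K x → ¬ All (λ p → x ^ E p ≢ 𝟙) K → free K x ≡ 0ℚ
      free-bad [] x bad = ⊥-elim (bad [])
      free-bad (p ∷ K) x bad with x ^ E p ≟ 𝟙
      ... | yes h = trans (cong (_* free K x) (trans (1-u≡ p x) (trans (cong (λ s → b p * (1ℚ - s)) (sim𝟙-yes (E p) x h)) (*-zeroʳ (b p)))))
                     (*-zeroˡ (free K x))
      ... | no ¬h = trans (cong (_*_ (1ℚ - u p x 𝟙)) (free-bad K x (λ t → bad (¬h ∷ t)))) (*-zeroʳ (1ℚ - u p x 𝟙))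

      simSum : List ℕ → F → ℚ
      simSum ps x = ∑ₗ (λ p → sim (E p) x 𝟙) ps

      0≤simSum : ∀ ps x → 0ℚ ≤ simSum ps x
      0≤simSum [] x = ≤-refl
      0≤simSum (p ∷ ps) x = 0≤+ (0≤⟦⟧ (x ^ E p ≟ 𝟙 ^ E p)) (0≤simSum ps x)

      simSum-bad : ∀ ps x → ¬ All (λ p → x ^ E p ≢ 𝟙) ps → 1ℚ ≤ simSum ps x
      simSum-bad [] x bad = ⊥-elim (bad [])
      simSum-bad (p ∷ ps) x bad with x ^ E p ≟ 𝟙
      ... | yes h = subst (_≤ simSum (p ∷ ps) x) (+-identityʳ 1ℚ)
                      (+-mono-≤ (≤-reflexive (sym (sim𝟙-yes (E p) x h))) (0≤simSum ps x))
      ... | no ¬h = subst (_≤ simSum (p ∷ ps) x) (+-identityˡ 1ℚ)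
                      (+-mono-≤ (0≤⟦⟧ (x ^ E p ≟ 𝟙 ^ E p)) (simSum-bad ps x (λ t → bad (¬h ∷ t))))

      module _ {K ps} (hK : All OddPrimeDivisor K) (uK : Unique K) (hps : All OddPrimeDivisor ps)
               (disj : All (λ p → All (p ≢_) K) ps) where

        θ : ℕ → ℚ
        θ p = 1ℚ - recipℕ p

        f : F → ℚ
        f x = free K x * g₄ x

        -- Away from good points either f vanishes, or x^(E p) = 1 for some p in ps; in the second
        -- case the indicators sum to at least 1, while f ≥ 0.
        f[1-simSum]≤0 : ∀ x → ¬ (All (λ p → x ^ E p ≢ 𝟙) K × Good ps x) → f x * (1ℚ - simSum ps x) ≤ 0ℚ
        f[1-simSum]≤0 x bad = by (All.all? (λ p → ¬? (x ^ E p ≟ 𝟙)) K) (All.all? (λ p → ¬? (x ^ E p ≟ 𝟙)) ps)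
          (x ^ E 2 ≟ 𝟙) (x ^ E 4 ≟ 𝟙)
          where
          s = 1ℚ - simSum ps x
          zero-f : f x ≡ 0ℚ → f x * s ≤ 0ℚ
          zero-f h = ≤-reflexive (trans (cong (_* s) h) (*-zeroˡ s))
          zero-g : ¬ (x ^ E 2 ≡ 𝟙 × x ^ E 4 ≢ 𝟙) → f x * s ≤ 0ℚ
          zero-g h = zero-f (trans (cong (_*_ (free K x)) (g₄-bad x h)) (*-zeroʳ (free K x)))
          by : Dec (All (λ p → x ^ E p ≢ 𝟙) K) → Dec (All (λ p → x ^ E p ≢ 𝟙) ps) → Dec (x ^ E 2 ≡ 𝟙) → Dec (x ^ E 4 ≡ 𝟙) →
               f x * s ≤ 0ℚ
          by (no k) _ _ _ = zero-f (trans (cong (_* g₄ x) (free-bad K x k)) (*-zeroˡ (g₄ x)))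
          by (yes k) (no p) _ _ = 0≤⇒≤ (subst (0ℚ ≤_) (eq (f x) (simSum ps x))
            (0≤* (0≤* (0≤free hK x) (0≤g₄ x)) (≤⇒0≤ (simSum-bad ps x p))))
            where
            eq : ∀ f s → f * (s - 1ℚ) ≡ 0ℚ - f * (1ℚ - s)
            eq = solve-∀ ringℚ
          by (yes k) (yes p) (no s) _ = zero-g (λ h → s (proj₁ h))
          by (yes k) (yes p) (yes s) (yes t) = zero-g (λ h → proj₂ h t)
          by (yes k) (yes p) (yes s) (no t) = ⊥-elim (bad (k , p , s , t))

        S₄≡ : ∀ C → ∑ (λ α → w α * (f (line α) * kern C one (line α) 𝟙)) ≡ S₄ K C
        S₄≡ C = begin
          ∑ (λ α → w α * (f (line α) * kern C one (line α) 𝟙))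
            ≡⟨ ∑-cong (λ α → pointwise α) ⟩
          ∑ (λ α → t one α + t two α - 2ℚ * t four α)
            ≡⟨ ∑-- (λ α → t one α + t two α) (λ α → 2ℚ * t four α) ⟩
          ∑ (λ α → t one α + t two α) - ∑ (λ α → 2ℚ * t four α)
            ≡⟨ cong₂ _-_ (∑-+ (t one) (t two)) (∑-*ˡ 2ℚ (t four)) ⟩
          S₄ K C ∎
          where
          open ≡-Reasoning
          t : Tail → F → ℚ
          t v α = w α * (free K (line α) * kern C v (line α) 𝟙)
          tail : ∀ C v x y → kern C v x y ≡ kern C one x y * tailK v x y
          tail [] v x y = sym (*-identityˡ (tailK v x y))
          tail (p ∷ C) v x y = trans (cong (_*_ (u p x y)) (tail C v x y)) (sym (*-assoc (u p x y) (kern C one x y) (tailK v x y)))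
          eq : ∀ w f k a b → w * (f * (1ℚ + a - 2ℚ * b) * k) ≡ w * (f * k) + w * (f * (k * a)) - 2ℚ * (w * (f * (k * b)))
          eq = solve-∀ ringℚ
          pointwise : ∀ α → w α * (f (line α) * kern C one (line α) 𝟙) ≡ t one α + t two α - 2ℚ * t four α
          pointwise α = trans (eq (w α) (free K (line α)) (kern C one (line α) 𝟙) (tailK two (line α) 𝟙) (tailK four (line α) 𝟙))
            (sym (cong₂ (λ x y → t one α + w α * (free K (line α) * x) - 2ℚ * (w α * (free K (line α) * y)))
              (tail C two (line α) 𝟙) (tail C four (line α) 𝟙)))

        -- `sim≡u` splits each indicator as 1/p + (1 - 1/p)·`u p`: the constants add up to
        -- `sumRecip`, and the other part puts p into the kernel.
        expand : ∀ ps → All OddPrimeDivisor ps →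
          ∑ (λ α → w α * (f (line α) * simSum ps (line α))) ≡
          sumRecip ps * S₄ K [] + ∑ₗ (λ p → θ p * S₄ K (p ∷ [])) ps
        expand [] [] = trans (∑-zero (λ α → trans (cong (_*_ (w α)) (*-zeroʳ (f (line α)))) (*-zeroʳ (w α))))
          (sym (trans (+-identityʳ (0ℚ * S₄ K [])) (*-zeroˡ (S₄ K []))))
        expand (p ∷ ps) ((pd , _) ∷ h) = begin
          ∑ (λ α → w α * (f (line α) * (sim (E p) (line α) 𝟙 + simSum ps (line α))))
            ≡⟨ ∑-cong (λ α → trans (cong (λ s → w α * (f (line α) * (s + simSum ps (line α)))) (sim≡u pd (line α) 𝟙))
                 (eq (w α) (f (line α)) (recipℕ p) (θ p) (u p (line α) 𝟙) (simSum ps (line α)))) ⟩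
          ∑ (λ α → (recipℕ p * A α + θ p * B α) + D α)
            ≡⟨ ∑-+ (λ α → recipℕ p * A α + θ p * B α) D ⟩
          ∑ (λ α → recipℕ p * A α + θ p * B α) + ∑ D
            ≡⟨ cong₂ _+_ (∑-lin₂ (recipℕ p) (θ p) A B) (expand ps h) ⟩
          (recipℕ p * ∑ A + θ p * ∑ B) + (sumRecip ps * S₄ K [] + ∑ₗ g ps)
            ≡⟨ cong₂ (λ x y → (recipℕ p * x + θ p * y) + (sumRecip ps * S₄ K [] + ∑ₗ g ps)) (S₄≡ []) (S₄≡ (p ∷ [])) ⟩
          (recipℕ p * S₄ K [] + θ p * S₄ K (p ∷ [])) + (sumRecip ps * S₄ K [] + ∑ₗ g ps)
            ≡⟨ eq′ (recipℕ p) (sumRecip ps) (S₄ K []) (θ p * S₄ K (p ∷ [])) (∑ₗ g ps) ⟩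
          (recipℕ p + sumRecip ps) * S₄ K [] + (θ p * S₄ K (p ∷ []) + ∑ₗ g ps) ∎
          where
          open ≡-Reasoning
          g : ℕ → ℚ
          g p = θ p * S₄ K (p ∷ [])
          A B D : F → ℚ
          A α = w α * (f (line α) * 1ℚ)
          B α = w α * (f (line α) * (u p (line α) 𝟙 * 1ℚ))
          D α = w α * (f (line α) * simSum ps (line α))
          eq : ∀ w f i t u s → w * (f * (i + t * u + s)) ≡ (i * (w * (f * 1ℚ)) + t * (w * (f * (u * 1ℚ)))) + w * (f * s)
          eq = solve-∀ ringℚ
          eq′ : ∀ i j s a b → (i * s + a) + (j * s + b) ≡ (i + j) * s + (a + b)
          eq′ = solve-∀ ringℚ

        -- Summing f·(1 - ∑ s_p) ≤ 0 over the line gives ε·S₄(K, ∅) ≤ ∑ (1 - 1/p)·S₄(K, {p}). The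
        -- main term q + 1 occurs only on the left, which is bounded from below, and the right side
        -- from above.
        sieve : 0ℚ ≤ 1ℚ - sumRecip ps →
          (∀ α → InSub α → ¬ (All (λ p → line α ^ E p ≢ 𝟙) K × Good ps (line α))) →
          (1ℚ - sumRecip ps) * (ℕ→ℚ (q ℕ.+ 1) - bound₄ K []) ≤ ∑ₗ (λ p → θ p * bound₄ K (p ∷ [])) ps
        sieve 0≤ε none = ≤-trans (*-monoˡ-≤-nonNeg (1ℚ - sumRecip ps) {{nonNegative 0≤ε}} (S₄-lower hK uK))
          (≤-trans step (mono ps hps disj))
          where
          nonpos : ∀ α → w α * (f (line α) * (1ℚ - simSum ps (line α))) ≤ 0ℚ
          nonpos α with inSub? α
          ... | yes hα = subst (_≤ 0ℚ) (sym (*-identityˡ (f (line α) * (1ℚ - simSum ps (line α)))))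
                           (f[1-simSum]≤0 (line α) (none α hα))
          ... | no _ = ≤-reflexive (*-zeroˡ (f (line α) * (1ℚ - simSum ps (line α))))
          eq : ∀ w f s → w * (f * (1ℚ - s)) ≡ w * (f * 1ℚ) - w * (f * s)
          eq = solve-∀ ringℚ
          total : ∑ (λ α → w α * (f (line α) * (1ℚ - simSum ps (line α)))) ≡
                  S₄ K [] - (sumRecip ps * S₄ K [] + ∑ₗ (λ p → θ p * S₄ K (p ∷ [])) ps)
          total = trans (∑-cong (λ α → eq (w α) (f (line α)) (simSum ps (line α))))
            (trans (∑-- (λ α → w α * (f (line α) * 1ℚ)) (λ α → w α * (f (line α) * simSum ps (line α))))
              (cong₂ _-_ (S₄≡ []) (expand ps hps)))
          step : (1ℚ - sumRecip ps) * S₄ K [] ≤ ∑ₗ (λ p → θ p * S₄ K (p ∷ [])) ps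
          step = ≤-from (0≤neg (subst₂ _≤_ total (∑-zero {n} (λ _ → refl)) (∑-mono nonpos)))
            (arith (sumRecip ps) (S₄ K []) (∑ₗ (λ p → θ p * S₄ K (p ∷ [])) ps))
            where
            arith : ∀ i s l → l - (1ℚ - i) * s ≡ - (s - (i * s + l))
            arith = solve-∀ ringℚ
          mono : ∀ ps → All OddPrimeDivisor ps → All (λ p → All (p ≢_) K) ps →
            ∑ₗ (λ p → θ p * S₄ K (p ∷ [])) ps ≤ ∑ₗ (λ p → θ p * bound₄ K (p ∷ [])) ps
          mono [] [] [] = ≤-refl
          mono (p ∷ ps) (hp ∷ h) (p∉K ∷ d) = +-mono-≤
            (*-monoˡ-≤-nonNeg (θ p) {{nonNegative (0≤1-recip (proj₁ (proj₁ hp)))}} (S₄-upper hK uK hp p∉K)) (mono ps h d)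

-- Rational upper bounds for √q.

module SquareRoots where

  open RationalLemmas
  open import Defs using (ℕ→ℚ; GtCSqrt)
  open import Data.Empty using (⊥-elim)
  open import Data.Nat as ℕ using (ℕ)
  open import Data.Product using (∃; _×_; _,_; proj₂)
  open import Data.Rational
  open import Data.Rational.Properties
  open import Data.Sum using (inj₁; inj₂)
  open import Relation.Nullary using (Dec; yes; no)
  open import Relation.Binary.PropositionalEquality
  open import Tactic.RingSolver using (solve-∀)

  SqrtUpperBound : ℕ → ℚ → Set
  SqrtUpperBound q r = 0ℚ ≤ r × ℕ→ℚ q ≤ r * r

  reciprocal : ∀ {c} → 0ℚ < c → ∃ λ i → 0ℚ < i × c * i ≡ 1ℚ
  reciprocal {c} 0<c = 1/ c , positive⁻¹ (1/ c) {{1/pos⇒pos c}} , *-inverseʳ c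
    where
    instance
      _ = positive 0<c
      _ = pos⇒nonZero c

  0<-of-sq : ∀ {x} → 0ℚ ≤ x → 0ℚ < x * x → 0ℚ < x
  0<-of-sq {x} 0≤x 0<x² with 0ℚ <? x
  ... | yes h = h
  ... | no ¬h = ⊥-elim (<-irrefl (sym (trans (cong (_* x) x≡0) (*-zeroˡ x))) 0<x²)
    where
    x≡0 : x ≡ 0ℚ
    x≡0 = ≤-antisym (≮⇒≥ ¬h) 0≤x

  -- The arithmetic mean of s and t is at least their geometric mean √q; the squares differ by (½(s
  -- - t))².
  heron : ∀ q {s t} → 0ℚ < s → 0ℚ < t → s * t ≡ ℕ→ℚ q → SqrtUpperBound q (½ * (s + t))
  heron q {s} {t} 0<s 0<t st≡q =
    0≤* (nonNegative⁻¹ ½) (0≤+ (<⇒≤ 0<s) (<⇒≤ 0<t)) ,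
    ≤-from (0≤sq (½ * (s - t))) (trans (cong (_-_ (½ * (s + t) * (½ * (s + t)))) (sym st≡q)) (eq s t))
    where
    eq : ∀ s t → ½ * (s + t) * (½ * (s + t)) - s * t ≡ ½ * (s - t) * (½ * (s - t))
    eq = solve-∀ ringℚ

  module _ (q : ℕ) .{{_ : ℕ.NonZero q}} where
    private
      Q = ℕ→ℚ q

      0<Q : 0ℚ < Q
      0<Q = 0<ℕ→ℚ q

      -- As q ≥ 1, q itself bounds √q. This crude choice serves whenever the coefficient of √q is
      -- not positive.
      Q-bound : SqrtUpperBound q Q
      Q-bound = 0≤ℕ→ℚ q , ≤-from (0≤* (0≤ℕ→ℚ q) (≤⇒0≤ (ℕ→ℚ-mono-≤ {1} {q} (ℕ.>-nonZero⁻¹ q)))) (eq Q)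
        where
        eq : ∀ q → q * q - q ≡ q * (q - 1ℚ)
        eq = solve-∀ ringℚ

    -- One Heron step from x/c, which exceeds √q: for r = ½(x/c + qc/x), the product c·r = ½(x +
    -- qc²/x) is less than x. The reciprocals i and j are 1/c and 1/x.
    √-gap : ∀ {x c} → 0ℚ < c → 0ℚ < x → c * c * Q < x * x → ∃ λ r → SqrtUpperBound q r × c * r < x
    √-gap {x} {c} 0<c 0<x c²q<x² = from (reciprocal 0<c) (reciprocal 0<x)
      where
      eq₁ : ∀ x i q c j → x * i * (q * c * j) ≡ q * (c * i) * (x * j)
      eq₁ = solve-∀ ringℚ
      eq₂ : ∀ x i q c j → x - c * (½ * (x * i + q * c * j)) ≡
        ½ * j * (x * x - c * c * q) + x * (½ * (1ℚ - x * j) + ½ * (1ℚ - c * i))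
      eq₂ = solve-∀ ringℚ
      eq₃ : ∀ a x → a + x * (½ * (1ℚ - 1ℚ) + ½ * (1ℚ - 1ℚ)) ≡ a
      eq₃ = solve-∀ ringℚ
      from : (∃ λ i → 0ℚ < i × c * i ≡ 1ℚ) → (∃ λ j → 0ℚ < j × x * j ≡ 1ℚ) →
        ∃ λ r → SqrtUpperBound q r × c * r < x
      from (i , 0<i , ci≡1) (j , 0<j , xj≡1) =
        ½ * (x * i + Q * c * j) , heron q (0<* 0<x 0<i) (0<* (0<* 0<Q 0<c) 0<j) st≡q , cr<x
        where
        st≡q : x * i * (Q * c * j) ≡ Q
        st≡q = trans (eq₁ x i Q c j) (trans (cong₂ (λ a b → Q * a * b) ci≡1 xj≡1) (trans (*-identityʳ (Q * 1ℚ)) (*-identityʳ Q)))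
        cr<x : c * (½ * (x * i + Q * c * j)) < x
        cr<x = <-from (0<* (0<* (positive⁻¹ ½) 0<j) (<⇒0< c²q<x²))
          (trans (eq₂ x i Q c j) (trans (cong₂ (λ a b → ½ * j * (x * x - c * c * Q) + x * (½ * (1ℚ - a) + ½ * (1ℚ - b))) xj≡1 ci≡1)
            (eq₃ (½ * j * (x * x - c * c * Q)) x)))

    -- The strict real inequality x > c√q leaves room for a rational r ≥ √q in place of √q; only c >
    -- 0 requires r to be close to √q.
    √-separation : ∀ x c → GtCSqrt x c q → ∃ λ r → SqrtUpperBound q r × c * r < x
    √-separation x c (inj₁ (c<0 , inj₁ 0≤x)) = Q , Q-bound , <-≤-trans cQ<0 0≤x
      where
      cQ<0 : c * Q < 0ℚ
      cQ<0 = <-from (0<* (neg-antimono-< c<0) 0<Q) (eq c Q)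
        where
        eq : ∀ c q → 0ℚ - c * q ≡ (- c) * q
        eq = solve-∀ ringℚ
    √-separation x c (inj₁ (c<0 , inj₂ x²<c²q)) = Q , Q-bound , cQ<x
      where
      cQ<x : c * Q < x
      cQ<x with c * Q <? x
      ... | yes h = h
      ... | no ¬h = ⊥-elim (<-irrefl refl (<-≤-trans x²<c²q c²q≤x²))
        where
        0≤-c : 0ℚ ≤ - c
        0≤-c = <⇒≤ (neg-antimono-< c<0)
        0≤d : 0ℚ ≤ c * Q - x
        0≤d = ≤⇒0≤ (≮⇒≥ ¬h)
        -- With d = cq - x ≥ 0, -x is the sum of d and (-c)q, both nonnegative; so x² ≥ c²q², and q²
        -- ≥ q.
        eq : ∀ x c q → x * x - c * c * q ≡
          (c * q - x) * (c * q - x) + (1ℚ + 1ℚ) * ((c * q - x) * ((- c) * q)) + (- c) * (- c) * (q * q - q)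
        eq = solve-∀ ringℚ
        c²q≤x² : c * c * Q ≤ x * x
        c²q≤x² = ≤-from (0≤+ (0≤+ (0≤sq (c * Q - x)) (0≤* (nonNegative⁻¹ (1ℚ + 1ℚ)) (0≤* 0≤d (0≤* 0≤-c (0≤ℕ→ℚ q)))))
          (0≤* (0≤* 0≤-c 0≤-c) (≤⇒0≤ (proj₂ Q-bound)))) (eq x c Q)
    √-separation x c (inj₂ (0≤c , 0≤x , c²q<x²)) = by (0ℚ <? c)
      where
      0<x : 0ℚ < x
      0<x = 0<-of-sq 0≤x (≤-<-trans (0≤* (0≤sq c) (0≤ℕ→ℚ q)) c²q<x²)
      by : Dec (0ℚ < c) → ∃ λ r → SqrtUpperBound q r × c * r < x
      by (no ¬0<c) = Q , Q-bound , subst (_< x) (sym (trans (cong (_* Q) (≤-antisym (≮⇒≥ ¬0<c) 0≤c)) (*-zeroˡ Q))) 0<x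
      by (yes 0<c) = √-gap 0<c 0<x c²q<x²

    -- A Heron step from y itself: for r = ½(y + q/y), the product y·r is the mean of y² and q.
    √-product : ∀ {y} → 0ℚ < y → y * y ≤ Q → ∃ λ r → SqrtUpperBound q r × y * r ≤ Q
    √-product {y} 0<y y²≤q with reciprocal 0<y
    ... | j , 0<j , yj≡1 = ½ * (y + Q * j) , heron q 0<y (0<* 0<Q 0<j) st≡q , yr≤Q
      where
      eq₁ : ∀ y q j → y * (q * j) ≡ q * (y * j)
      eq₁ = solve-∀ ringℚ
      st≡q : y * (Q * j) ≡ Q
      st≡q = trans (eq₁ y Q j) (trans (cong (_*_ Q) yj≡1) (*-identityʳ Q))
      eq₂ : ∀ y q j → q - y * (½ * (y + q * j)) ≡ ½ * (q - y * y) + ½ * (q * (1ℚ - y * j))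
      eq₂ = solve-∀ ringℚ
      eq₃ : ∀ a q → a + ½ * (q * (1ℚ - 1ℚ)) ≡ a
      eq₃ = solve-∀ ringℚ
      yr≤Q : y * (½ * (y + Q * j)) ≤ Q
      yr≤Q = ≤-from (0≤* (nonNegative⁻¹ ½) (≤⇒0≤ y²≤q))
        (trans (eq₂ y Q j) (trans (cong (λ a → ½ * (Q - y * y) + ½ * (Q * (1ℚ - a))) yj≡1) (eq₃ (½ * (Q - y * y)) Q)))

-- Explicit bounds and comparison with the hypotheses.

module Estimates where

  open RationalLemmas
  open FieldBasics
  open Kernels using (2ℚ)
  open Lines
  open Sieve
  open SquareRoots
  open import Defs using (ℕ→ℚ; recipℕ; sumRecip; _÷ℚ_; GtAffineSqrt; SqrtGe)
  open import Data.Bool using (true; false; _∧_)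
  open import Data.List using (List; []; _∷_; _++_; length; filter)
  open import Data.List.Properties using (length-++; filter-accept; filter-reject)
  open import Data.List.Relation.Unary.All as All using (All; []; _∷_)
  open import Data.List.Relation.Unary.All.Properties using (++⁻ˡ)
  open import Data.List.Relation.Unary.Unique.Propositional using (Unique)
  open import Data.Nat as ℕ using (ℕ; suc)
  import Data.Nat.Properties as ℕ
  open import Data.Nat.Divisibility using (_∣_; _∣?_)
  open import Data.Nat.Primality using (Prime)
  open import Data.Product using (∃; _×_; _,_; proj₁)
  open import Data.Rational
  open import Data.Rational.Properties
  open import Data.Sum using (_⊎_; inj₁; inj₂)
  open import Relation.Nullary using (¬_; Dec; yes; no)
  open import Relation.Nullary.Decidable using (dec-true; dec-false)
  open import Relation.Binary.PropositionalEquality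
  open import Tactic.RingSolver using (solve-∀)

  ∑ₗ-++ : ∀ f ps qs → ∑ₗ f (ps ++ qs) ≡ ∑ₗ f ps + ∑ₗ f qs
  ∑ₗ-++ f []       qs = sym (+-identityˡ (∑ₗ f qs))
  ∑ₗ-++ f (p ∷ ps) qs = trans (cong (_+_ (f p)) (∑ₗ-++ f ps qs)) (sym (+-assoc (f p) (∑ₗ f ps) (∑ₗ f qs)))

  -- The total sieving weight, that is, the sum of 1 - 1/p over ps.
  Θ : List ℕ → ℚ
  Θ ps = ℕ→ℚ (length ps) - sumRecip ps

  Θ-∷ : ∀ p ps → Θ (p ∷ ps) ≡ (1ℚ - recipℕ p) + Θ ps
  Θ-∷ p ps = trans (cong (_- (recipℕ p + sumRecip ps)) (ℕ→ℚ-suc (length ps))) (eq (ℕ→ℚ (length ps)) (recipℕ p) (sumRecip ps))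
    where
    eq : ∀ l i s → 1ℚ + l - (i + s) ≡ (1ℚ - i) + (l - s)
    eq = solve-∀ ringℚ

  0≤Θ : ∀ {ps} → All Prime ps → 0ℚ ≤ Θ ps
  0≤Θ [] = ≤-refl
  0≤Θ {p ∷ ps} (pp ∷ h) = subst (0ℚ ≤_) (sym (Θ-∷ p ps)) (0≤+ (0≤1-recip pp) (0≤Θ h))

  ∑ₗ-Θ : ∀ (g : ℕ → ℚ) (Y : ℚ) {ps} → All (λ p → g p ≡ Y) ps → ∑ₗ (λ p → (1ℚ - recipℕ p) * g p) ps ≡ Θ ps * Y
  ∑ₗ-Θ g Y [] = sym (*-zeroˡ Y)
  ∑ₗ-Θ g Y {p ∷ ps} (e ∷ h) = trans (cong₂ (λ y s → (1ℚ - recipℕ p) * y + s) e (∑ₗ-Θ g Y h))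
    (trans (sym (*-distribʳ-+ Y (1ℚ - recipℕ p) (Θ ps))) (cong (_* Y) (sym (Θ-∷ p ps))))

  ℕ→ℚ-2^suc : ∀ l → ℕ→ℚ (2 ℕ.^ suc l) ≡ 2ℚ * ℕ→ℚ (2 ℕ.^ l)
  ℕ→ℚ-2^suc l = ℕ→ℚ-* 2 (2 ℕ.^ l)

  module EstimateTheory {n : ℕ} {𝔽 : FinField n} (𝓛 : LineData 𝔽) (2∣q+1 : 2 ∣ LineData.q 𝓛 ℕ.+ 1) where
    open SieveTheory 𝓛 2∣q+1 public

    -- The number of characters of order 1, 2 or 4 that are trivial on 𝔽_q*.
    Multiplicity : ℚ → Set
    Multiplicity m = (4 ∣ q ℕ.+ 1 × m ≡ ℕ→ℚ 4) ⊎ (¬ (4 ∣ q ℕ.+ 1) × m ≡ ℕ→ℚ 2)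

    K₁ : List ℕ → List ℕ
    K₁ = filter (λ p → p ∣? (q ℕ.+ 1))

    W# W₁# : List ℕ → ℚ
    W# K = ℕ→ℚ (2 ℕ.^ length K)
    W₁# K = ℕ→ℚ (2 ℕ.^ length (K₁ K))

    module _ {r : ℚ} (0≤r : 0ℚ ≤ r) (q≤r² : ℕ→ℚ q ≤ r * r) where
      open Bounds 0≤r q≤r²

      bound-false : ∀ K → bound K false ≡ W# K * r
      bound-false [] = sym (*-identityˡ r)
      bound-false (p ∷ K) = trans (cong₂ _+_ (bound-false K) (trans (cong (bound K) (∧-false (divides-q+1 p))) (bound-false K)))
        (trans (eq (W# K) r) (cong (_* r) (sym (ℕ→ℚ-2^suc (length K)))))
        where
        ∧-false : ∀ b → b ∧ false ≡ false
        ∧-false true  = refl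
        ∧-false false = refl
        eq : ∀ w r → w * r + w * r ≡ 2ℚ * w * r
        eq = solve-∀ ringℚ

      -- A subset of K costs 1 if all its primes divide q + 1, and r otherwise; the subsets of the
      -- first kind are those of `K₁ K`.
      bound-true : ∀ K → bound K true ≡ W₁# K + (W# K - W₁# K) * r
      bound-true [] = eq r
        where
        eq : ∀ r → 1ℚ ≡ 1ℚ + (1ℚ - 1ℚ) * r
        eq = solve-∀ ringℚ
      bound-true (p ∷ K) = by (p ∣? (q ℕ.+ 1))
        where
        open ≡-Reasoning
        eq₁ : ∀ a b r → (a + (b - a) * r) + (a + (b - a) * r) ≡ 2ℚ * a + (2ℚ * b - 2ℚ * a) * r
        eq₁ = solve-∀ ringℚ
        eq₂ : ∀ a b r → (a + (b - a) * r) + b * r ≡ a + (2ℚ * b - a) * r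
        eq₂ = solve-∀ ringℚ
        by : Dec (p ∣ q ℕ.+ 1) → bound (p ∷ K) true ≡ W₁# (p ∷ K) + (W# (p ∷ K) - W₁# (p ∷ K)) * r
        by (yes p∣) = begin
          bound K true + bound K (divides-q+1 p ∧ true)
            ≡⟨ cong₂ _+_ (bound-true K) (trans (cong (λ b → bound K (b ∧ true)) (dec-true (p ∣? (q ℕ.+ 1)) p∣)) (bound-true K)) ⟩
          (W₁# K + (W# K - W₁# K) * r) + (W₁# K + (W# K - W₁# K) * r)
            ≡⟨ eq₁ (W₁# K) (W# K) r ⟩
          2ℚ * W₁# K + (2ℚ * W# K - 2ℚ * W₁# K) * r
            ≡⟨ cong₂ (λ a b → a + (b - a) * r)
                 (trans (cong (λ l → ℕ→ℚ (2 ℕ.^ length l)) (filter-accept (λ p → p ∣? (q ℕ.+ 1)) p∣)) (ℕ→ℚ-2^suc (length (K₁ K))))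
                 (ℕ→ℚ-2^suc (length K)) ⟨
          W₁# (p ∷ K) + (W# (p ∷ K) - W₁# (p ∷ K)) * r ∎
        by (no p∤) = begin
          bound K true + bound K (divides-q+1 p ∧ true)
            ≡⟨ cong₂ _+_ (bound-true K) (trans (cong (λ b → bound K (b ∧ true)) (dec-false (p ∣? (q ℕ.+ 1)) p∤)) (bound-false K)) ⟩
          (W₁# K + (W# K - W₁# K) * r) + W# K * r
            ≡⟨ eq₂ (W₁# K) (W# K) r ⟩
          W₁# K + (2ℚ * W# K - W₁# K) * r
            ≡⟨ cong₂ (λ a b → a + (b - a) * r)
                 (cong (λ l → ℕ→ℚ (2 ℕ.^ length l)) (filter-reject (λ p → p ∣? (q ℕ.+ 1)) p∤)) (ℕ→ℚ-2^suc (length K)) ⟨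
          W₁# (p ∷ K) + (W# (p ∷ K) - W₁# (p ∷ K)) * r ∎

      -- If every kernel cost r, the total would be 4·`W# K`·r. Each of the m characters of order 1,
      -- 2 or 4 trivial on 𝔽_q* saves r - 1 for each subset of `K₁ K`.
      bound₄-[] : ∀ {m} → Multiplicity m → ∀ K → bound₄ K [] ≡ ℕ→ℚ 4 * W# K * r - m * W₁# K * (r - 1ℚ)
      bound₄-[] (inj₁ (4∣ , refl)) K = trans
        (cong₂ (λ x b → x + x + 2ℚ * bound K b) (bound-true K) (dec-true (4 ∣? (q ℕ.+ 1)) 4∣))
        (trans (cong (λ x → (W₁# K + (W# K - W₁# K) * r) + (W₁# K + (W# K - W₁# K) * r) + 2ℚ * x) (bound-true K)) (eq (W₁# K) (W# K) r))
        where
        eq : ∀ a b r → (a + (b - a) * r) + (a + (b - a) * r) + 2ℚ * (a + (b - a) * r) ≡ ℕ→ℚ 4 * b * r - ℕ→ℚ 4 * a * (r - 1ℚ)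
        eq = solve-∀ ringℚ
      bound₄-[] (inj₂ (4∤ , refl)) K = trans
        (cong₂ (λ x b → x + x + 2ℚ * bound K b) (bound-true K) (dec-false (4 ∣? (q ℕ.+ 1)) 4∤))
        (trans (cong (λ x → (W₁# K + (W# K - W₁# K) * r) + (W₁# K + (W# K - W₁# K) * r) + 2ℚ * x) (bound-false K)) (eq (W₁# K) (W# K) r))
        where
        eq : ∀ a b r → (a + (b - a) * r) + (a + (b - a) * r) + 2ℚ * (b * r) ≡ ℕ→ℚ 4 * b * r - ℕ→ℚ 2 * a * (r - 1ℚ)
        eq = solve-∀ ringℚ

      -- Adjoining p preserves triviality on 𝔽_q* if p ∣ q + 1. If not, as in `bound₄-∤`, triviality
      -- is lost and every term costs r. This is why the sieving primes come in two lists.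
      bound₄-∣ : ∀ K {p} → p ∣ q ℕ.+ 1 → bound₄ K (p ∷ []) ≡ bound₄ K []
      bound₄-∣ K {p} p∣ = cong (λ b → bound K (b ∧ true) + bound K (b ∧ true) + 2ℚ * bound K (b ∧ tailTrivial four))
        (dec-true (p ∣? (q ℕ.+ 1)) p∣)

      bound₄-∤ : ∀ K {p} → ¬ (p ∣ q ℕ.+ 1) → bound₄ K (p ∷ []) ≡ ℕ→ℚ 4 * W# K * r
      bound₄-∤ K {p} p∤ = trans
        (cong (λ b → bound K (b ∧ true) + bound K (b ∧ true) + 2ℚ * bound K (b ∧ tailTrivial four)) (dec-false (p ∣? (q ℕ.+ 1)) p∤))
        (trans (cong (λ x → x + x + 2ℚ * x) (bound-false K)) (eq (W# K) r))
        where
        eq : ∀ b r → b * r + b * r + 2ℚ * (b * r) ≡ ℕ→ℚ 4 * b * r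
        eq = solve-∀ ringℚ

    module _ {K ps₁ ps₂ : List ℕ} (hK : All OddPrimeDivisor K) (uK : Unique K)
      (hps : All OddPrimeDivisor (ps₁ ++ ps₂)) (disj : All (λ p → All (p ≢_) K) (ps₁ ++ ps₂))
      (ps₁∣ : All (_∣ q ℕ.+ 1) ps₁) (ps₂∤ : All (λ p → ¬ (p ∣ q ℕ.+ 1)) ps₂)
      (0<ε : 0ℚ < 1ℚ - sumRecip (ps₁ ++ ps₂)) where

      private
        ps = ps₁ ++ ps₂
        ε = 1ℚ - sumRecip ps
        ε′ = 1ℚ - sumRecip ps₁
        R₁ = ℕ→ℚ (length ps₁)
        R₂ = ℕ→ℚ (length ps₂)
        σ₁ = sumRecip ps₁
        σ₂ = sumRecip ps₂

      A B : ℚ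
      A = W# K * ((ℕ→ℚ (length (ps₁ ++ ps₂)) - 1ℚ) ÷ℚ (1ℚ - sumRecip (ps₁ ++ ps₂)) + ℕ→ℚ 2)
      B = W₁# K * ((ℕ→ℚ (length ps₁) - 1ℚ + (1ℚ - sumRecip ps₁)) ÷ℚ (1ℚ - sumRecip (ps₁ ++ ps₂)) + 1ℚ)

      private
        ε≢0 : ε ≢ 0ℚ
        ε≢0 e = <-irrefl (sym e) 0<ε

        s≡ : ℕ→ℚ (length ps) ≡ R₁ + R₂
        s≡ = trans (cong ℕ→ℚ (length-++ ps₁)) (ℕ→ℚ-+ (length ps₁) (length ps₂))

        σ≡ : sumRecip ps ≡ σ₁ + σ₂
        σ≡ = ∑ₗ-++ recipℕ ps₁ ps₂

        primes : All Prime ps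
        primes = All.map (λ o → proj₁ (proj₁ o)) hps

        Aε : A * ε ≡ W# K * (ℕ→ℚ (length ps) - 1ℚ + ℕ→ℚ 2 * ε)
        Aε = trans (eq (W# K) ((ℕ→ℚ (length ps) - 1ℚ) ÷ℚ ε) ε)
          (cong (λ t → W# K * (t + ℕ→ℚ 2 * ε)) (÷ℚ-* (ℕ→ℚ (length ps) - 1ℚ) ε≢0))
          where
          eq : ∀ w d e → w * (d + ℕ→ℚ 2) * e ≡ w * (d * e + ℕ→ℚ 2 * e)
          eq = solve-∀ ringℚ

        Bε : B * ε ≡ W₁# K * (R₁ - 1ℚ + ε′ + ε)
        Bε = trans (eq (W₁# K) ((R₁ - 1ℚ + ε′) ÷ℚ ε) ε)
          (cong (λ t → W₁# K * (t + ε)) (÷ℚ-* (R₁ - 1ℚ + ε′) ε≢0))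
          where
          eq : ∀ w d e → w * (d + 1ℚ) * e ≡ w * (d * e + e)
          eq = solve-∀ ringℚ

      -- Multiplied by ε, A becomes `W# K` times Θ + ε, because s - 1 + 2ε = (s - ∑ 1/p) + ε; this
      -- also covers s = 0.
      0<A : 0ℚ < A
      0<A = *-cancelʳ-<-nonNeg ε {{nonNegative (<⇒≤ 0<ε)}} (subst₂ _<_ (sym (*-zeroˡ ε))
        (sym (trans Aε (cong (_*_ (W# K)) (eq (ℕ→ℚ (length ps)) (sumRecip ps)))))
        (0<* (0<ℕ→ℚ (2 ℕ.^ length K) {{ℕ.m^n≢0 2 (length K)}}) (+-mono-≤-< (0≤Θ primes) 0<ε)))
        where
        eq : ∀ l s → l - 1ℚ + ℕ→ℚ 2 * (1ℚ - s) ≡ (l - s) + (1ℚ - s)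
        eq = solve-∀ ringℚ

      0≤B : 0ℚ ≤ B
      0≤B = *-cancelʳ-≤-pos ε {{positive 0<ε}} (subst₂ _≤_ (sym (*-zeroˡ ε))
        (sym (trans Bε (cong (_*_ (W₁# K)) (eq R₁ σ₁ ε))))
        (0≤* (0≤ℕ→ℚ (2 ℕ.^ length (K₁ K))) (0≤+ (0≤Θ (++⁻ˡ ps₁ primes)) (<⇒≤ 0<ε))))
        where
        eq : ∀ l s e → l - 1ℚ + (1ℚ - s) + e ≡ (l - s) + e
        eq = solve-∀ ringℚ

      module _ {m : ℚ} (mult : Multiplicity m)
        (none : ∀ α → InSub α → ¬ (All (λ p → line α ^ E p ≢ 𝟙) K × All (λ p → line α ^ E p ≢ 𝟙) (ps₁ ++ ps₂) × line α ^ E 2 ≡ 𝟙 × line α ^ E 4 ≢ 𝟙)) where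

        -- The sieve gives ε(q + 1 - Y₁) ≤ Θ₁Y₁ + Θ₂Y₂, where Y₁ and Y₂ are the bounds for primes
        -- dividing q + 1 and for the others. Solving for q + 1 leaves the coefficients ε + Θ = s -
        -- 1 + 2ε and ε + Θ₁ = R₁ - 1 + ε′ + ε, which are those of A and B.
        q+1≤ : ∀ {r} → SqrtUpperBound q r → ℕ→ℚ (q ℕ.+ 1) ≤ (ℕ→ℚ 4 * A - m * B) * r + m * B
        q+1≤ {r} (0≤r , q≤r²) = ≤-cancel* 0<ε (≤-from (≤⇒0≤ sieved) (begin
          ε * ((ℕ→ℚ 4 * A - m * B) * r + m * B) - ε * Q
            ≡⟨ eq₁ ε A B m r Q ⟩
          ℕ→ℚ 4 * (A * ε) * r - m * (B * ε) * (r - 1ℚ) - ε * Q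
            ≡⟨ cong₂ (λ a b → ℕ→ℚ 4 * a * r - m * b * (r - 1ℚ) - ε * Q) Aε Bε ⟩
          ℕ→ℚ 4 * (ω * (ℕ→ℚ (length ps) - 1ℚ + ℕ→ℚ 2 * ε)) * r - m * (ω₁ * (R₁ - 1ℚ + ε′ + ε)) * (r - 1ℚ) - ε * Q
            ≡⟨ cong₂ (λ s σ → ℕ→ℚ 4 * (ω * (s - 1ℚ + ℕ→ℚ 2 * (1ℚ - σ))) * r - m * (ω₁ * (R₁ - 1ℚ + ε′ + (1ℚ - σ))) * (r - 1ℚ) - (1ℚ - σ) * Q) s≡ σ≡ ⟩
          _ ≡⟨ eq₂ ω ω₁ r m R₁ R₂ σ₁ σ₂ Q ⟩
          Θ ps₁ * Y₁ + Θ ps₂ * Y₂ - (1ℚ - (σ₁ + σ₂)) * (Q - Y₁)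
            ≡⟨ cong (λ σ → Θ ps₁ * Y₁ + Θ ps₂ * Y₂ - (1ℚ - σ) * (Q - Y₁)) σ≡ ⟨
          Θ ps₁ * Y₁ + Θ ps₂ * Y₂ - ε * (Q - Y₁) ∎))
          where
          open ≡-Reasoning
          open Bounds 0≤r q≤r²
          Q = ℕ→ℚ (q ℕ.+ 1)
          ω = W# K
          ω₁ = W₁# K
          Y₁ = ℕ→ℚ 4 * ω * r - m * ω₁ * (r - 1ℚ)
          Y₂ = ℕ→ℚ 4 * ω * r
          g : ℕ → ℚ
          g p = bound₄ K (p ∷ [])
          eq₁ : ∀ e a b m r q → e * ((ℕ→ℚ 4 * a - m * b) * r + m * b) - e * q ≡ ℕ→ℚ 4 * (a * e) * r - m * (b * e) * (r - 1ℚ) - e * q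
          eq₁ = solve-∀ ringℚ
          eq₂ : ∀ w w₁ r m R₁ R₂ σ₁ σ₂ Q →
            ℕ→ℚ 4 * (w * (R₁ + R₂ - 1ℚ + ℕ→ℚ 2 * (1ℚ - (σ₁ + σ₂)))) * r - m * (w₁ * (R₁ - 1ℚ + (1ℚ - σ₁) + (1ℚ - (σ₁ + σ₂)))) * (r - 1ℚ) - (1ℚ - (σ₁ + σ₂)) * Q ≡
            (R₁ - σ₁) * (ℕ→ℚ 4 * w * r - m * w₁ * (r - 1ℚ)) + (R₂ - σ₂) * (ℕ→ℚ 4 * w * r) - (1ℚ - (σ₁ + σ₂)) * (Q - (ℕ→ℚ 4 * w * r - m * w₁ * (r - 1ℚ)))
          eq₂ = solve-∀ ringℚ
          total : ∑ₗ (λ p → (1ℚ - recipℕ p) * g p) ps ≡ Θ ps₁ * Y₁ + Θ ps₂ * Y₂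
          total = trans (∑ₗ-++ (λ p → (1ℚ - recipℕ p) * g p) ps₁ ps₂) (cong₂ _+_
            (∑ₗ-Θ g Y₁ (All.map (λ p∣ → trans (bound₄-∣ 0≤r q≤r² K p∣) (bound₄-[] 0≤r q≤r² mult K)) ps₁∣))
            (∑ₗ-Θ g Y₂ (All.map (bound₄-∤ 0≤r q≤r² K) ps₂∤)))
          sieved : ε * (Q - Y₁) ≤ Θ ps₁ * Y₁ + Θ ps₂ * Y₂
          sieved = subst₂ (λ y s → ε * (Q - y) ≤ s) (bound₄-[] 0≤r q≤r² mult K) total (sieve hK uK hps disj (<⇒≤ 0<ε) none)

        not-GtAffineSqrt : ¬ GtAffineSqrt (ℕ→ℚ (q ℕ.+ 1)) (ℕ→ℚ 4 * A - m * B) (m * B) q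
        not-GtAffineSqrt h = from (√-separation q (ℕ→ℚ (q ℕ.+ 1) - m * B) c h)
          where
          c = ℕ→ℚ 4 * A - m * B
          eq : ∀ a b → a - b + b ≡ a
          eq = solve-∀ ringℚ
          from : ¬ (∃ λ r → SqrtUpperBound q r × c * r < ℕ→ℚ (q ℕ.+ 1) - m * B)
          from (r , ub , cr<x) = <-irrefl refl (<-≤-trans
            (subst (c * r + m * B <_) (eq (ℕ→ℚ (q ℕ.+ 1)) (m * B)) (+-monoˡ-< (m * B) cr<x)) (q+1≤ ub))

        not-SqrtGe : ¬ SqrtGe q (ℕ→ℚ 4 * A)
        not-SqrtGe (inj₁ 4A≤0) = <-irrefl refl (<-≤-trans (0<* {ℕ→ℚ 4} (positive⁻¹ (ℕ→ℚ 4)) 0<A) 4A≤0)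
        not-SqrtGe (inj₂ h) = from (√-product q (0<* {ℕ→ℚ 4} (positive⁻¹ (ℕ→ℚ 4)) 0<A) h)
          where
          0≤m : 0ℚ ≤ m
          0≤m = by mult
            where
            by : Multiplicity m → 0ℚ ≤ m
            by (inj₁ (_ , refl)) = 0≤ℕ→ℚ 4
            by (inj₂ (_ , refl)) = 0≤ℕ→ℚ 2
          eq : ∀ y b r → y * r - ((y - b) * r + b) ≡ b * (r - 1ℚ)
          eq = solve-∀ ringℚ
          eq′ : ∀ a → a + 1ℚ - a ≡ 1ℚ
          eq′ = solve-∀ ringℚ
          q<q+1 : ℕ→ℚ q < ℕ→ℚ (q ℕ.+ 1)
          q<q+1 = <-from (positive⁻¹ 1ℚ) (trans (cong (_- ℕ→ℚ q) (ℕ→ℚ-+ q 1)) (eq′ (ℕ→ℚ q)))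
          from : ¬ (∃ λ r → SqrtUpperBound q r × ℕ→ℚ 4 * A * r ≤ ℕ→ℚ q)
          from (r , ub@(0≤r , q≤r²) , yr≤q) = <-irrefl refl (<-≤-trans q<q+1 (≤-trans (q+1≤ ub) (≤-trans drop yr≤q)))
            where
            1≤r : 1ℚ ≤ r
            1≤r = sq-cancel-≤ 0≤r (≤-trans (ℕ→ℚ-mono-≤ {1} {q} (ℕ.>-nonZero⁻¹ q)) q≤r²)
            -- The saving m·B·(r - 1) is nonnegative and is given away; then q + 1 ≤ 4A·r ≤ q is
            -- absurd.
            drop : (ℕ→ℚ 4 * A - m * B) * r + m * B ≤ ℕ→ℚ 4 * A * r
            drop = ≤-from (0≤* (0≤* 0≤m 0≤B) (≤⇒0≤ 1≤r)) (eq (ℕ→ℚ 4 * A) (m * B) r)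

-- Transport of the given field to `Fin n`.

module Transport where

  open FieldBasics
  open Lines
  open import Defs
  open import Algebra.Bundles using (CommutativeRing; RawRing)
  import Algebra.Morphism.RingMonomorphism as RingMonomorphism
  open import Algebra.Morphism.Structures using (IsRingMonomorphism)
  open import Data.Fin using (Fin)
  open import Data.Empty using (⊥-elim)
  open import Data.Nat as ℕ using (ℕ; zero; suc)
  import Data.Nat.Properties as ℕ
  open import Data.Nat.Divisibility using (_∣_; divides; ∣1⇒≡1)
  open import Data.Nat.Primality using (euclidsLemma; prime[2]; prime⇒nonTrivial)
  open import Data.Product using (_,_)
  open import Data.Sum using (inj₁; inj₂)
  open import Relation.Nullary using (¬_)
  open import Relation.Binary.PropositionalEquality

  module FinCopy {n : ℕ} (F : FiniteField n) where
    open FiniteField F renaming (trans to ≈trans; sym to ≈sym)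

    fromFin-injective : ∀ {i j} → fromFin i ≈ fromFin j → i ≡ j
    fromFin-injective {i} {j} h = trans (sym (to∘from i)) (trans (toFin-cong h) (to∘from j))

    fromFin-cong : ∀ {i j} → i ≡ j → fromFin i ≈ fromFin j
    fromFin-cong e = reflexive (cong fromFin e)

    finRing : RawRing _ _
    finRing = record
      { Carrier = Fin n
      ; _≈_ = _≡_
      ; _+_ = λ i j → toFin (fromFin i + fromFin j)
      ; _*_ = λ i j → toFin (fromFin i * fromFin j)
      ; -_  = λ i → toFin (- fromFin i)
      ; 0#  = toFin 0#
      ; 1#  = toFin 1#
      }

    -- The operations of the copy are conjugates of the given ones, so the ring laws can be pulled
    -- back along `fromFin`.
    fromFin-mono : IsRingMonomorphism finRing (CommutativeRing.rawRing commRing) fromFin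
    fromFin-mono = record
      { isRingHomomorphism = record
        { isSemiringHomomorphism = record
          { isNearSemiringHomomorphism = record
            { +-isMonoidHomomorphism = record
              { isMagmaHomomorphism = record
                { isRelHomomorphism = record { cong = fromFin-cong }
                ; homo = λ i j → from∘to _
                }
              ; ε-homo = from∘to 0#
              }
            ; *-homo = λ i j → from∘to _
            }
          ; 1#-homo = from∘to 1#
          }
        ; -‿homo = λ i → from∘to _
        }
      ; injective = fromFin-injective
      }

    finField : FinField n
    finField = record
      { _⊕_ = RawRing._+_ finRing
      ; _⊗_ = RawRing._*_ finRing
      ; ⊖_  = RawRing.-_ finRing
      ; 𝟘   = toFin 0#
      ; 𝟙   = toFin 1#
      ; isCommutativeRing = RingMonomorphism.isCommutativeRing fromFin-mono (CommutativeRing.isCommutativeRing commRing)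
      ; 𝟙≢𝟘 = λ e → 1≉0 (≈trans (≈sym (from∘to 1#)) (≈trans (fromFin-cong e) (from∘to 0#)))
      ; inverse = λ i ne → let (y , e) = inverse (fromFin i) (λ h → ne (trans (sym (to∘from i)) (toFin-cong h)))
          in toFin y , toFin-cong (≈trans (*-cong (reflexive refl) (from∘to y)) e)
      }

    module _ (q : ℕ) where
      open FieldTheory finField using (_^_)

      fromFin-^ : ∀ i d → fromFin (i ^ d) ≈ pow F q (fromFin i) d
      fromFin-^ i zero    = from∘to 1#
      fromFin-^ i (suc d) = ≈trans (from∘to _) (*-cong (reflexive refl) (fromFin-^ i d))

      pow-cong : ∀ {x y} d → x ≈ y → pow F q x d ≈ pow F q y d
      pow-cong zero    h = reflexive refl
      pow-cong (suc d) h = *-cong h (pow-cong d h)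

      toFin-^ : ∀ x d → toFin (pow F q x d) ≡ toFin x ^ d
      toFin-^ x d = fromFin-injective (≈trans (from∘to _) (≈trans (pow-cong d (≈sym (from∘to x))) (≈sym (fromFin-^ (toFin x) d))))

      fixed⇒InFq : ∀ {i} → i ^ q ≡ i → InFq F q (fromFin i)
      fixed⇒InFq {i} h = ≈trans (≈sym (fromFin-^ i q)) (fromFin-cong h)

      InFq⇒fixed : ∀ {x} → InFq F q x → toFin x ^ q ≡ toFin x
      InFq⇒fixed {x} h = trans (sym (toFin-^ x q)) (toFin-cong h)

  1<oddPrimePower : ∀ {q} → OddPrimePower q → 1 ℕ.< q
  1<oddPrimePower (p , suc e , pp , _ , _ , refl) =
    ℕ.<-≤-trans (ℕ.nonTrivial⇒n>1 p) (ℕ.m≤m*n p (p ℕ.^ e) {{ℕ.m^n≢0 p e}})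
    where
    instance
      _ = prime⇒nonTrivial pp
      _ = ℕ.nonTrivial⇒nonZero p

  oddPrimePower-odd : ∀ {q} → OddPrimePower q → ¬ (2 ∣ q)
  oddPrimePower-odd (p , e , pp , odd , _ , refl) = go e
    where
    go : ∀ e → ¬ (2 ∣ p ℕ.^ e)
    go zero h with () ← ∣1⇒≡1 h
    go (suc e) h with euclidsLemma p (p ℕ.^ e) prime[2] h
    ... | inj₁ t = odd t
    ... | inj₂ t = go e t

  odd⇒2∣1+ : ∀ q → ¬ (2 ∣ q) → 2 ∣ q ℕ.+ 1
  odd⇒2∣1+ zero odd = ⊥-elim (odd (divides 0 refl))
  odd⇒2∣1+ (suc zero) odd = divides 1 refl
  odd⇒2∣1+ (suc (suc q)) odd with odd⇒2∣1+ q (λ { (divides c e) → odd (divides (suc c) (cong (2 ℕ.+_) e)) })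
  ... | divides c e = divides (suc c) (cong (2 ℕ.+_) e)

  module _ {q : ℕ} (opp : OddPrimePower q) (F : FiniteField (q ℕ.^ 2)) where
    open FiniteField F renaming (trans to ≈trans; sym to ≈sym)
    open FinCopy F

    lineData : ∀ {θ₁ θ₂} → IsFqBasis F q θ₁ θ₂ → LineData finField
    lineData {θ₁} {θ₂} (indep , span) = record
      { q = q
      ; 1<q = 1<oddPrimePower opp
      ; n≡q*q = cong (q ℕ.*_) (ℕ.*-identityʳ q)
      ; frobenius-q = frob opp
      ; θ₁ = toFin θ₁
      ; θ₂ = toFin θ₂
      ; independent = λ a b ha hb e →
          let (h₁ , h₂) = indep (fromFin a) (fromFin b) (fixed⇒InFq q ha) (fixed⇒InFq q hb)
                (≈trans (≈sym (fromFin-comb a b)) (≈trans (fromFin-cong e) (from∘to 0#)))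
          in trans (sym (to∘from a)) (toFin-cong h₁) , trans (sym (to∘from b)) (toFin-cong h₂)
      ; spanning = λ ξ → let (a , b , ha , hb , e) = span (fromFin ξ) in
          toFin a , toFin b , InFq⇒fixed q ha , InFq⇒fixed q hb ,
          fromFin-injective (≈trans e (≈sym (≈trans (fromFin-comb (toFin a) (toFin b))
            (+-cong (*-cong (from∘to a) (reflexive refl)) (*-cong (from∘to b) (reflexive refl))))))
      }
      where
      open FieldTheory finField using (_⊕_; _⊗_; _^_; frobenius^)
      fromFin-comb : ∀ a b → fromFin (a ⊗ toFin θ₁ ⊕ b ⊗ toFin θ₂) ≈ fromFin a * θ₁ + fromFin b * θ₂
      fromFin-comb a b = ≈trans (from∘to _) (+-cong
        (≈trans (from∘to _) (*-cong (reflexive refl) (from∘to θ₁)))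
        (≈trans (from∘to _) (*-cong (reflexive refl) (from∘to θ₂))))
      frob : OddPrimePower q → ∀ x y → (x ⊕ y) ^ q ≡ x ^ q ⊕ y ^ q
      frob (p , e , pp , _ , _ , q≡) x y = subst (λ t → (x ⊕ y) ^ t ≡ x ^ t ⊕ y ^ t) (sym q≡)
        -- The field has p^(2e) elements, while the q-th power map is the e-fold Frobenius.
        (frobenius^ {p} {e ℕ.* 2} pp (trans (cong (ℕ._^ 2) q≡) (ℕ.^-*-assoc p e 2)) e x y)

-- Prime divisors and the function ν.

module NumberTheory where

  open import Defs
  open import Data.List using (List; []; _∷_; length; upTo)
  open import Data.List.Membership.Propositional using (_∈_)
  open import Data.List.Membership.Propositional.Properties using (∈-filter⁺; ∈-filter⁻; ∈-upTo⁺)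
  open import Data.List.Membership.Propositional.Properties.WithK using (unique∧set⇒bag)
  open import Data.List.Relation.Binary.BagAndSetEquality using (∼bag⇒↭)
  open import Data.List.Relation.Binary.Permutation.Propositional.Properties using (↭-length)
  open import Data.List.Relation.Unary.All as All using (All)
  open import Data.List.Relation.Unary.Unique.Propositional using (Unique)
  import Data.List.Relation.Unary.Unique.Propositional.Properties as Unique
  open import Data.Nat as ℕ using (ℕ; suc; NonZero)
  import Data.Nat.Properties as ℕ
  open import Data.Nat.Divisibility using (_∣_; _∣?_; ∣⇒≤; m∣m*n)
  open import Data.Nat.ListAction using (product)
  open import Data.Nat.Primality using (Prime; prime?; productOfPrimes≢0)
  open import Data.Nat.Primality.Factorisation using (factorise; factorisationHasAllPrimeFactors)
  open import Data.Product using (∃; _×_; _,_; proj₂)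
  open import Function.Bundles using (mk⇔)
  open import Relation.Binary.PropositionalEquality
  open import Relation.Nullary using (contradiction)
  open import Relation.Nullary.Decidable using (_×-dec_)
  open Sieve using (∈⇒∣product)

  module _ (m : ℕ) where
    private
      isDivisor? = λ p → prime? p ×-dec p ∣? m

    primeDivisors-unique : Unique (primeDivisors m)
    primeDivisors-unique = Unique.filter⁺ isDivisor? (Unique.upTo⁺ (suc m))

    ∈-primeDivisors⁻ : ∀ {p} → p ∈ primeDivisors m → Prime p × p ∣ m
    ∈-primeDivisors⁻ h = proj₂ (∈-filter⁻ isDivisor? {xs = upTo (suc m)} h)

    ∈-primeDivisors⁺ : ∀ {p} → .{{NonZero m}} → Prime p → p ∣ m → p ∈ primeDivisors m
    ∈-primeDivisors⁺ pp p∣m = ∈-filter⁺ isDivisor? (∈-upTo⁺ (ℕ.s≤s (∣⇒≤ p∣m))) (pp , p∣m)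

  -- Serves to identify W(k₁) with `W₁#`. Both lists are free of repetitions and have the same
  -- members, so one is a permutation of the other.
  ν-product : ∀ {L} → Unique L → All Prime L → ν (product L) ≡ length L
  ν-product {L} uL pL = ↭-length (∼bag⇒↭ (unique∧set⇒bag (primeDivisors-unique (product L)) uL (mk⇔
    (λ h → let (pp , p∣) = ∈-primeDivisors⁻ (product L) h in factorisationHasAllPrimeFactors pp p∣ pL)
    (λ h → ∈-primeDivisors⁺ (product L) {{productOfPrimes≢0 pL}} (All.lookup pL h) (∈⇒∣product h)))))

  -- Reduces freeness to prime exponents: a d-th power is also a p-th power for each prime p
  -- dividing d.
  ∃-primeDivisor : ∀ d → .{{NonZero d}} → d ≢ 1 → ∃ λ p → Prime p × p ∣ d
  ∃-primeDivisor d d≢1 with factorise d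
  ... | record { factors = [] ; isFactorisation = e } = contradiction e d≢1
  ... | record { factors = p ∷ ps ; isFactorisation = e ; factorsPrime = pp All.∷ _ } =
    p , pp , subst (p ∣_) (sym e) (m∣m*n (product ps))

-- From a good point of the line to nonvanishing.

module Existence where
  open Sieve
  open Estimates
  open NumberTheory
  open Transport
  open import Defs
  open import Data.Empty using (⊥-elim)
  open import Data.Fin.Properties using (_≟_; any?)
  open import Data.List using (List; []; _∷_; _++_; length)
  open import Data.List.Relation.Unary.All as All using (All; []; _∷_)
  import Data.List.Relation.Unary.All.Properties as All
  open import Data.List.Relation.Unary.Unique.Propositional using (Unique)
  import Data.List.Relation.Unary.Unique.Propositional.Properties as Unique
  open import Data.Nat as ℕ using (ℕ; NonZero)
  import Data.Nat.Properties as ℕ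
  open import Data.Nat.Divisibility using (_∣_; _∣?_; divides; ∣-trans; m∣m*n; n∣m*n; 0∣⇒≡0; n∣m⇒m%n≡0; m%n≡0⇒n∣m)
  open import Data.Nat.DivMod using (%-distribˡ-+)
  open import Data.Nat.ListAction using (product)
  open import Data.Nat.Primality using (Prime; euclidsLemma; productOfPrimes≢0)
  open import Data.Nat.Primality.Factorisation using (factorisationHasAllPrimeFactors)
  open import Data.Product using (_×_; _,_; proj₁; proj₂)
  open import Data.Rational as ℚ using (ℚ; 0ℚ; 1ℚ)
  open import Data.Sum using (_⊎_; inj₁; inj₂)
  open import Function.Bundles using (Equivalence)
  open import Relation.Binary.PropositionalEquality
  open import Relation.Nullary using (¬_; Dec; yes; no)
  open import Relation.Nullary.Decidable using (¬?; _×-dec_)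

  module _ {q : ℕ} (opp : OddPrimePower q) (F : FiniteField (q ℕ.^ 2)) {θ₁ θ₂ : FiniteField.Carrier F}
    (basis : IsFqBasis F q θ₁ θ₂) where

    2∣q+1 : 2 ∣ q ℕ.+ 1
    2∣q+1 = odd⇒2∣1+ q (oddPrimePower-odd opp)

    open FiniteField F using (_≈_; _+_; _*_; 0#; toFin; fromFin; toFin-cong; from∘to; to∘from; +-cong; *-cong; reflexive)
      renaming (trans to ≈trans; sym to ≈sym)
    open FinCopy F
    private
      𝓛 = lineData opp F basis
    open EstimateTheory 𝓛 2∣q+1 using (_^_; 𝟘; 𝟙; E; N; line; line-nonzero; inSub?; InSub; fermat; ^-nonzero;
      ^-assocʳ; root⇒power; N≡p*E; pd2; N≡4*E₄; E₂≢0; E₄≢0; OddPrimeDivisor; N≢0; 𝟘^;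
      Multiplicity; W₁#; not-GtAffineSqrt; not-SqrtGe)

    private
      fromFin-line : ∀ α → fromFin (line α) ≈ θ₁ + fromFin α * θ₂
      fromFin-line α = ≈trans (from∘to _) (+-cong (from∘to θ₁)
        (≈trans (from∘to _) (*-cong (reflexive refl) (from∘to θ₂))))

      line≡^ : ∀ {α} d {ζ} → θ₁ + fromFin α * θ₂ ≈ pow F q ζ d → line α ≡ toFin ζ ^ d
      line≡^ {α} d {ζ} h = trans (sym (to∘from (line α)))
        (trans (toFin-cong (≈trans (fromFin-line α) h)) (toFin-^ q ζ d))

      power-root : ∀ {d e z} c → z ≢ 𝟘 → N ≡ d ℕ.* e → (z ^ (c ℕ.* d)) ^ e ≡ 𝟙
      power-root {d} {e} {z} c nz N≡ = trans (^-assocʳ z (c ℕ.* d) e)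
        (trans (cong (z ^_) (trans (ℕ.*-assoc c d e) (cong (c ℕ.*_) (sym N≡))))
        (trans (sym (^-assocʳ z c N)) (fermat (^-nonzero nz c))))

    -- If the point were ζ^d with a prime p dividing d, its power with exponent E p would be a power
    -- of ζ^N = 1. So freeness needs only the primes dividing m. Being a square is the converse
    -- direction and comes from `root⇒power`.
    counted : ∀ {α m} → .{{NonZero m}} → InSub α → (∀ {p} → Prime p → p ∣ m → N ≡ p ℕ.* E p × line α ^ E p ≢ 𝟙) →
      line α ^ E 2 ≡ 𝟙 → line α ^ E 4 ≢ 𝟙 → QNonzero F q θ₁ θ₂ m
    counted {α} {m} hα nonpower sq non4 = fromFin α , fixed⇒InFq q hα , (nonzero , free) , square , nonfourth
      where
      nonzero : ¬ (θ₁ + fromFin α * θ₂ ≈ 0#)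
      nonzero h = line-nonzero hα (trans (sym (to∘from (line α))) (toFin-cong (≈trans (fromFin-line α) h)))
      free : ∀ d ζ → d ∣ m → ¬ (ζ ≈ 0#) → θ₁ + fromFin α * θ₂ ≈ pow F q ζ d → d ≡ 1
      free d ζ d∣m ζ≉0 h with d ℕ.≟ 1
      ... | yes e = e
      ... | no d≢1 with ∃-primeDivisor d {{ℕ.≢-nonZero (λ { refl → ℕ.≢-nonZero⁻¹ m (0∣⇒≡0 d∣m) })}} d≢1
      ...   | p , pp , divides c refl = ⊥-elim (proj₂ (nonpower pp (∣-trans (n∣m*n c) d∣m))
        (trans (cong (_^ E p) (line≡^ (c ℕ.* p) h)) (power-root {p} {E p} c ζ≢𝟘 (proj₁ (nonpower pp (∣-trans (n∣m*n c) d∣m))))))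
        where
        ζ≢𝟘 : toFin ζ ≢ 𝟘
        ζ≢𝟘 e = ζ≉0 (≈trans (≈sym (from∘to ζ)) (≈trans (fromFin-cong e) (from∘to 0#)))
      square : IsSquare F q (θ₁ + fromFin α * θ₂)
      square with root⇒power 2 (E 2) (N≡p*E pd2) sq
      ... | y , e = fromFin y , ≈trans (≈sym (fromFin-line α)) (≈trans (fromFin-cong (sym e)) (fromFin-^ q y 2))
      nonfourth : ¬ IsFourthPower F q (θ₁ + fromFin α * θ₂)
      nonfourth (ζ , h) = non4 (trans (cong (_^ E 4) (line≡^ 4 h)) (power-root {4} {E 4} 1 ζ≢𝟘 N≡4*E₄))
        where
        ζ≢𝟘 : toFin ζ ≢ 𝟘
        ζ≢𝟘 e = line-nonzero hα (trans (line≡^ 4 h) (trans (cong (_^ 4) e) (𝟘^ 4)))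

    module _ {ℓ q₂ q₂′ k : ℕ} {ps₁ ps₂ : List ℕ} (N≡2^ℓq₂ : (q ℕ.^ 2) ℕ.∸ 1 ≡ (2 ℕ.^ ℓ) ℕ.* q₂) (odd : ¬ (2 ∣ q₂))
      (rad : IsRadicalOf q₂ q₂′) (q₂′≡ : q₂′ ≡ k ℕ.* product (ps₁ ++ ps₂)) (primes : All Prime (ps₁ ++ ps₂))
      (∤k : All (λ p → ¬ (p ∣ k)) (ps₁ ++ ps₂)) where

      private
        pL = proj₁ (proj₂ (proj₂ rad))
        L⇔ = proj₁ (proj₂ (proj₂ (proj₂ rad)))
        ΠL≡ = proj₂ (proj₂ (proj₂ (proj₂ rad)))
        instance
          q₂′≢0 : NonZero q₂′
          q₂′≢0 = subst NonZero ΠL≡ (productOfPrimes≢0 pL)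
          k≢0 : NonZero k
          k≢0 = ℕ.m*n≢0⇒m≢0 k {product (ps₁ ++ ps₂)} {{subst NonZero q₂′≡ q₂′≢0}}

      K : List ℕ
      K = primeDivisors k

      prime∣q₂′⇒OddPrimeDivisor : ∀ {p} → Prime p → p ∣ q₂′ → OddPrimeDivisor p
      prime∣q₂′⇒OddPrimeDivisor {p} pp p∣ = (pp , subst (p ∣_) (sym N≡2^ℓq₂) (∣-trans p∣q₂ (n∣m*n (2 ℕ.^ ℓ))) , N≢0) ,
        λ { refl → odd p∣q₂ }
        where
        p∣q₂ : p ∣ q₂
        p∣q₂ = Equivalence.from (L⇔ p pp) (factorisationHasAllPrimeFactors pp (subst (p ∣_) (sym ΠL≡) p∣) pL)

      K-odd : All OddPrimeDivisor K
      K-odd = All.tabulate (λ h → let (pp , p∣k) = ∈-primeDivisors⁻ k h in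
        prime∣q₂′⇒OddPrimeDivisor pp (subst (_ ∣_) (sym q₂′≡) (∣-trans p∣k (m∣m*n _))))

      ps-odd : All OddPrimeDivisor (ps₁ ++ ps₂)
      ps-odd = All.tabulate (λ h → prime∣q₂′⇒OddPrimeDivisor (All.lookup primes h)
        (subst (_ ∣_) (sym q₂′≡) (∣-trans (∈⇒∣product h) (n∣m*n k))))

      ps-disjoint : All (λ p → All (p ≢_) K) (ps₁ ++ ps₂)
      ps-disjoint = All.map (λ p∤k → All.tabulate (λ { h refl → p∤k (proj₂ (∈-primeDivisors⁻ k h)) })) ∤k

      GoodPoint : _ → Set
      GoodPoint α = All (λ p → line α ^ E p ≢ 𝟙) K × All (λ p → line α ^ E p ≢ 𝟙) (ps₁ ++ ps₂) ×
        line α ^ E 2 ≡ 𝟙 × line α ^ E 4 ≢ 𝟙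

      goodPoint? : ∀ α → Dec (GoodPoint α)
      goodPoint? α = All.all? (λ p → ¬? (line α ^ E p ≟ 𝟙)) K ×-dec All.all? (λ p → ¬? (line α ^ E p ≟ 𝟙)) (ps₁ ++ ps₂)
        ×-dec (line α ^ E 2 ≟ 𝟙) ×-dec ¬? (line α ^ E 4 ≟ 𝟙)

      goodPoint⇒QNonzero : ∀ α → InSub α → GoodPoint α → QNonzero F q θ₁ θ₂ q₂′
      goodPoint⇒QNonzero α hα (freeK , freeps , sq , non4) = counted hα nonpower sq non4
        where
        nonpower : ∀ {p} → Prime p → p ∣ q₂′ → N ≡ p ℕ.* E p × line α ^ E p ≢ 𝟙
        nonpower {p} pp p∣ = N≡p*E (proj₁ (prime∣q₂′⇒OddPrimeDivisor pp p∣)) ,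
          by (euclidsLemma k (product (ps₁ ++ ps₂)) pp (subst (p ∣_) q₂′≡ p∣))
          where
          by : p ∣ k ⊎ p ∣ product (ps₁ ++ ps₂) → line α ^ E p ≢ 𝟙
          by (inj₁ p∣k) = All.lookup freeK (∈-primeDivisors⁺ k pp p∣k)
          by (inj₂ p∣Π) = All.lookup freeps (factorisationHasAllPrimeFactors pp p∣Π primes)

      -- The estimates only refute the absence of good points. As F is finite and goodness is
      -- decidable, an exhaustive search turns this into an actual α.
      search : QNonzero F q θ₁ θ₂ q₂′ ⊎ (∀ α → InSub α → ¬ GoodPoint α)
      search with any? (λ α → inSub? α ×-dec goodPoint? α)
      ... | yes (α , hα , good) = inj₁ (goodPoint⇒QNonzero α hα good)
      ... | no none = inj₂ (λ α hα good → none (α , hα , good))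

      module _ (ps₁∣ : All (λ p → p ∣ (q ℕ.+ 1)) ps₁) (ps₂∤ : All (λ p → ¬ (p ∣ (q ℕ.+ 1))) ps₂)
        (0<ε : 0ℚ ℚ.< 1ℚ ℚ.- sumRecip (ps₁ ++ ps₂)) where

        private
          A : ℚ
          A = ℕ→ℚ (W k) ℚ.* (((ℕ→ℚ (length (ps₁ ++ ps₂)) ℚ.- 1ℚ) ÷ℚ (1ℚ ℚ.- sumRecip (ps₁ ++ ps₂))) ℚ.+ ℕ→ℚ 2)

          B/W₁ : ℚ
          B/W₁ = (((ℕ→ℚ (length ps₁) ℚ.- 1ℚ) ℚ.+ (1ℚ ℚ.- sumRecip ps₁)) ÷ℚ (1ℚ ℚ.- sumRecip (ps₁ ++ ps₂))) ℚ.+ 1ℚ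

          W[k₁] : ℕ→ℚ (W (k₁Of k q)) ≡ W₁# K
          W[k₁] = cong (λ l → ℕ→ℚ (2 ℕ.^ l)) (ν-product
            (Unique.filter⁺ (λ p → p ∣? (q ℕ.+ 1)) (primeDivisors-unique k))
            (All.filter⁺ (λ p → p ∣? (q ℕ.+ 1)) (All.map (λ o → proj₁ (proj₁ o)) K-odd)))

        QNonzero-of-GtAffineSqrt : ∀ {m} → Multiplicity m →
          GtAffineSqrt (ℕ→ℚ (q ℕ.+ 1)) ((ℕ→ℚ 4 ℚ.* A) ℚ.- (m ℚ.* (ℕ→ℚ (W (k₁Of k q)) ℚ.* B/W₁)))
            (m ℚ.* (ℕ→ℚ (W (k₁Of k q)) ℚ.* B/W₁)) q →
          QNonzero F q θ₁ θ₂ q₂′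
        QNonzero-of-GtAffineSqrt {m} mult h = by search
          where
          by : QNonzero F q θ₁ θ₂ q₂′ ⊎ (∀ α → InSub α → ¬ GoodPoint α) → QNonzero F q θ₁ θ₂ q₂′
          by (inj₁ found) = found
          by (inj₂ none) = ⊥-elim (not-GtAffineSqrt K-odd (primeDivisors-unique k) ps-odd ps-disjoint ps₁∣ ps₂∤ 0<ε mult none
            (subst (λ w₁ → GtAffineSqrt (ℕ→ℚ (q ℕ.+ 1)) ((ℕ→ℚ 4 ℚ.* A) ℚ.- (m ℚ.* (w₁ ℚ.* B/W₁))) (m ℚ.* (w₁ ℚ.* B/W₁)) q) W[k₁] h))

        -- The case distinction on 4 ∣ q + 1 only selects the multiplicity m; `not-SqrtGe` covers
        -- both values.
        QNonzero-of-SqrtGe : SqrtGe q (ℕ→ℚ 4 ℚ.* A) → QNonzero F q θ₁ θ₂ q₂′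
        QNonzero-of-SqrtGe h = by search (4 ∣? (q ℕ.+ 1))
          where
          by : QNonzero F q θ₁ θ₂ q₂′ ⊎ (∀ α → InSub α → ¬ GoodPoint α) → Dec (4 ∣ q ℕ.+ 1) → QNonzero F q θ₁ θ₂ q₂′
          by (inj₁ found) _ = found
          by (inj₂ none) (yes 4∣) =
            ⊥-elim (not-SqrtGe K-odd (primeDivisors-unique k) ps-odd ps-disjoint ps₁∣ ps₂∤ 0<ε (inj₁ (4∣ , refl)) none h)
          by (inj₂ none) (no 4∤) =
            ⊥-elim (not-SqrtGe K-odd (primeDivisors-unique k) ps-odd ps-disjoint ps₁∣ ps₂∤ 0<ε (inj₂ (4∤ , refl)) none h)

  %4≡1⇒4∤1+ : ∀ q → q ℕ.% 4 ≡ 1 → ¬ (4 ∣ q ℕ.+ 1)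
  %4≡1⇒4∤1+ q e h with () ← trans (sym (n∣m⇒m%n≡0 (q ℕ.+ 1) 4 h)) (trans (%-distribˡ-+ q 1 4) (cong (λ t → (t ℕ.+ 1) ℕ.% 4) e))

  %4≡3⇒4∣1+ : ∀ q → q ℕ.% 4 ≡ 3 → 4 ∣ q ℕ.+ 1
  %4≡3⇒4∣1+ q e = m%n≡0⇒n∣m (q ℕ.+ 1) 4 (trans (%-distribˡ-+ q 1 4) (cong (λ t → (t ℕ.+ 1) ℕ.% 4) e))

open Existence
open import Data.Product using (_,_)
open import Data.Sum using (inj₁; inj₂)
open import Relation.Binary.PropositionalEquality using (refl)

open import Defs
open import Data.Nat using (ℕ; _+_; _*_; _^_; _∸_; _%_)
open import Data.Nat.Divisibility using (_∣_)
open import Data.Nat.Primality using (Prime)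
open import Data.Nat.ListAction using (product)
open import Data.List using (List; _++_; length)
open import Data.List.Relation.Unary.All using (All)
open import Data.List.Relation.Unary.Unique.Propositional using (Unique)
open import Data.Rational as ℚ using (ℚ; 0ℚ; 1ℚ)
open import Data.Product using (_×_)
open import Relation.Nullary using (¬_)
open import Relation.Binary.PropositionalEquality using (_≡_)

theorem8p5 :
    (q : ℕ) → OddPrimePower q →
    (F : FiniteField (q ^ 2)) →
    (β θ₁ θ₂ : FiniteField.Carrier F) → Setup F q β θ₁ θ₂ →
    (ℓ q₂ : ℕ) → (q ^ 2) ∸ 1 ≡ (2 ^ ℓ) * q₂ → ¬ (2 ∣ q₂) →
    (q₂′ : ℕ) → IsRadicalOf q₂ q₂′ →
    (k : ℕ) (ps₁ ps₂ : List ℕ) →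
    q₂′ ≡ k * product (ps₁ ++ ps₂) →
    All Prime (ps₁ ++ ps₂) → Unique (ps₁ ++ ps₂) →
    All (λ p → ¬ (p ∣ k)) (ps₁ ++ ps₂) →
    All (λ p → p ∣ (q + 1)) ps₁ → All (λ p → ¬ (p ∣ (q + 1))) ps₂ →
    let s = length (ps₁ ++ ps₂)
        r = length ps₁
        ε = 1ℚ ℚ.- sumRecip (ps₁ ++ ps₂)
        ε′ = 1ℚ ℚ.- sumRecip ps₁
        A = ℕ→ℚ (W k) ℚ.* (((ℕ→ℚ s ℚ.- 1ℚ) ÷ℚ ε) ℚ.+ ℕ→ℚ 2)
        B = ℕ→ℚ (W (k₁Of k q))
              ℚ.* ((((ℕ→ℚ r ℚ.- 1ℚ) ℚ.+ ε′) ÷ℚ ε) ℚ.+ 1ℚ)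
    in
    0ℚ ℚ.< ε →
    -- (1) q ≡ 1 mod 4 and q+1 > 4[A√q − B(√q−1)/2] = (4A − 2B)√q + 2B
    ((q % 4 ≡ 1 →
      GtAffineSqrt (ℕ→ℚ (q + 1))
        ((ℕ→ℚ 4 ℚ.* A) ℚ.- (ℕ→ℚ 2 ℚ.* B)) (ℕ→ℚ 2 ℚ.* B) q →
      QNonzero F q θ₁ θ₂ q₂′)
    -- (2) q ≡ 3 mod 4 and q+1 > 4[A√q − B(√q−1)] = (4A − 4B)√q + 4B
    × (q % 4 ≡ 3 →
      GtAffineSqrt (ℕ→ℚ (q + 1))
        ((ℕ→ℚ 4 ℚ.* A) ℚ.- (ℕ→ℚ 4 ℚ.* B)) (ℕ→ℚ 4 ℚ.* B) q →
      QNonzero F q θ₁ θ₂ q₂′)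
    -- in particular: √q ≥ 4 W(k) ((s−1)/ε + 2)
    × (SqrtGe q (ℕ→ℚ 4 ℚ.* A) → QNonzero F q θ₁ θ₂ q₂′))
theorem8p5 q opp F β θ₁ θ₂ (_ , _ , basis , _) ℓ q₂ N≡ odd q₂′ rad k ps₁ ps₂ q₂′≡ primes _ ∤k ps₁∣ ps₂∤ 0<ε =
  (λ q%4≡1 → QNonzero-of-GtAffineSqrt opp F basis {ℓ} N≡ odd rad q₂′≡ primes ∤k ps₁∣ ps₂∤ 0<ε
    -- The quartic characters are nontrivial on 𝔽_q* here, so m = 2.
    (inj₂ (%4≡1⇒4∤1+ q q%4≡1 , refl))) ,
  (λ q%4≡3 → QNonzero-of-GtAffineSqrt opp F basis {ℓ} N≡ odd rad q₂′≡ primes ∤k ps₁∣ ps₂∤ 0<ε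
    -- The quartic characters are trivial on 𝔽_q* here, so m = 4 and the saving doubles.
    (inj₁ (%4≡3⇒4∣1+ q q%4≡3 , refl))) ,
  QNonzero-of-SqrtGe opp F basis {ℓ} N≡ odd rad q₂′≡ primes ∤k ps₁∣ ps₂∤ 0<ε
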